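{- Let $m,n\geq 1$ with $m\neq n$. Then there is no $*$-reduction from $(\mathrm{Mod}_\omega(\widehat{\mathcal{B}_m}),\simeq_{\mathrm{iso}})$ to $(\mathrm{Mod}_\omega(\widehat{\mathcal{B}_n}),\simeq_{\mathrm{iso}})$.
   Context: A map $f\colon X\to Y$ between Polish spaces is Baire measurable if preimages of open sets have the Baire property, and category preserving if preimages of meager sets are meager. A $*$-reduction from an equivalence relation $E$ on $X$ to an equivalence relation $F$ on $Y$ is a Baire measurable category preserving map $f\colon X\to Y$ such that $x\,E\,x'\iff f(x)\,F\,f(x')$ for all $x,x'\in X$. For $n\ge1$, $\mathcal{L}_n$ is the language with $n$-ary function symbols $s_i$ ($i\in\omega$) and $n$-ary relation symbols $R_j$ ($j\in\omega$). A BKL$_n$-structure is an $\mathcal{L}_n$-structure $A$ (possibly empty) such that: (B1) the relations $(R_j)_{j\in\omega}$ partition $A^n$; (B2) if $a=(a_0,\dots,a_{n-1})$ satisfies $R_j$, then $s_i(a)=a_0$ for all $i>j$; (B3) for every $B\subseteq A$ with $|B|=n+1$ there is $b\in B$ lying in the substructure generated by $B\setminus\{b\}$; (B4) $A$ is locally finite, i.e. every finitely generated substructure is finite. $\mathcal{B}_n$ is the class of all BKL$_n$-structures. Let $\widehat{\mathcal{L}_n}=\mathcal{L}_n\cup\{P_i\mid i\in\omega\}$ with $P_i$ new unary relation symbols; $\widehat{\mathcal{B}_n}$ is the class of $\widehat{\mathcal{L}_n}$-structures whose reduct to $\mathcal{L}_n$ is in $\mathcal{B}_n$ and in which no two distinct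 elements satisfy exactly the same predicates $P_i$. For a countable language $\mathcal{L}$, $\mathcal{X}_{\mathcal{L}}$ is the Polish space of all $\mathcal{L}$-structures with domain $\omega$, with subbasis the sets $\{A\mid A\models R(a)\}$, $\{A\mid A\models\lnot R(a)\}$, $\{A\mid A\models f(a)=b\}$, for $R,f$ relation and function symbols of $\mathcal{L}$, $a$ a tuple from $\omega$ of the right length and $b\in\omega$. $\mathrm{Mod}_\omega(\widehat{\mathcal{B}_n})$ is the subspace of $\mathcal{X}_{\widehat{\mathcal{L}_n}}$ of structures in $\widehat{\mathcal{B}_n}$ (it is $G_\delta$, hence Polish), and $\simeq_{\mathrm{iso}}$ is the isomorphism relation on it. -}

module Defs where

open import Data.Bool.Base using (Bool; true; false)
open import Data.List.Base using (List; length)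
open import Data.List.Membership.Propositional using () renaming (_∈_ to _∈ˡ_)
open import Data.List.Relation.Unary.All as List using ()
open import Data.List.Relation.Unary.Unique.Propositional using (Unique)
open import Data.Nat.Base using (ℕ; suc; NonZero; _<_)
open import Data.Product using (Σ; ∃-syntax; ∃!; _×_; _,_; proj₁)
open import Data.Sum.Base using (_⊎_; inj₁; inj₂; [_,_]′)
open import Data.Vec.Base using (Vec; []; _∷_; map)
open import Data.Vec.Relation.Unary.All using (All)
open import Function.Base using (_∘_; const; _on_)
open import Function.Bundles using (Func; Inverse; _⇔_; _↔_; _⟶ₛ_)
open import Level using (0ℓ)
open import Relation.Binary.Bundles using (Setoid)
open import Relation.Binary.Core using (Rel)
open import Relation.Binary.PropositionalEquality using (_≡_; _≢_; refl; sym; trans)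
open import Relation.Unary using (Pred; _∈_; _⊆_; _≐_; _≬_; _∪_; _∖_; ⋃; Empty)

-- A topological space presented by a subbasis.  Points are taken up to
-- the equality of the setoid.
record Space : Set₁ where
  field
    setoid : Setoid 0ℓ 0ℓ
  open Setoid setoid public using (_≈_) renaming (Carrier to Point)
  field
    Index : Set
    Sub   : Index → Pred Point 0ℓ
    resp  : ∀ i {x y} → x ≈ y → x ∈ Sub i → y ∈ Sub i

module Topology (X : Space) where
  open Space X

  Basic : List Index → Pred Point 0ℓ
  Basic is x = List.All (λ i → x ∈ Sub i) is

  Interior Closure : Pred Point 0ℓ → Pred Point 0ℓ
  Interior S x = ∃[ is ] x ∈ Basic is × Basic is ⊆ S
  Closure  S x = ∀ is → x ∈ Basic is → Basic is ≬ S

  Open : Pred Point 0ℓ → Set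
  Open U = U ⊆ Interior U

  NowhereDense : Pred Point 0ℓ → Set
  NowhereDense S = Empty (Interior (Closure S))

  Meager : Pred Point 0ℓ → Set₁
  Meager M = Σ (ℕ → Pred Point 0ℓ) λ N →
    (∀ i → NowhereDense (N i)) × M ≐ (⋃[ i ∶ ℕ ] N i)

  _△_ : Pred Point 0ℓ → Pred Point 0ℓ → Pred Point 0ℓ
  S △ T = (S ∖ T) ∪ (T ∖ S)

  BaireProperty : Pred Point 0ℓ → Set₁
  BaireProperty S = Σ (Pred Point 0ℓ) λ U → Open U × Meager (S △ U)

module _ (X Y : Space) where
  private
    module X = Topology X
    module Y = Topology Y
  open Space using (Point; setoid)

  BaireMeasurable : (Point X → Point Y) → Set₁
  BaireMeasurable f = ∀ U → Y.Open U → X.BaireProperty (U ∘ f)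

  CategoryPreserving : (Point X → Point Y) → Set₁
  CategoryPreserving f = ∀ M → Y.Meager M → X.Meager (M ∘ f)

  record *-Reduction (_E_ : Rel (Point X) 0ℓ) (_F_ : Rel (Point Y) 0ℓ) : Set₁ where
    field
      func : setoid X ⟶ₛ setoid Y
    open Func func public using () renaming (to to f)
    field
      baireMeasurable    : BaireMeasurable f
      categoryPreserving : CategoryPreserving f
      reduces            : ∀ x x′ → (x E x′) ⇔ (f x F f x′)

record Language : Set₁ where
  field
    FunSym RelSym : Set
    funArity : FunSym → ℕ
    relArity : RelSym → ℕ

-- Relations are two-valued: in the topology below both R(a) and ¬ R(a)
-- are subbasic conditions.
record Structure (L : Language) (A : Set) : Set where
  open Language L
  field
    fun : (s : FunSym) → Vec A (funArity s) → A
    rel : (r : RelSym) → Vec A (relArity r) → Bool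

open Structure public

module _ {L : Language} where
  open Language L

  data Generated {A : Set} (M : Structure L A) (S : Pred A 0ℓ) : Pred A 0ℓ where
    base : ∀ {a} → a ∈ S → a ∈ Generated M S
    app  : ∀ s {as} → All (Generated M S) as → fun M s as ∈ Generated M S

  LocallyFinite : {A : Set} → Structure L A → Set
  LocallyFinite {A} M =
    ∀ (S : List A) → ∃[ xs ] Generated M (_∈ˡ S) ≐ (_∈ˡ xs)

  record _≅_ {A B : Set} (M : Structure L A) (N : Structure L B) : Set where
    field
      bijection : A ↔ B
    open Inverse bijection public using (to)
    field
      fun-hom : ∀ s as → to (fun M s as) ≡ fun N s (map to as)
      rel-iso : ∀ r as → rel M r as ≡ rel N r (map to as)

  record _≗_ {A : Set} (M N : Structure L A) : Set where
    field
      fun-≗ : ∀ s as → fun M s as ≡ fun N s as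
      rel-≗ : ∀ r as → rel M r as ≡ rel N r as

  open _≗_

  ≗-setoid : Set → Setoid 0ℓ 0ℓ
  ≗-setoid A = record
    { Carrier = Structure L A
    ; _≈_ = _≗_
    ; isEquivalence = record
      { refl  = record { fun-≗ = λ _ _ → refl ; rel-≗ = λ _ _ → refl }
      ; sym   = λ p → record
        { fun-≗ = λ s as → sym (fun-≗ p s as)
        ; rel-≗ = λ r as → sym (rel-≗ p r as) }
      ; trans = λ p q → record
        { fun-≗ = λ s as → trans (fun-≗ p s as) (fun-≗ q s as)
        ; rel-≗ = λ r as → trans (rel-≗ p r as) (rel-≗ q r as) }
      }
    }

  data Condition : Set where
    holds fails : (r : RelSym) → Vec ℕ (relArity r) → Condition
    value       : (s : FunSym) → Vec ℕ (funArity s) → ℕ → Condition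

  ⟦_⟧ : Condition → Pred (Structure L ℕ) 0ℓ
  ⟦ holds r as   ⟧ M = rel M r as ≡ true
  ⟦ fails r as   ⟧ M = rel M r as ≡ false
  ⟦ value s as b ⟧ M = fun M s as ≡ b

  ⟦⟧-resp : ∀ c {M N} → M ≗ N → M ∈ ⟦ c ⟧ → N ∈ ⟦ c ⟧
  ⟦⟧-resp (holds r as)   p h = trans (sym (rel-≗ p r as)) h
  ⟦⟧-resp (fails r as)   p h = trans (sym (rel-≗ p r as)) h
  ⟦⟧-resp (value s as b) p h = trans (sym (fun-≗ p s as)) h

𝒳 : Language → Space
𝒳 L = record
  { setoid = ≗-setoid {L} ℕ
  ; Index  = Condition {L}
  ; Sub    = ⟦_⟧
  ; resp   = ⟦⟧-resp
  }

subspace : (X : Space) → Pred (Space.Point X) 0ℓ → Space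
subspace X C = record
  { setoid = record
    { Carrier = Σ Point C
    ; _≈_ = _≈_ on proj₁
    ; isEquivalence = record
      { refl  = Setoid.refl setoid
      ; sym   = Setoid.sym setoid
      ; trans = Setoid.trans setoid }
    }
  ; Index = Index
  ; Sub   = λ i → Sub i ∘ proj₁
  ; resp  = λ i → resp i
  }
  where open Space X

Class : Language → Set₁
Class L = ∀ {A : Set} → Structure L A → Set

Modω : ∀ {L} → Class L → Space
Modω {L} K = subspace (𝒳 L) K

Iso : ∀ {L} (K : Class L) → Rel (Space.Point (Modω K)) 0ℓ
Iso K = _≅_ on proj₁

data FunSymbol : Set where
  s : ℕ → FunSymbol

data RelSymbol : Set where
  R : ℕ → RelSymbol

ℒ : ℕ → Language
ℒ n = record
  { FunSym = FunSymbol
  ; RelSym = RelSymbol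
  ; funArity = const n
  ; relArity = const n
  }

first : ∀ {A : Set} {n} .{{_ : NonZero n}} → Vec A n → A
first (x ∷ _) = x

record BKL (n : ℕ) .{{_ : NonZero n}} {A : Set} (M : Structure (ℒ n) A) : Set where
  field
    -- Pieces of the partition may be empty, as they must be when A is finite.
    B1 : ∀ a → ∃! _≡_ λ j → rel M (R j) a ≡ true
    B2 : ∀ a j → rel M (R j) a ≡ true → ∀ i → j < i → fun M (s i) a ≡ first a
    B3 : ∀ (B : List A) → Unique B → length B ≡ suc n →
         ∃[ b ] b ∈ˡ B × b ∈ Generated M (λ x → x ∈ˡ B × x ≢ b)
    B4 : LocallyFinite M

𝓑 : (n : ℕ) .{{_ : NonZero n}} → Class (ℒ n)
𝓑 n = BKL n

data Predicate : Set where
  P : ℕ → Predicate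

expand : Language → Language
expand L = record
  { FunSym = FunSym
  ; RelSym = RelSym ⊎ Predicate
  ; funArity = funArity
  ; relArity = [ relArity , const 1 ]′
  }
  where open Language L

reduct : ∀ {L A} → Structure (expand L) A → Structure L A
reduct M = record { fun = fun M ; rel = rel M ∘ inj₁ }

ℒ̂ : ℕ → Language
ℒ̂ n = expand (ℒ n)

record BKL̂ (n : ℕ) .{{_ : NonZero n}} {A : Set} (M : Structure (ℒ̂ n) A) : Set where
  field
    reduct∈𝓑 : 𝓑 n (reduct M)
    separated : ∀ x y →
      (∀ i → rel M (inj₂ (P i)) (x ∷ []) ≡ rel M (inj₂ (P i)) (y ∷ [])) → x ≡ y

𝓑̂ : (n : ℕ) .{{_ : NonZero n}} → Class (ℒ̂ n)
𝓑̂ n = BKL̂ n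

module Submission where

-- Suppose first that m > n. A reduction f is continuous on a comeager set, and the type of an element is the set of
-- predicates P i which it satisfies. For generic x every element of x is determined by finitely many elements of f x,
-- and every element of f x by finitely many elements of x: otherwise some sequence in the class of x has a limit which
-- stays in the class on one side and realises a new type on the other. Being determined is forced by a finite
-- condition, so one finds a generic x containing m disjoint copies F 0, …, F (m - 1) of one finite substructure, such
-- that the union of any m - 1 of them is closed, each determining a finite set G i of elements of f x which in turn
-- determines an element a i of F i. Since n < m, axiom B3 for f x puts some G i into the closure of the other ones.
-- Amalgamating two copies of a large finite substructure over the union of the F j with j ≠ i yields a permutation that
-- fixes these F j, hence every G j including G i, but moves a i; this is impossible. If m < n, then f, being category
-- preserving, has a continuous right inverse on a comeager subset of a nonempty open set, and the argument applies to
-- this right inverse.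

open import Axiom.ExcludedMiddle using (ExcludedMiddle)
open import Data.Bool.Base using (Bool; T; false; true)
open import Data.Bool.Properties using (¬-not)
open import Data.Empty using (⊥)
open import Data.Fin.Base as Fin using (Fin; inject≤; toℕ)
open import Data.Fin.Properties using (inject≤-injective; pigeonhole; toℕ-fromℕ<; toℕ-injective; toℕ<n)
open import Data.List.Base as List using (List; []; _++_; _∷_; allFin; cartesianProduct; concatMap; length; upTo)
open import Data.List.Extrema.Nat using (max; xs≤max)
open import Data.List.Membership.Propositional using (find) renaming (_∈_ to _∈ˡ_)
open import Data.List.Membership.Propositional.Properties using (∈-++⁺ʳ; ∈-++⁺ˡ; ∈-allFin; ∈-cartesianProduct⁺;
  ∈-concatMap⁺; ∈-filter⁺; ∈-filter⁻; ∈-lookup; ∈-map⁺; ∈-map⁻; ∈-tabulate⁻; ∈-upTo⁺; ∈-upTo⁻)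
open import Data.List.Membership.Setoid.Properties using (index-injective)
open import Data.List.Properties using (length-map; length-tabulate)
open import Data.List.Relation.Unary.All as ListAll using ([]; _∷_)
open import Data.List.Relation.Unary.All.Properties using (++⁺; ++⁻ʳ; ++⁻ˡ; ¬All⇒Any¬)
import Data.List.Relation.Unary.All.Properties as ListAllₚ
import Data.List.Relation.Unary.AllPairs as AllPairs
open import Data.List.Relation.Unary.Any as Any using (here; there)
open import Data.List.Relation.Unary.Unique.Propositional using (Unique)
import Data.List.Relation.Unary.Unique.Propositional.Properties as Unique
open import Data.Nat.Base using (>-nonZero⁻¹; NonZero; _*_; _+_; _<_; _≤_; _≤′_; _⊔_; s<s; suc; s≤s; z<s; zero;
  z≤n; ℕ; ≤′-refl; ≤′-step)
open import Data.Nat.Induction using (<-wellFounded)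
open import Data.Nat.Properties using (*-monoˡ-≤; +-cancelʳ-≡; +-cancelˡ-≡; +-identityʳ; +-monoˡ-<; +-monoˡ-≤;
  +-suc; <-cmp; <-irrefl; <-trans; <-≤-trans; <⇒≢; <⇒≤; <⇒≱; _<?_; _≟_; _≤?_; m<1+n⇒m<n∨m≡n; m<n⇒m<1+n; m≢1+m+n;
  m≤m+n; m≤m⊔n; m≤n+m; m≤n⇒m<n∨m≡n; m≤n⊔m; suc-injective; ≡ᵇ⇒≡; ≤-pred; ≤-refl; ≤-reflexive; ≤-total; ≤-trans;
  ≤⇒≤′; ≮⇒≥; ≰⇒>; ⊔-lub)
open import Data.Product using (_,_; _×_; map₁; proj₁; proj₂; Σ; ∃)
open import Data.Sum.Base using ([_,_]; _⊎_; inj₁; inj₂)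
open import Data.Unit.Base using (tt; ⊤)
open import Data.Vec.Base as Vec using (Vec; []; _∷_)
open import Data.Vec.Properties using (map-cong; map-id; map-∘; toList∘fromList)
open import Data.Vec.Relation.Unary.All as VecAll using (All; []; _∷_)
import Data.Vec.Relation.Unary.All.Properties as VecAllₚ
open import Defs
open import Function.Base using (_∘_; case_of_; id)
open import Function.Bundles using (Equivalence; Inverse; mk↔ₛ′)
open import Function.Construct.Composition using (_↔-∘_)
open import Function.Construct.Identity using (↔-id)
open import Function.Construct.Symmetry using (↔-sym)
open import Induction.WellFounded using (Acc; acc)
open import Level using (0ℓ)
open import Relation.Binary.Bundles using (Setoid)
open import Relation.Binary.Definitions using (tri<; tri>; tri≈)
open import Relation.Binary.PropositionalEquality using (_≡_; _≢_; cong; cong₂; refl; subst; sym;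
  trans) renaming (setoid to ≡-setoid)
open import Relation.Nullary.Decidable using (dec-true)
open import Relation.Nullary.Decidable.Core using (Dec; True; decidable-stable; does; fromWitness; no; toWitness; yes)
open import Relation.Nullary.Negation using (contradiction; ¬_)
open import Relation.Unary using (Pred; _∈_; _∩_; _≐_; _⊆_)

-- The predicates `P` make all structures rigid: an isomorphism sends an element to the only one of
-- the same type. So `Same` replaces the tracking of isomorphisms. It compares infinitely many
-- predicates and need not be an open relation, hence the extra dense open sets `decisions`.
-- Movement inside a class uses only permutations of finite support: they form a countable group,
-- under which a countable family of dense open sets can be made invariant. The dimension enters
-- through the blocks. A tuple produces everything in the blocks it meets and nothing in a block it
-- misses, so the union of any m - 1 blocks is closed. B3 survives: two of m + 1 elements share a
-- block, and unless all lie in that block, one of the two is produced by the remaining elements.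
-- With m + 1 such blocks, one element from each would violate B3. The amalgamation takes place in
-- the larger of the two dimensions, which is at least 2. In dimension 1 it would fail: two
-- elements, one from each copy outside the common part, would violate B3.

module _ (em : ∀ ℓ → ExcludedMiddle ℓ) where

  -- Classical logic, countable sets, finite sets of numbers

  dec : ∀ {a} (A : Set a) → Dec A
  dec _ = em _

  by-contradiction : ∀ {a} {A : Set a} → ¬ ¬ A → A
  by-contradiction {A = A} = decidable-stable (dec A)

  ¬∀⇒∃¬ : ∀ {a b} {A : Set a} {B : A → Set b} → ¬ (∀ x → B x) → ∃ λ x → ¬ B x
  ¬∀⇒∃¬ ¬∀ = by-contradiction λ ¬∃ → ¬∀ λ x → by-contradiction λ ¬Bx → ¬∃ (x , ¬Bx)

  ¬→⇒× : ∀ {a b} {A : Set a} {B : Set b} → ¬ (A → B) → A × ¬ B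
  ¬→⇒× ¬f = by-contradiction (λ k → ¬f (λ a → by-contradiction λ ¬b → k (a , ¬b)))

  -- Meagerness lives in Set₁, whereas the sets of points considered are predicates in Set.
  Small : Set₁ → Set
  Small A = True (dec A)

  small : {A : Set₁} → A → Small A
  small = fromWitness

  large : {A : Set₁} → Small A → A
  large = toWitness

  Least : Pred ℕ 0ℓ → Pred ℕ 0ℓ
  Least Q k = Q k × (∀ j → j < k → ¬ Q j)

  least : (Q : Pred ℕ 0ℓ) → ∃ Q → ∃ (Least Q)
  least Q (k , q) = go k (<-wellFounded k) q
    where
    go : ∀ k → Acc _<_ k → Q k → ∃ (Least Q)
    go k (acc below) q with dec (∃ λ j → j < k × Q j)
    ... | yes (j , j<k , qj) = go j (below j<k) qj
    ... | no  none           = k , q , λ j j<k qj → none (j , j<k , qj)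

  Eventually : Pred ℕ 0ℓ → Set
  Eventually Q = ∃ λ k → ∀ j → k ≤ j → Q j

  eventually-× : {Q R : Pred ℕ 0ℓ} → Eventually Q → Eventually R → Eventually (λ j → Q j × R j)
  eventually-× (k , f) (l , g) =
    k ⊔ l , λ j le → f j (≤-trans (m≤m⊔n k l) le) , g j (≤-trans (m≤n⊔m k l) le)

  -- A surjection from `ℕ`, possibly with repetitions. Countable sets are thus inhabited, and a
  -- constant family may be indexed by `ℕ` as well.
  Countable : Set → Set
  Countable A = Σ (ℕ → A) λ e → ∀ x → ∃ λ k → e k ≡ x

  ℕ-countable : Countable ℕ
  ℕ-countable = id , λ k → k , refl

  image-countable : ∀ {A B : Set} (f : A → B) → (∀ y → ∃ λ x → f x ≡ y) → Countable A → Countable B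
  image-countable f onto (e , e-onto) = f ∘ e , λ y →
    let x , fx≡y = onto y ; k , ek≡x = e-onto x in k , trans (cong f ek≡x) fx≡y

  private
    advance : ℕ × ℕ → ℕ × ℕ
    advance (i , zero)  = zero , suc i
    advance (i , suc j) = suc i , j

    -- Runs through the antidiagonals: from `(0 , l)` to `(l , 0)`, then on to `(0 , suc l)`.
    walk : ℕ → ℕ × ℕ
    walk zero    = zero , zero
    walk (suc k) = advance (walk k)

    Reached : ℕ × ℕ → Set
    Reached p = ∃ λ k → walk k ≡ p

    along : ∀ i j → Reached (zero , i + j) → Reached (i , j)
    along zero    j r = r
    along (suc i) j r with along i (suc j) (subst (λ l → Reached (zero , l)) (sym (+-suc i j)) r)
    ... | k , eq = suc k , cong advance eq

    begin-diagonal : ∀ l → Reached (zero , l)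
    begin-diagonal zero = zero , refl
    begin-diagonal (suc l) with along l zero (subst (λ l → Reached (zero , l)) (sym (+-identityʳ l)) (begin-diagonal l))
    ... | k , eq = suc k , cong advance eq

  Σ-countable : {A : Set} {B : A → Set} → Countable A → (∀ x → Countable (B x)) → Countable (Σ A B)
  Σ-countable (e , e-onto) c =
    image-countable (λ (i , j) → e i , proj₁ (c (e i)) j) onto (walk , λ (i , j) → along i j (begin-diagonal (i + j)))
    where
    onto : ∀ y → ∃ λ x → (e (proj₁ x) , proj₁ (c (e (proj₁ x))) (proj₂ x)) ≡ y
    onto (x , y) with e-onto x
    ... | i , refl = let j , eq = proj₂ (c (e i)) y in (i , j) , cong (e i ,_) eq

  ×-countable : {A B : Set} → Countable A → Countable B → Countable (A × B)
  ×-countable c d = Σ-countable c λ _ → d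

  ⊎-countable : {A B : Set} → Countable A → Countable B → Countable (A ⊎ B)
  ⊎-countable {A} {B} c d = image-countable choose onto (×-countable ℕ-countable (×-countable c d))
    where
    choose : ℕ × A × B → A ⊎ B
    choose (zero  , x , y) = inj₁ x
    choose (suc _ , x , y) = inj₂ y
    onto : ∀ z → ∃ λ p → choose p ≡ z
    -- The component that `choose` ignores is filled by an arbitrary element of the other set.
    onto (inj₁ x) = (0 , x , proj₁ d 0) , refl
    onto (inj₂ y) = (1 , proj₁ c 0 , y) , refl

  Vec-countable : {A : Set} → Countable A → ∀ n → Countable (Vec A n)
  Vec-countable c zero    = (λ _ → []) , λ { [] → 0 , refl }
  Vec-countable c (suc n) = image-countable (λ (x , xs) → x ∷ xs) (λ { (x ∷ xs) → (x , xs) , refl })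
    (×-countable c (Vec-countable c n))

  List-countable : {A : Set} → Countable A → Countable (List A)
  List-countable c = image-countable (λ (_ , xs) → Vec.toList xs)
    (λ xs → (List.length xs , Vec.fromList xs) , toList∘fromList xs)
    (Σ-countable ℕ-countable (Vec-countable c))

  top : ∀ {n} → Vec ℕ n → ℕ
  top []       = 0
  top (x ∷ xs) = x ⊔ top xs

  ≤-top : ∀ {n} (t : Vec ℕ n) → All (_≤ top t) t
  ≤-top []       = []
  ≤-top (x ∷ xs) = m≤m⊔n x _ ∷ VecAll.map (λ le → ≤-trans le (m≤n⊔m x _)) (≤-top xs)

  maximum : List ℕ → ℕ
  maximum = max 0

  ≤-maximum : ∀ {xs x} → x ∈ˡ xs → x ≤ maximum xs
  ≤-maximum {xs} = ListAll.lookup (xs≤max 0 xs)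

  bounded-finite : (Q : Pred ℕ 0ℓ) (k : ℕ) → (∀ {x} → Q x → x ≤ k) → ∃ λ xs → Q ≐ (_∈ˡ xs)
  bounded-finite Q k Q≤k = xs ,
    (λ q → ∈-filter⁺ (λ x → dec (Q x)) (∈-upTo⁺ (s≤s (Q≤k q))) q) ,
    λ m → proj₂ (∈-filter⁻ (λ x → dec (Q x)) {xs = upTo (suc k)} m)
    where xs = List.filter (λ x → dec (Q x)) (upTo (suc k))

  vectors : ∀ {A : Set} → List A → ∀ n → List (Vec A n)
  vectors xs zero    = [] ∷ []
  vectors xs (suc n) = concatMap (λ t → List.map (_∷ t) xs) (vectors xs n)

  ∈-vectors : ∀ {A : Set} {xs : List A} {n} {t : Vec A n} → All (_∈ˡ xs) t → t ∈ˡ vectors xs n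
  ∈-vectors         []                = here refl
  ∈-vectors {xs = xs} {t = x ∷ t} (m ∷ ms) =
    ∈-concatMap⁺ (λ u → List.map (_∷ u) xs) {xs = vectors xs _} (Any.map prepend (∈-vectors ms))
    where
    prepend : ∀ {u} → t ≡ u → (x ∷ t) ∈ˡ List.map (_∷ u) xs
    prepend refl = ∈-map⁺ (_∷ t) m

  -- Baire category

  module Category (X : Space) where
    open Space X public
    open Topology X public

    Nonempty : List Index → Set
    Nonempty is = ∃ (Basic is)

    Dense : Pred Point 0ℓ → Set
    Dense U = ∀ is → Nonempty is → ∃ λ z → z ∈ Basic is × z ∈ U

    basic-resp : ∀ is {x y} → x ≈ y → x ∈ Basic is → y ∈ Basic is
    basic-resp _ x≈y = ListAll.map λ {i} → resp i x≈y

    open-resp : ∀ {U x y} → Open U → x ≈ y → x ∈ U → y ∈ U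
    open-resp openU x≈y x∈U = let is , x∈is , is⊆U = openU x∈U in is⊆U (basic-resp is x≈y x∈is)

    interior-self : ∀ z i → z ∈ Sub i → Interior (Sub i) z
    interior-self z i z∈i = i ∷ [] , z∈i ∷ [] , λ { (w∈i ∷ []) → w∈i }

    interior-basic : ∀ z is → z ∈ Basic is → Interior (Basic is) z
    interior-basic z is z∈is = is , z∈is , id

    interior-⊆ : ∀ {S T} z → S ⊆ T → Interior S z → Interior T z
    interior-⊆ z S⊆T (is , z∈is , is⊆S) = is , z∈is , λ w∈is → S⊆T (is⊆S w∈is)

    interior-∩ : ∀ {S T} z → Interior S z → Interior T z → Interior (S ∩ T) z
    interior-∩ z (is , z∈is , is⊆S) (js , z∈js , js⊆T) =
      is ++ js , ++⁺ z∈is z∈js , λ w∈ → is⊆S (++⁻ˡ is w∈) , js⊆T (++⁻ʳ is w∈)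

    interior-all : ∀ {A : Set} {S : A → Pred Point 0ℓ} z xs → (∀ {x} → x ∈ˡ xs → Interior (S x) z) →
      Interior (λ w → ∀ {x} → x ∈ˡ xs → S x w) z
    interior-all z []       int = [] , [] , λ _ ()
    interior-all z (x ∷ xs) int = interior-⊆ z (λ { (sx , sxs) (here refl) → sx ; (sx , sxs) (there x∈) → sxs x∈ })
      (interior-∩ z (int (here refl)) (interior-all z xs (λ x∈ → int (there x∈))))

    -- Comeager sets are carried as explicit countable families of dense open sets, so that they can
    -- be joined, translated by permutations and met one by one along an enumeration.
    record Family : Set₁ where
      field
        I         : Set
        countable : Countable I
        D         : I → Pred Point 0ℓ
        isOpen    : ∀ i → Open (D i)
        isDense   : ∀ i → Dense (D i)

      Gen : Pred Point 0ℓ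
      Gen z = ∀ i → z ∈ D i

    open Family

    _⊕_ : Family → Family → Family
    𝒟 ⊕ ℰ = record
      { I         = I 𝒟 ⊎ I ℰ
      ; countable = ⊎-countable (countable 𝒟) (countable ℰ)
      ; D         = [ D 𝒟 , D ℰ ]
      ; isOpen    = λ { (inj₁ i) → isOpen 𝒟 i ; (inj₂ i) → isOpen ℰ i }
      ; isDense   = λ { (inj₁ i) → isDense 𝒟 i ; (inj₂ i) → isDense ℰ i }
      }

    -- The complement of the closure of `N`, in a form that is visibly open.
    Avoids : Pred Point 0ℓ → Pred Point 0ℓ
    Avoids N z = ∃ λ is → z ∈ Basic is × (∀ {w} → w ∈ Basic is → ¬ N w)

    avoids-open : ∀ N → Open (Avoids N)
    avoids-open N (is , z∈is , avoid) = is , z∈is , λ w∈is → is , w∈is , avoid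

    avoids-dense : ∀ {N} → NowhereDense N → Dense (Avoids N)
    avoids-dense {N} nowhere is (z , z∈is) = by-contradiction λ none →
      nowhere z (is , z∈is , λ {w} w∈is js w∈js → by-contradiction λ disjoint →
        none (w , w∈is , js , w∈js , λ {v} v∈js v∈N → disjoint (v , v∈js , v∈N)))

    meager-family : {C : Set} → Countable C → (M : C → Pred Point 0ℓ) → (∀ c → Meager (M c)) → Family
    meager-family {C} C-countable M meager = record
      { I         = C × ℕ
      ; countable = ×-countable C-countable ℕ-countable
      ; D         = λ (c , i) → Avoids (proj₁ (meager c) i)
      ; isOpen    = λ (c , i) → avoids-open (proj₁ (meager c) i)
      ; isDense   = λ (c , i) → avoids-dense (proj₁ (proj₂ (meager c)) i)
      }

    meager-family-avoids : ∀ {C : Set} (cC : Countable C) M (meager : ∀ c → Meager (M c)) {z} →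
      Gen (meager-family cC M meager) z → ∀ c → ¬ M c z
    meager-family-avoids cC M meager gen c z∈M =
      let i , z∈N = proj₁ (proj₂ (proj₂ (meager c))) z∈M ; is , z∈is , avoid = gen (c , i) in avoid z∈is z∈N

    nowhereDense-⊆ : ∀ {S T} → S ⊆ T → NowhereDense T → NowhereDense S
    nowhereDense-⊆ S⊆T nowhere z (is , z∈is , dense) = nowhere z (is , z∈is , λ w∈is js w∈js →
      let v , v∈js , v∈S = dense w∈is js w∈js in v , v∈js , S⊆T v∈S)

    meager-⊆ : ∀ {S T} → S ⊆ T → Meager T → Meager S
    meager-⊆ {S} S⊆T (N , nowhere , T⊆ , _) =
      (λ i → S ∩ N i) , (λ i → nowhereDense-⊆ proj₂ (nowhere i)) ,
      (λ z∈S → let i , z∈N = T⊆ (S⊆T z∈S) in i , z∈S , z∈N) , λ (_ , z∈S , _) → z∈S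

    meager-⋃ : {C : Set} → Countable C → (S : C → Pred Point 0ℓ) → (∀ c → Meager (S c)) →
      Meager λ z → ∃ λ c → z ∈ S c
    meager-⋃ {C} cC S meager = N ∘ e , nowhere ∘ e , S⊆N , N⊆S
      where
      e = proj₁ (×-countable cC ℕ-countable)
      N : C × ℕ → Pred Point 0ℓ
      N (c , i) = proj₁ (meager c) i
      nowhere : ∀ p → NowhereDense (N p)
      nowhere (c , i) = proj₁ (proj₂ (meager c)) i
      S⊆N : ∀ {z} → (∃ λ c → z ∈ S c) → ∃ λ k → z ∈ N (e k)
      S⊆N (c , z∈S) =
        let i , z∈N = proj₁ (proj₂ (proj₂ (meager c))) z∈S
            k , ek≡ = proj₂ (×-countable cC ℕ-countable) (c , i)
        in k , subst (λ p → N p _) (sym ek≡) z∈N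
      N⊆S : ∀ {z} → (∃ λ k → z ∈ N (e k)) → ∃ λ c → z ∈ S c
      N⊆S (k , z∈N) = proj₁ (e k) , proj₂ (proj₂ (proj₂ (meager (proj₁ (e k))))) (proj₂ (e k) , z∈N)

    nowhereDense-meager : ∀ {S} → NowhereDense S → Meager S
    nowhereDense-meager {S} nowhere = (λ _ → S) , (λ _ → nowhere) , (λ z∈S → 0 , z∈S) , proj₂

    nonmeager-inhabited : ∀ {S} → ¬ Meager S → ∃ S
    nonmeager-inhabited nonmeager = by-contradiction λ empty → nonmeager
      (nowhereDense-meager λ z (is , z∈is , dense) → let v , _ , v∈S = dense z∈is is z∈is in empty (v , v∈S))

    nonmeager-piece : {C : Set} {S : C → Pred Point 0ℓ} {T : Pred Point 0ℓ} → Countable C →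
      T ⊆ (λ z → ∃ λ (c : C) → z ∈ S c) → ¬ Meager T → ∃ λ c → ¬ Meager (S c)
    nonmeager-piece {S = S} cC T⊆⋃S nonmeager = ¬∀⇒∃¬ λ meager → nonmeager (meager-⊆ T⊆⋃S (meager-⋃ cC S meager))

    NonmeagerIn : Pred Point 0ℓ → List Index → Set₁
    NonmeagerIn S is = ¬ Meager (S ∩ Basic is)

    EverywhereNonmeagerIn : Pred Point 0ℓ → List Index → Set₁
    EverywhereNonmeagerIn S is = ∀ js → Nonempty (is ++ js) → NonmeagerIn S (is ++ js)

    -- Otherwise the basic sets in which S is meager would have a dense union.
    abstract
      localize : Countable Index → ∀ {S is} → NonmeagerIn S is →
        ∃ λ js → Nonempty (is ++ js) × EverywhereNonmeagerIn S (is ++ js)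
      localize cI {S} {is} nonmeager = by-contradiction λ none →
        nonmeager (meager-⊆ (cover none) (meager-⋃ (⊎-countable (ℕ-countable) (List-countable cI)) (piece none)
          (piece-meager none)))
        where
        module _ (none : ¬ ∃ λ js → Nonempty (is ++ js) × EverywhereNonmeagerIn S (is ++ js)) where
          Thin : List Index → Set
          Thin js = Small (Meager (S ∩ Basic js))
          Rest : Pred Point 0ℓ
          Rest z = z ∈ Basic is × (∀ js → z ∈ Basic js → ¬ Thin js)
          piece : ℕ ⊎ List Index → Pred Point 0ℓ
          piece (inj₁ _)  = Rest
          piece (inj₂ js) z = Thin js × z ∈ S × z ∈ Basic js
          rest-nowhere : NowhereDense Rest
          rest-nowhere z (js , z∈js , dense) =
            let w , w∈js , w∈is , _ = dense z∈js js z∈js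
                ks , ¬nonmeager = ¬∀⇒∃¬ λ ks-ok → none (js , (w , ++⁺ w∈is w∈js) , ks-ok)
                (v , v∈) , meager = ¬→⇒× ¬nonmeager
                v∈js = ++⁻ʳ is (++⁻ˡ (is ++ js) v∈)
                u , u∈ , _ , not-thin = dense v∈js _ v∈
            in not-thin _ u∈ (small (by-contradiction meager))
          piece-meager : ∀ c → Meager (piece c)
          piece-meager (inj₁ _) = nowhereDense-meager rest-nowhere
          piece-meager (inj₂ js) with dec (Thin js)
          ... | yes thin  = meager-⊆ proj₂ (large thin)
          ... | no  ¬thin = meager-⊆ {T = λ _ → ⊥} (λ (thin , _) → ¬thin thin)
                              (nowhereDense-meager λ z (is , z∈is , dense) → proj₂ (proj₂ (dense z∈is is z∈is)))
          cover : (S ∩ Basic is) ⊆ λ z → ∃ λ c → z ∈ piece c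
          cover {z} (z∈S , z∈is) with dec (∃ λ js → z ∈ Basic js × Thin js)
          ... | yes (js , z∈js , thin) = inj₂ js , thin , z∈S , z∈js
          ... | no  nowhere = inj₁ 0 , z∈is , λ js z∈js thin → nowhere (js , z∈js , thin)

    -- Stands in for a complete metric. `detail z k` is a finite part of what holds at `z`, chosen
    -- so that a sequence whose later points keep the details of the earlier ones has a limit inside
    -- the space. `complement` makes the subbasic sets clopen.
    record Complete : Set₁ where
      field
        index-countable : Countable Index
        complement : ∀ i {z} → ¬ z ∈ Sub i → ∃ λ is → z ∈ Basic is × (∀ {w} → w ∈ Basic is → ¬ w ∈ Sub i)
        detail     : Point → ℕ → List Index
        ∈-detail   : ∀ z k → z ∈ Basic (detail z k)
        limit      : (z : ℕ → Point) → (∀ {k j} → k ≤ j → z j ∈ Basic (detail (z k) k)) →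
          ∃ λ z∞ → ∀ i → (z∞ ∈ Sub i → Eventually λ j → z j ∈ Sub i)
                       × ((Eventually λ j → z j ∈ Sub i) → z∞ ∈ Sub i)

      basic-complement : ∀ is {z} → ¬ z ∈ Basic is →
        ∃ λ js → z ∈ Basic js × (∀ {w} → w ∈ Basic js → ¬ w ∈ Basic is)
      basic-complement is {z} z∉is =
        let i , i∈is , z∉i = find (¬All⇒Any¬ (λ i → dec (z ∈ Sub i)) is z∉is)
            js , z∈js , disjoint = complement i z∉i
        in js , z∈js , λ w∈js w∈is → disjoint w∈js (ListAll.lookup w∈is i∈is)

      record FusionSequence : Set where
        field
          z       : ℕ → Point
          B       : ℕ → List Index
          z∈B     : ∀ k → z k ∈ Basic (B k)
          nested  : ∀ k → Basic (B (suc k)) ⊆ Basic (B k)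
          details : ∀ k → Basic (B k) ⊆ Basic (detail (z k) k)

        nested′ : ∀ {k j} → k ≤′ j → Basic (B j) ⊆ Basic (B k)
        nested′ ≤′-refl         = id
        nested′ (≤′-step k≤j) w∈ = nested′ k≤j (nested _ w∈)

        private
          lim = limit z λ {k} {j} k≤j → details k (nested′ (≤⇒≤′ k≤j) (z∈B j))

        z∞ : Point
        z∞ = proj₁ lim

        basic-eventually : ∀ is → z∞ ∈ Basic is → Eventually λ j → z j ∈ Basic is
        basic-eventually []       []       = 0 , λ _ _ → []
        basic-eventually (i ∷ is) (m ∷ ms) =
          let k , f = eventually-× (proj₁ (proj₂ lim i) m) (basic-eventually is ms)
          in k , λ j k≤j → let p , q = f j k≤j in p ∷ q

        eventually-basic : ∀ is → (Eventually λ j → z j ∈ Basic is) → z∞ ∈ Basic is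
        eventually-basic is (k , f) = ListAll.tabulate λ {i} i∈is →
          proj₂ (proj₂ lim i) (k , λ j k≤j → ListAll.lookup (f j k≤j) i∈is)

        z∞∈B : ∀ k → z∞ ∈ Basic (B k)
        z∞∈B k = eventually-basic (B k) (k , λ j k≤j → nested′ (≤⇒≤′ k≤j) (z∈B j))

      module Approach (𝒟 : Family) (is : List Index) (z₀ : Point) (z₀∈is : z₀ ∈ Basic is) where
        enum = proj₁ (countable 𝒟)
        State : Set
        State = Σ (List Index) Nonempty
        step : ℕ → State → State
        step k (js , ne) =
          let w , w∈js , w∈D = isDense 𝒟 (enum k) js ne
              ks , w∈ks , _ = isOpen 𝒟 (enum k) w∈D
          in js ++ (ks ++ detail w (suc k)) , w , ++⁺ w∈js (++⁺ w∈ks (∈-detail w (suc k)))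
        step-⊆D : ∀ k s → Basic (proj₁ (step k s)) ⊆ D 𝒟 (enum k)
        step-⊆D k (js , ne) w∈ =
          let w , w∈js , w∈D = isDense 𝒟 (enum k) js ne
              ks , w∈ks , ks⊆D = isOpen 𝒟 (enum k) w∈D
          in ks⊆D (++⁻ˡ ks (++⁻ʳ js w∈))
        step-details : ∀ k s → Basic (proj₁ (step k s)) ⊆ Basic (detail (proj₁ (proj₂ (step k s))) (suc k))
        step-details k (js , ne) w∈ =
          let w , w∈js , w∈D = isDense 𝒟 (enum k) js ne
              ks , w∈ks , ks⊆D = isOpen 𝒟 (enum k) w∈D
          in ++⁻ʳ ks (++⁻ʳ js w∈)
        states : ℕ → State
        states zero    = is ++ detail z₀ 0 , z₀ , ++⁺ z₀∈is (∈-detail z₀ 0)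
        states (suc k) = step k (states k)
        sequence : FusionSequence
        sequence = record
          { z       = λ k → proj₁ (proj₂ (states k))
          ; B       = λ k → proj₁ (states k)
          ; z∈B     = λ k → proj₂ (proj₂ (states k))
          ; nested  = λ k → ++⁻ˡ (proj₁ (states k))
          ; details = λ { zero → ++⁻ʳ is ; (suc k) → step-details k (states k) }
          }
        open FusionSequence sequence

        generic : ∃ λ z → z ∈ Basic is × Gen 𝒟 z
        generic = z∞ , ++⁻ˡ is (z∞∈B 0) , λ i →
          let k , eq = proj₂ (countable 𝒟) i in
          subst (λ i → z∞ ∈ D 𝒟 i) eq (step-⊆D k (states k) (z∞∈B (suc k)))

      abstract
        baire : (𝒟 : Family) → ∀ is → Nonempty is → ∃ λ z → z ∈ Basic is × Gen 𝒟 z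
        baire 𝒟 is (z₀ , z₀∈is) = Approach.generic 𝒟 is z₀ z₀∈is

  -- The spaces of structures

  module Models (n : ℕ) .{{_ : NonZero n}} where
    open Category (Modω (𝓑̂ n)) public

    module _ {A : Set} (M : Structure (ℒ̂ n) A) where
      op : ℕ → Vec A n → A
      op i = fun M (s i)

      ranked : ℕ → Vec A n → Bool
      ranked j = rel M (inj₁ (R j))

      bit : ℕ → A → Bool
      bit i a = rel M (inj₂ (P i)) (a ∷ [])

      Closed : Pred A 0ℓ → Set
      Closed C = ∀ t → All C t → ∀ i → op i t ∈ C

    module _ (z : Point) where
      open BKL (BKL̂.reduct∈𝓑 (proj₂ z)) public

      rank : Vec ℕ n → ℕ
      rank t = proj₁ (B1 t)

      rank-ranked : ∀ t → ranked (proj₁ z) (rank t) t ≡ true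
      rank-ranked t = proj₁ (proj₂ (B1 t))

      rank-unique : ∀ t {j} → ranked (proj₁ z) j t ≡ true → rank t ≡ j
      rank-unique t = proj₂ (proj₂ (B1 t))

      op-above : ∀ t {i} → rank t < i → op (proj₁ z) i t ≡ first t
      op-above t = B2 t (rank t) (rank-ranked t) _

    -- Restricts the arguments and the predicates, but not the indices of functions and ranks;
    -- function values may lie outside `C`. For finite `C` this still describes a neighbourhood.
    record Agree (C : Pred ℕ 0ℓ) (K : ℕ) (M N : Structure (ℒ̂ n) ℕ) : Set where
      constructor agree
      field
        ops   : ∀ {t} → All C t → ∀ i → op M i t ≡ op N i t
        ranks : ∀ {t} → All C t → ∀ j → ranked M j t ≡ ranked N j t
        bits  : ∀ {a} → C a → ∀ i → i < K → bit M i a ≡ bit N i a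
    open Agree public

    agree-sym : ∀ {C K M N} → Agree C K M N → Agree C K N M
    agree-sym p = agree (λ t i → sym (ops p t i)) (λ t j → sym (ranks p t j)) (λ a i i<K → sym (bits p a i i<K))

    agree-trans : ∀ {C K M N O} → Agree C K M N → Agree C K N O → Agree C K M O
    agree-trans p q = agree (λ t i → trans (ops p t i) (ops q t i)) (λ t j → trans (ranks p t j) (ranks q t j))
      (λ a i i<K → trans (bits p a i i<K) (bits q a i i<K))

    agree-mono : ∀ {C D K L M N} → D ⊆ C → L ≤ K → Agree C K M N → Agree D L M N
    agree-mono D⊆C L≤K p = agree (λ t → ops p (VecAll.map D⊆C t)) (λ t → ranks p (VecAll.map D⊆C t))
      (λ a i i<L → bits p (D⊆C a) i (<-≤-trans i<L L≤K))

    Cond : Set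
    Cond = Condition {ℒ̂ n}

    -- Counts only what `Agree` restricts: arguments and indices of predicates. The indices of `s`
    -- and `R` and the value `b` are irrelevant to it.
    size : Cond → ℕ
    size (holds (inj₁ (R j)) t) = top t
    size (holds (inj₂ (P i)) t) = suc i ⊔ top t
    size (fails (inj₁ (R j)) t) = top t
    size (fails (inj₂ (P i)) t) = suc i ⊔ top t
    size (value (s i) t b)      = top t

    sizes : List Cond → ℕ
    sizes is = maximum (List.map size is)

    module _ {C K M N} (M~N : Agree C K M N) where
      private
        within : ∀ {k m} {t : Vec ℕ m} → (∀ {a} → a ≤ k → C a) → top t ≤ k → All C t
        within {t = t} ≤k⇒C top≤k = VecAll.map (λ a≤ → ≤k⇒C (≤-trans a≤ top≤k)) (≤-top t)

      agree-cond : ∀ c → (∀ {a} → a ≤ size c → C a) → size c ≤ K → M ∈ ⟦ c ⟧ → N ∈ ⟦ c ⟧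
      agree-cond (holds (inj₁ (R j)) t) inC _ = trans (sym (ranks M~N (within inC ≤-refl) j))
      agree-cond (holds (inj₂ (P i)) (a ∷ [])) inC le =
        trans (sym (bits M~N (inC (≤-trans (m≤m⊔n a 0) (m≤n⊔m (suc i) (a ⊔ 0)))) i (≤-trans (m≤m⊔n (suc i) (a ⊔ 0)) le)))
      agree-cond (fails (inj₁ (R j)) t) inC _ = trans (sym (ranks M~N (within inC ≤-refl) j))
      agree-cond (fails (inj₂ (P i)) (a ∷ [])) inC le =
        trans (sym (bits M~N (inC (≤-trans (m≤m⊔n a 0) (m≤n⊔m (suc i) (a ⊔ 0)))) i (≤-trans (m≤m⊔n (suc i) (a ⊔ 0)) le)))
      agree-cond (value (s i) t b) inC _ = trans (sym (ops M~N (within inC ≤-refl) i))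

    agree-basic : ∀ {C K} {z w : Point} is → Agree C K (proj₁ z) (proj₁ w) →
      (∀ {a} → a ≤ sizes is → C a) → sizes is ≤ K → z ∈ Basic is → w ∈ Basic is
    agree-basic is z~w inC le z∈is = ListAll.tabulate λ {c} c∈is →
      let size≤ = ≤-maximum (∈-map⁺ size c∈is) in
      agree-cond z~w c (λ a≤ → inC (≤-trans a≤ size≤)) (≤-trans size≤ le) (ListAll.lookup z∈is c∈is)

    abstract
      cond-countable : Countable Cond
      cond-countable = image-countable build onto (⊎-countable (⊎-countable c-rel c-rel)
        (×-countable (Σ-countable (image-countable s (λ { (s i) → i , refl }) ℕ-countable) λ _ →
          Vec-countable ℕ-countable n) ℕ-countable))
        where
        RelAtom FunAtom : Set
        RelAtom = Σ (RelSymbol ⊎ Predicate) λ r → Vec ℕ (Language.relArity (ℒ̂ n) r)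
        FunAtom = Σ FunSymbol (λ _ → Vec ℕ n) × ℕ
        c-rel : Countable RelAtom
        c-rel = Σ-countable
          (⊎-countable (image-countable R (λ { (R i) → i , refl }) ℕ-countable)
            (image-countable P (λ { (P i) → i , refl }) ℕ-countable))
          λ _ → Vec-countable ℕ-countable _
        build : (RelAtom ⊎ RelAtom) ⊎ FunAtom → Cond
        build (inj₁ (inj₁ (r , t)))  = holds r t
        build (inj₁ (inj₂ (r , t)))  = fails r t
        build (inj₂ ((f , t) , b)) = value f t b
        onto : ∀ c → ∃ λ x → build x ≡ c
        onto (holds r t)   = inj₁ (inj₁ (r , t)) , refl
        onto (fails r t)   = inj₁ (inj₂ (r , t)) , refl
        onto (value f t b) = inj₂ ((f , t) , b) , refl

    cond-complement : ∀ c {z} → ¬ z ∈ Space.Sub (Modω (𝓑̂ n)) c →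
      ∃ λ is → z ∈ Basic is × (∀ {w} → w ∈ Basic is → ¬ w ∈ Space.Sub (Modω (𝓑̂ n)) c)
    cond-complement (holds r t) z∉ = fails r t ∷ [] , ¬-not z∉ ∷ [] , λ { (w∈ ∷ []) h → case trans (sym w∈) h of λ () }
    cond-complement (fails r t) z∉ = holds r t ∷ [] , ¬-not z∉ ∷ [] , λ { (w∈ ∷ []) h → case trans (sym w∈) h of λ () }
    cond-complement (value f t b) {z} z∉ = value f t (fun (proj₁ z) f t) ∷ [] , refl ∷ [] ,
      λ { (w∈ ∷ []) h → z∉ (trans (sym w∈) h) }

    bit-interior : ∀ z i a → Interior (λ w → bit (proj₁ z) i a ≡ bit (proj₁ w) i a) z
    bit-interior z i a with bit (proj₁ z) i a in eq
    ... | true  = interior-⊆ z sym (interior-self z (holds (inj₂ (P i)) (a ∷ [])) eq)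
    ... | false = interior-⊆ z sym (interior-self z (fails (inj₂ (P i)) (a ∷ [])) eq)

    -- By B1 and B2 the finitely many values up to the rank determine all of them.
    tuple-interior : ∀ z t → Interior
      (λ w → (∀ i → op (proj₁ z) i t ≡ op (proj₁ w) i t) × (∀ j → ranked (proj₁ z) j t ≡ ranked (proj₁ w) j t)) z
    tuple-interior z t = interior-⊆ z (λ {w} → determined w) (interior-∩ z
      (interior-self z (holds (inj₁ (R (rank z t))) t) (rank-ranked z t))
      (interior-all z (upTo (suc (rank z t))) λ {i} _ → interior-self z (value (s i) t (op (proj₁ z) i t)) refl))
      where
      determined : ∀ w → ranked (proj₁ w) (rank z t) t ≡ true ×
        (∀ {i} → i ∈ˡ upTo (suc (rank z t)) → op (proj₁ w) i t ≡ op (proj₁ z) i t) →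
        (∀ i → op (proj₁ z) i t ≡ op (proj₁ w) i t) × (∀ j → ranked (proj₁ z) j t ≡ ranked (proj₁ w) j t)
      determined w (rk , vals) = same-op , same-rank
        where
        rank≡ : rank w t ≡ rank z t
        rank≡ = rank-unique w t rk
        same-op : ∀ i → op (proj₁ z) i t ≡ op (proj₁ w) i t
        same-op i with i ≤? rank z t
        ... | yes i≤ = sym (vals (∈-upTo⁺ (s≤s i≤)))
        ... | no  i≰ = trans (op-above z t (≰⇒> i≰)) (sym (op-above w t (subst (_< i) (sym rank≡) (≰⇒> i≰))))
        same-rank : ∀ j → ranked (proj₁ z) j t ≡ ranked (proj₁ w) j t
        same-rank j with rank z t ≟ j
        ... | yes refl = trans (rank-ranked z t) (sym rk)
        ... | no  ≢j = trans (¬-not (λ h → ≢j (rank-unique z t h)))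
                         (sym (¬-not (λ h → ≢j (trans (sym rank≡) (rank-unique w t h)))))

    abstract
      agree-interior : ∀ F K z → Interior (λ w → Agree (_∈ˡ F) K (proj₁ z) (proj₁ w)) z
      agree-interior F K z = interior-⊆ z
        (λ (tuples , bits) → agree (λ t∈ → proj₁ (tuples (∈-vectors t∈))) (λ t∈ → proj₂ (tuples (∈-vectors t∈)))
          λ a∈F i i<K → bits (∈-cartesianProduct⁺ a∈F (∈-upTo⁺ i<K)))
        (interior-∩ z (interior-all z (vectors F n) λ {t} _ → tuple-interior z t)
          (interior-all z (cartesianProduct F (upTo K)) λ {(a , i)} _ → bit-interior z i a))

    module _ (z : Point) (k : ℕ) where
      hull : List ℕ
      hull = proj₁ (B4 z (upTo (suc k)))

      ≤⇒∈-hull : ∀ {a} → a ≤ k → a ∈ˡ hull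
      ≤⇒∈-hull a≤k = proj₁ (proj₂ (B4 z (upTo (suc k)))) (base (∈-upTo⁺ (s≤s a≤k)))

      hull-closed : Closed (proj₁ z) (_∈ˡ hull)
      hull-closed t t∈ i = proj₁ (proj₂ (B4 z (upTo (suc k))))
        (app (s i) (VecAll.map (proj₂ (proj₂ (B4 z (upTo (suc k))))) t∈))

    Separates : Point → ℕ → ℕ → ℕ → Set
    Separates z a b i = bit (proj₁ z) i a ≢ bit (proj₁ z) i b

    separate : ∀ z {a b} → a ≢ b → ∃ (Separates z a b)
    separate z a≢b = ¬∀⇒∃¬ λ same → a≢b (BKL̂.separated (proj₂ z) _ _ same)

    separator : Point → ℕ × ℕ → ℕ
    separator z (a , b) with a ≟ b
    ... | yes _ = 0
    ... | no a≢b = proj₁ (separate z a≢b)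

    separator-separates : ∀ z {a b} → a ≢ b → Separates z a b (separator z (a , b))
    separator-separates z {a} {b} a≢b with a ≟ b
    ... | yes a≡b = contradiction a≡b a≢b
    ... | no a≢b  = proj₂ (separate z a≢b)

    -- Large enough that distinct elements of the hull differ in a predicate below it. Keeping these
    -- predicates makes the limit satisfy `separated`; the `k` ensures that every predicate is
    -- eventually settled.
    depth : Point → ℕ → ℕ
    depth z k = k ⊔ suc (maximum (List.map (separator z) (cartesianProduct (hull z k) (hull z k))))

    detail : Point → ℕ → List Cond
    detail z k = proj₁ (agree-interior (hull z k) (depth z k) z)

    ∈-detail : ∀ z k → z ∈ Basic (detail z k)
    ∈-detail z k = proj₁ (proj₂ (agree-interior (hull z k) (depth z k) z))

    detail-agree : ∀ z k w → w ∈ Basic (detail z k) → Agree (_∈ˡ hull z k) (depth z k) (proj₁ z) (proj₁ w)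
    detail-agree z k w = proj₂ (proj₂ (agree-interior (hull z k) (depth z k) z)) {w}

    -- The generating term never leaves the closed set, so it has the same value in both structures.
    -- With `N` equal to `M` this just bounds a generated substructure.
    generated-transfer : ∀ (M N : Structure (ℒ̂ n) ℕ) {C S : Pred ℕ 0ℓ} → Closed M C → S ⊆ C →
      (∀ {t} → All C t → ∀ i → op M i t ≡ op N i t) →
      ∀ {a} → Generated (reduct M) S a → C a × Generated (reduct N) S a
    generated-transfer M N {C} {S} closed S⊆C same = go
      where
      go : ∀ {a} → Generated (reduct M) S a → C a × Generated (reduct N) S a
      gos : ∀ {m} {t : Vec ℕ m} → All (Generated (reduct M) S) t → All C t × All (Generated (reduct N) S) t
      go (base a∈S) = S⊆C a∈S , base a∈S
      go (app (s i) {t} gs) = let t∈C , gs′ = gos gs in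
        closed t t∈C i , subst (Generated (reduct N) S) (sym (same t∈C i)) (app (s i) gs′)
      gos []       = [] , []
      gos (g ∷ gs) = let c , g′ = go g ; cs , gs′ = gos gs in c ∷ cs , g′ ∷ gs′

    generated-mono : ∀ {A : Set} {M : Structure (ℒ n) A} {S T : Pred A 0ℓ} → S ⊆ T → Generated M S ⊆ Generated M T
    generated-mono {M = M} {S} {T} S⊆T = go
      where
      go : Generated M S ⊆ Generated M T
      gos : ∀ {m} {t : Vec _ m} → All (Generated M S) t → All (Generated M T) t
      go (base a∈S)   = base (S⊆T a∈S)
      go (app f gs)   = app f (gos gs)
      gos []       = []
      gos (g ∷ gs) = go g ∷ gos gs

    module Limit (z : ℕ → Point) (coherent : ∀ {k j} → k ≤ j → z j ∈ Basic (detail (z k) k)) where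
      stage : ∀ (r : RelSymbol ⊎ Predicate) → Vec ℕ (Language.relArity (ℒ̂ n) r) → ℕ
      stage (inj₁ _)     t = top t
      stage (inj₂ (P i)) t = suc i ⊔ top t

      -- Each value is read off at a stage whose hull contains the arguments and whose depth exceeds
      -- the index of the predicate; later stages do not change it.
      M∞ : Structure (ℒ̂ n) ℕ
      M∞ = record { fun = λ f t → fun (proj₁ (z (top t))) f t ; rel = λ r t → rel (proj₁ (z (stage r t))) r t }

      agrees : ∀ {k j} → k ≤ j → Agree (_∈ˡ hull (z k) k) (depth (z k) k) (proj₁ (z k)) (proj₁ (z j))
      agrees {k} {j} k≤j = detail-agree (z k) k (z j) (coherent k≤j)

      private
        top-∈-hull : ∀ {m} k (t : Vec ℕ m) → top t ≤ k → All (_∈ˡ hull (z k) k) t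
        top-∈-hull k t le = VecAll.map (λ a≤ → ≤⇒∈-hull (z k) k (≤-trans a≤ le)) (≤-top t)

      agree-limit : ∀ k → Agree (_∈ˡ hull (z k) k) (depth (z k) k) (proj₁ (z k)) M∞
      agree-limit k = agree
        (λ {t} t∈ i → let j = k ⊔ top t in
          trans (ops (agrees (m≤m⊔n k (top t))) t∈ i) (sym (ops (agrees {top t} {j} (m≤n⊔m k _)) (top-∈-hull _ t ≤-refl) i)))
        (λ {t} t∈ i → let j = k ⊔ top t in
          trans (ranks (agrees (m≤m⊔n k (top t))) t∈ i) (sym
            (ranks (agrees {top t} {j} (m≤n⊔m k _)) (top-∈-hull _ t ≤-refl) i)))
        (λ {a} a∈ i i<K → let l = suc i ⊔ top (a ∷ []) ; j = k ⊔ l in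
          trans (bits (agrees (m≤m⊔n k l)) a∈ i i<K)
            (sym (bits (agrees {l} {j} (m≤n⊔m k l)) (≤⇒∈-hull (z l) l (≤-trans (m≤m⊔n a 0) (m≤n⊔m (suc i) (a ⊔ 0)))) i
              (≤-trans (m≤m⊔n (suc i) (a ⊔ 0)) (m≤m⊔n l _)))))

      private
        forth : ∀ k {S} → S ⊆ (_∈ˡ hull (z k) k) → Generated (reduct (proj₁ (z k))) S ⊆ Generated (reduct M∞) S
        forth k S⊆ g = proj₂ (generated-transfer (proj₁ (z k)) M∞ (hull-closed (z k) k) S⊆ (ops (agree-limit k)) g)

        back : ∀ k {S} → S ⊆ (_∈ˡ hull (z k) k) → Generated (reduct M∞) S ⊆ Generated (reduct (proj₁ (z k))) S
        back k S⊆ g = proj₂ (generated-transfer M∞ (proj₁ (z k))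
          (λ t t∈ i → subst (_∈ˡ hull (z k) k) (ops (agree-limit k) t∈ i) (hull-closed (z k) k t t∈ i)) S⊆
          (λ t∈ i → sym (ops (agree-limit k) t∈ i)) g)

        list-∈-hull : ∀ xs {x} → x ∈ˡ xs → x ∈ˡ hull (z (maximum xs)) (maximum xs)
        list-∈-hull xs x∈ = ≤⇒∈-hull (z _) _ (≤-maximum x∈)

      z∞ : Point
      z∞ = M∞ , record
        { reduct∈𝓑 = record
          { B1 = λ t → B1 (z (top t)) t
          ; B2 = λ t → B2 (z (top t)) t
          -- The elements of `xs` lie in the hull of stage `maximum xs`, a closed set on which that
          -- stage and the limit have the same functions. Generation from them is therefore the same
          -- in both, here and in B4.
          ; B3 = λ xs unique len → let k = maximum xs ; b , b∈ , g = B3 (z k) xs unique len in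
              b , b∈ , forth k (λ (x∈ , _) → list-∈-hull xs x∈) g
          ; B4 = λ xs → let k = maximum xs ; ys , g⊆ , ⊆g = B4 (z k) xs in
              ys , (λ g → g⊆ (back k (list-∈-hull xs) g)) , λ y∈ → forth k (list-∈-hull xs) (⊆g y∈)
          }
        ; separated = λ a b same → by-contradiction λ a≢b →
            let k = a ⊔ b ; i = separator (z k) (a , b)
                a∈ = ≤⇒∈-hull (z k) k (m≤m⊔n a b) ; b∈ = ≤⇒∈-hull (z k) k (m≤n⊔m a b)
                i<K = ≤-trans (s≤s (≤-maximum (∈-map⁺ (separator (z k)) (∈-cartesianProduct⁺ a∈ b∈)))) (m≤n⊔m k _)
            in separator-separates (z k) a≢b (trans (bits (agree-limit k) a∈ i i<K)
                 (trans (same i) (sym (bits (agree-limit k) b∈ i i<K))))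
        }

      agree-late : ∀ {k j} → k ≤ j → Agree (_≤ k) k (proj₁ (z j)) M∞
      agree-late {k} k≤j = agree-mono (≤⇒∈-hull (z k) k) (m≤m⊔n k _)
        (agree-trans (agree-sym (agrees k≤j)) (agree-limit k))

      converges : ∀ c → (M∞ ∈ ⟦ c ⟧ → Eventually λ j → proj₁ (z j) ∈ ⟦ c ⟧)
                      × ((Eventually λ j → proj₁ (z j) ∈ ⟦ c ⟧) → M∞ ∈ ⟦ c ⟧)
      converges c =
        (λ m → size c , λ j le → agree-cond (agree-sym (agree-late {size c} {j} le)) c id ≤-refl m) ,
        (λ (k , f) → agree-cond (agree-late {size c} {k ⊔ size c} (m≤n⊔m k _)) c id ≤-refl (f _ (m≤m⊔n k _)))

    complete : Complete
    complete = record
      { index-countable = cond-countable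
      ; complement      = cond-complement
      ; detail          = detail
      ; ∈-detail        = ∈-detail
      ; limit           = λ z coherent → Limit.z∞ z coherent , Limit.converges z coherent
      }

  -- Permutations of finite support

  map-inverse : ∀ {A B : Set} {f : A → B} {g : B → A} → (∀ y → f (g y) ≡ y) →
    ∀ {m} (t : Vec B m) → Vec.map f (Vec.map g t) ≡ t
  map-inverse {f = f} {g} inverse t = trans (sym (map-∘ f g t)) (trans (map-cong inverse t) (map-id t))

  module _ {L : Language} where
    open _≅_
    open _≗_

    ≗⇒≅ : ∀ {A : Set} {M N : Structure L A} → M ≗ N → M ≅ N
    ≗⇒≅ {N = N} M≗N = record
      { bijection = ↔-id _
      ; fun-hom   = λ f t → trans (fun-≗ M≗N f t) (cong (fun N f) (sym (map-id t)))
      ; rel-iso   = λ r t → trans (rel-≗ M≗N r t) (cong (rel N r) (sym (map-id t)))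
      }

    ≅-sym : ∀ {A B : Set} {M : Structure L A} {N : Structure L B} → M ≅ N → N ≅ M
    ≅-sym {M = M} {N} τ = record
      { bijection = ↔-sym (bijection τ)
      ; fun-hom   = λ f t → trans
          (cong from (trans (cong (fun N f) (sym (map-inverse strictlyInverseˡ t))) (sym (fun-hom τ f (Vec.map from t)))))
          (strictlyInverseʳ _)
      ; rel-iso   = λ r t → trans (cong (rel N r) (sym (map-inverse strictlyInverseˡ t)))
          (sym (rel-iso τ r (Vec.map from t)))
      }
      where open Inverse (bijection τ) using (from; strictlyInverseˡ; strictlyInverseʳ)

    ≅-trans : ∀ {A B C : Set} {M : Structure L A} {N : Structure L B} {O : Structure L C} → M ≅ N → N ≅ O → M ≅ O
    ≅-trans {O = O} σ τ = record
      { bijection = bijection τ ↔-∘ bijection σ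
      ; fun-hom   = λ f t → trans (cong (to τ) (fun-hom σ f t))
          (trans (fun-hom τ f _) (cong (fun O f) (sym (map-∘ (to τ) (to σ) t))))
      ; rel-iso   = λ r t → trans (rel-iso σ r t) (trans (rel-iso τ r _) (cong (rel O r) (sym (map-∘ (to τ) (to σ) t))))
      }

  -- A product of transpositions, the head being applied last. Words are used because they form a
  -- countable set and are inverted by reversal.
  Word : Set
  Word = List (ℕ × ℕ)

  swap : ℕ → ℕ → ℕ → ℕ
  swap i j a with a ≟ i
  ... | yes _ = j
  ... | no  _ with a ≟ j
  ...   | yes _ = i
  ...   | no  _ = a

  swap-left : ∀ i j → swap i j i ≡ j
  swap-left i j with i ≟ i
  ... | yes _   = refl
  ... | no  i≢i = contradiction refl i≢i

  swap-right : ∀ i j → swap i j j ≡ i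
  swap-right i j with j ≟ i
  ... | yes j≡i = j≡i
  ... | no  _ with j ≟ j
  ...   | yes _   = refl
  ...   | no  j≢j = contradiction refl j≢j

  swap-other : ∀ {i j a} → a ≢ i → a ≢ j → swap i j a ≡ a
  swap-other {i} {j} {a} a≢i a≢j with a ≟ i
  ... | yes a≡i = contradiction a≡i a≢i
  ... | no  _ with a ≟ j
  ...   | yes a≡j = contradiction a≡j a≢j
  ...   | no  _   = refl

  swap-involutive : ∀ i j a → swap i j (swap i j a) ≡ a
  swap-involutive i j a with a ≟ i
  ... | yes refl = swap-right i j
  ... | no a≢i with a ≟ j
  ...   | yes refl = swap-left i j
  ...   | no a≢j = swap-other a≢i a≢j

  fwd bwd : Word → ℕ → ℕ
  fwd []            a = a
  fwd ((i , j) ∷ g) a = swap i j (fwd g a)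
  bwd []            a = a
  bwd ((i , j) ∷ g) a = bwd g (swap i j a)

  fwd-bwd : ∀ g a → fwd g (bwd g a) ≡ a
  fwd-bwd []            a = refl
  fwd-bwd ((i , j) ∷ g) a = trans (cong (swap i j) (fwd-bwd g (swap i j a))) (swap-involutive i j a)

  bwd-fwd : ∀ g a → bwd g (fwd g a) ≡ a
  bwd-fwd []            a = refl
  bwd-fwd ((i , j) ∷ g) a = trans (cong (bwd g) (swap-involutive i j (fwd g a))) (bwd-fwd g a)

  fwd-++ : ∀ g h a → fwd (g ++ h) a ≡ fwd g (fwd h a)
  fwd-++ []            h a = refl
  fwd-++ ((i , j) ∷ g) h a = cong (swap i j) (fwd-++ g h a)

  bwd-++ : ∀ g h a → bwd (g ++ h) a ≡ bwd h (bwd g a)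
  bwd-++ []            h a = refl
  bwd-++ ((i , j) ∷ g) h a = bwd-++ g h (swap i j a)

  inv : Word → Word
  inv []      = []
  inv (p ∷ g) = inv g ++ (p ∷ [])

  fwd-inv : ∀ g a → fwd (inv g) a ≡ bwd g a
  fwd-inv []            a = refl
  fwd-inv ((i , j) ∷ g) a = trans (fwd-++ (inv g) ((i , j) ∷ []) a) (fwd-inv g (swap i j a))

  bwd-inv : ∀ g a → bwd (inv g) a ≡ fwd g a
  bwd-inv []            a = refl
  bwd-inv ((i , j) ∷ g) a = trans (bwd-++ (inv g) ((i , j) ∷ []) a) (cong (swap i j) (bwd-inv g a))

  Word-countable : Countable Word
  Word-countable = List-countable (×-countable ℕ-countable ℕ-countable)

  module _ {L : Language} where
    open _≅_
    open _≗_

    act : Word → Structure L ℕ → Structure L ℕ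
    act g M = record
      { fun = λ f t → fwd g (fun M f (Vec.map (bwd g) t))
      ; rel = λ r t → rel M r (Vec.map (bwd g) t)
      }

    act-iso : ∀ g (M : Structure L ℕ) → M ≅ act g M
    act-iso g M = record
      { bijection = mk↔ₛ′ (fwd g) (bwd g) (fwd-bwd g) (bwd-fwd g)
      ; fun-hom   = λ f t → cong (fwd g ∘ fun M f) (sym (map-inverse (bwd-fwd g) t))
      ; rel-iso   = λ r t → cong (rel M r) (sym (map-inverse (bwd-fwd g) t))
      }

    act-cong : ∀ g {M N : Structure L ℕ} → M ≗ N → act g M ≗ act g N
    act-cong g M≗N = record
      { fun-≗ = λ f t → cong (fwd g) (fun-≗ M≗N f _)
      ; rel-≗ = λ r t → rel-≗ M≗N r _
      }

    act-++ : ∀ g h (M : Structure L ℕ) → act (g ++ h) M ≗ act g (act h M)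
    act-++ g h M = record
      { fun-≗ = λ f t → trans (fwd-++ g h _) (cong (fwd g ∘ fwd h ∘ fun M f) (bwd-map t))
      ; rel-≗ = λ r t → cong (rel M r) (bwd-map t)
      }
      where
      bwd-map : ∀ {m} (t : Vec ℕ m) → Vec.map (bwd (g ++ h)) t ≡ Vec.map (bwd h) (Vec.map (bwd g) t)
      bwd-map t = trans (map-cong (bwd-++ g h) t) (map-∘ (bwd h) (bwd g) t)

    act-trivial : ∀ g → (∀ a → fwd g a ≡ a) → ∀ (M : Structure L ℕ) → act g M ≗ M
    act-trivial g trivial M = record
      { fun-≗ = λ f t → trans (trivial _) (cong (fun M f) (bwd-map t))
      ; rel-≗ = λ r t → cong (rel M r) (bwd-map t)
      }
      where
      bwd-map : ∀ {m} (t : Vec ℕ m) → Vec.map (bwd g) t ≡ t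
      bwd-map t = trans (map-cong (λ a → trans (cong (bwd g) (sym (trivial a))) (bwd-fwd g a)) t) (map-id t)

    -- The preimage of a subbasic set under the action is again subbasic, so permutations act by
    -- homeomorphisms.
    pull : Word → Condition {L} → Condition {L}
    pull g (holds r t)   = holds r (Vec.map (bwd g) t)
    pull g (fails r t)   = fails r (Vec.map (bwd g) t)
    pull g (value f t b) = value f (Vec.map (bwd g) t) (bwd g b)

    act⇒pull : ∀ g c {M : Structure L ℕ} → act g M ∈ ⟦ c ⟧ → M ∈ ⟦ pull g c ⟧
    act⇒pull g (holds r t)   = id
    act⇒pull g (fails r t)   = id
    act⇒pull g (value f t b) eq = trans (sym (bwd-fwd g _)) (cong (bwd g) eq)

    pull⇒act : ∀ g c {M : Structure L ℕ} → M ∈ ⟦ pull g c ⟧ → act g M ∈ ⟦ c ⟧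
    pull⇒act g (holds r t)   = id
    pull⇒act g (fails r t)   = id
    pull⇒act g (value f t b) eq = trans (cong (fwd g) eq) (fwd-bwd g b)

  -- The action of permutations on the space, and types of elements

  module Action (n : ℕ) .{{_ : NonZero n}} where
    open Models n public
    open _≅_

    generated-act : ∀ g (M : Structure (ℒ̂ n) ℕ) {S T : Pred ℕ 0ℓ} → (∀ {a} → a ∈ S → fwd g a ∈ T) →
      ∀ {a} → Generated (reduct M) S a → Generated (reduct (act g M)) T (fwd g a)
    generated-act g M {S} {T} S⇒T = go
      where
      go : ∀ {a} → Generated (reduct M) S a → Generated (reduct (act g M)) T (fwd g a)
      gos : ∀ {m} {t : Vec ℕ m} → All (Generated (reduct M) S) t → All (Generated (reduct (act g M)) T) (Vec.map (fwd g) t)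
      go (base a∈S) = base (S⇒T a∈S)
      go (app f {t} gs) = subst (Generated (reduct (act g M)) T)
        (cong (fwd g ∘ fun M f) (map-inverse (bwd-fwd g) t)) (app f (gos gs))
      gos []       = []
      gos (g ∷ gs) = go g ∷ gos gs

    act-BKL̂ : ∀ g {M : Structure (ℒ̂ n) ℕ} → BKL̂ n M → BKL̂ n (act g M)
    act-BKL̂ g {M} M∈ = record
      { reduct∈𝓑 = record
        { B1 = λ t → K.B1 (Vec.map (bwd g) t)
        ; B2 = λ t j rk i j<i → trans (cong (fwd g) (K.B2 (Vec.map (bwd g) t) j rk i j<i)) (first-bwd t)
        ; B3 = λ xs unique len →
            let b , b∈ , gen = K.B3 (List.map (bwd g) xs) (Unique.map⁺ bwd-injective unique)
                  (trans (length-map (bwd g) xs) len)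
                c , c∈ , b≡ = ∈-map⁻ (bwd g) b∈
            in c , c∈ , subst (Generated _ _) (trans (cong (fwd g) b≡) (fwd-bwd g c))
                 (generated-act g M (λ {a} (a∈ , a≢b) → fwd-∈ a∈ , λ ga≡c →
                   a≢b (trans (trans (sym (bwd-fwd g a)) (cong (bwd g) ga≡c)) (sym b≡))) gen)
        ; B4 = λ xs → let ys , g⊆ , ⊆g = K.B4 (List.map (bwd g) xs) in List.map (fwd g) ys ,
            (λ {a} gen → subst (_∈ˡ List.map (fwd g) ys) (fwd-bwd g a)
              (∈-map⁺ (fwd g) (g⊆ (back gen)))) ,
            λ a∈ → let c , c∈ , a≡ = ∈-map⁻ (fwd g) a∈ in
              subst (Generated _ _) (sym a≡) (generated-act g M fwd-∈ (⊆g c∈))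
        }
      ; separated = λ a b same → trans (sym (fwd-bwd g a)) (trans (cong (fwd g) (BKL̂.separated M∈ _ _ same)) (fwd-bwd g b))
      }
      where
      module K = BKL (BKL̂.reduct∈𝓑 M∈)
      bwd-injective : ∀ {a b} → bwd g a ≡ bwd g b → a ≡ b
      bwd-injective {a} {b} eq = trans (sym (fwd-bwd g a)) (trans (cong (fwd g) eq) (fwd-bwd g b))
      first-bwd : (t : Vec ℕ n) → fwd g (first (Vec.map (bwd g) t)) ≡ first t
      first-bwd (a ∷ _) = fwd-bwd g a
      fwd-∈ : ∀ {a xs} → a ∈ˡ List.map (bwd g) xs → fwd g a ∈ˡ xs
      fwd-∈ {xs = xs} a∈ = let c , c∈ , a≡ = ∈-map⁻ (bwd g) a∈ in
        subst (_∈ˡ xs) (sym (trans (cong (fwd g) a≡) (fwd-bwd g c))) c∈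
      back : ∀ {xs a} → Generated (reduct (act g M)) (_∈ˡ xs) a → Generated (reduct M) (_∈ˡ List.map (bwd g) xs) (bwd g a)
      backs : ∀ {xs m} {t : Vec ℕ m} → All (Generated (reduct (act g M)) (_∈ˡ xs)) t →
        All (Generated (reduct M) (_∈ˡ List.map (bwd g) xs)) (Vec.map (bwd g) t)
      back (base a∈) = base (∈-map⁺ (bwd g) a∈)
      back (app f gs) = subst (Generated _ _) (sym (bwd-fwd g _)) (app f (backs gs))
      backs []       = []
      backs (g ∷ gs) = back g ∷ backs gs

    infixr 6 _•_

    _•_ : Word → Point → Point
    g • (M , M∈) = act g M , act-BKL̂ g M∈

    ≈-refl : ∀ {z : Point} → z ≈ z
    ≈-refl {z} = Setoid.refl setoid {z}

    ≈-sym : ∀ {z w : Point} → z ≈ w → w ≈ z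
    ≈-sym {z} {w} = Setoid.sym setoid {z} {w}

    ≈-trans : ∀ {x y z : Point} → x ≈ y → y ≈ z → x ≈ z
    ≈-trans {x} {y} {z} = Setoid.trans setoid {x} {y} {z}

    inv-• : ∀ g z → (inv g • g • z) ≈ z
    inv-• g z = ≈-trans {inv g • g • z} {(inv g ++ g) • z} {z}
      (≈-sym {(inv g ++ g) • z} {inv g • g • z} (act-++ (inv g) g (proj₁ z)))
      (act-trivial (inv g ++ g) (λ a → trans (fwd-++ (inv g) g a) (trans (fwd-inv g _) (bwd-fwd g a))) (proj₁ z))

    •-inv : ∀ g z → (g • inv g • z) ≈ z
    •-inv g z = ≈-trans {g • inv g • z} {(g ++ inv g) • z} {z}
      (≈-sym {(g ++ inv g) • z} {g • inv g • z} (act-++ g (inv g) (proj₁ z)))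
      (act-trivial (g ++ inv g) (λ a → trans (fwd-++ g (inv g) a) (trans (cong (fwd g) (fwd-inv g a)) (fwd-bwd g a)))
        (proj₁ z))

    -- Shows that the views of one block in `z` and in `h • z` lie in one orbit, as the notion of
    -- being determined requires.
    conjugate : ∀ g h z → (g • h • z) ≈ ((g ++ (h ++ inv g)) • g • z)
    conjugate g h z = ≈-sym {(g ++ (h ++ inv g)) • g • z} {g • h • z}
      (≈-trans {(g ++ (h ++ inv g)) • g • z} {g • (h ++ inv g) • g • z} {g • h • z}
        (act-++ g (h ++ inv g) (proj₁ (g • z)))
        (act-cong g (≈-trans {(h ++ inv g) • g • z} {h • inv g • g • z} {h • z}
          (act-++ h (inv g) (proj₁ (g • z))) (act-cong h (inv-• g z)))))

    •⇒pull : ∀ g is {z} → (g • z) ∈ Basic is → z ∈ Basic (List.map (pull g) is)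
    •⇒pull g is gz∈ = ListAllₚ.map⁺ (ListAll.map (λ {c} → act⇒pull g c) gz∈)

    pull⇒• : ∀ g is {z} → z ∈ Basic (List.map (pull g) is) → (g • z) ∈ Basic is
    pull⇒• g is z∈ = ListAll.map (λ {c} → pull⇒act g c) (ListAllₚ.map⁻ z∈)

    interior-pull : ∀ {S} g z → Interior S (g • z) → Interior (λ w → S (g • w)) z
    interior-pull g z (is , gz∈is , is⊆S) =
      List.map (pull g) is , •⇒pull g is {z} gz∈is , λ {w} w∈ → is⊆S {g • w} (pull⇒• g is {w} w∈)

    -- Equality of types. Since types separate elements, it expresses that `a` and `b` correspond
    -- under any isomorphism between the two points, without naming one.
    Same : Point → ℕ → Point → ℕ → Set
    Same z a w b = ∀ i → bit (proj₁ z) i a ≡ bit (proj₁ w) i b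

    iso-same : ∀ z w (τ : proj₁ z ≅ proj₁ w) a → Same z a w (to τ a)
    iso-same z w τ a i = rel-iso τ (inj₂ (P i)) (a ∷ [])

    same-iso : ∀ z w (τ : proj₁ z ≅ proj₁ w) {a b} → Same z a w b → to τ a ≡ b
    same-iso z w τ same = BKL̂.separated (proj₂ w) _ _ λ i → trans (sym (iso-same z w τ _ i)) (same i)

    same-≡ : ∀ z {a b} → Same z a z b → a ≡ b
    same-≡ z = BKL̂.separated (proj₂ z) _ _

    open Family

    -- Demands all translates as well. As there are only countably many words, the generic points
    -- remain comeager, and they now form an invariant set.
    saturate : Family → Family
    saturate 𝒟 = record
      { I         = Word × I 𝒟
      ; countable = ×-countable Word-countable (countable 𝒟)
      ; D         = λ (g , i) z → (g • z) ∈ D 𝒟 i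
      ; isOpen    = λ (g , i) {z} gz∈D → interior-pull {D 𝒟 i} g z (isOpen 𝒟 i {g • z} gz∈D)
      ; isDense   = λ (g , i) is (z , z∈is) →
          let w , w∈ , w∈D = isDense 𝒟 i (List.map (pull (inv g)) is)
                (g • z , •⇒pull (inv g) is {g • z} (basic-resp is {z} {inv g • g • z}
                  (≈-sym {inv g • g • z} {z} (inv-• g z)) z∈is))
          in inv g • w , pull⇒• (inv g) is {w} w∈ ,
             open-resp {D 𝒟 i} {w} {g • inv g • w} (isOpen 𝒟 i) (≈-sym {g • inv g • w} {w} (•-inv g w)) w∈D
      }

    saturate-gen : ∀ 𝒟 {z} → Gen (saturate 𝒟) z → Gen 𝒟 z
    saturate-gen 𝒟 {z} gen i = open-resp {D 𝒟 i} {[] • z} {z} (isOpen 𝒟 i) (act-trivial [] (λ _ → refl) (proj₁ z))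
      (gen ([] , i))

    saturate-invariant : ∀ 𝒟 g {z} → Gen (saturate 𝒟) z → Gen (saturate 𝒟) (g • z)
    saturate-invariant 𝒟 g {z} gen (h , i) =
      open-resp {D 𝒟 i} {(h ++ g) • z} {h • g • z} (isOpen 𝒟 i) (act-++ h g (proj₁ z)) (gen (h ++ g , i))

  -- Elements determined by finite sets

  eventually-map : ∀ {A : Set} {m} (f : ℕ → A → A) (g : A → A) → (∀ a → Eventually λ j → f j a ≡ g a) →
    ∀ (t : Vec A m) → Eventually λ j → Vec.map (f j) t ≡ Vec.map g t
  eventually-map f g f→g []      = 0 , λ _ _ → refl
  eventually-map f g f→g (a ∷ t) =
    let k , p = eventually-× (f→g a) (eventually-map f g f→g t)
    in k , λ j k≤j → cong₂ _∷_ (proj₁ (p j k≤j)) (proj₂ (p j k≤j))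

  module _ {L : Language} where
    open _≅_

    -- A pointwise limit of isomorphisms may fail to be onto, so its inverse is supplied separately.
    -- One implication between conditions is enough, as they fix function values and both truth
    -- values of relations.
    limit-iso : ∀ {M M∞ : Structure L ℕ} (N : ℕ → Structure L ℕ) (ρ : ∀ j → M ≅ N j) (to∞ from∞ : ℕ → ℕ) →
      (∀ a → Eventually λ j → to (ρ j) a ≡ to∞ a) → (∀ b → to∞ (from∞ b) ≡ b) → (∀ a → from∞ (to∞ a) ≡ a) →
      (∀ c → M∞ ∈ ⟦ c ⟧ → Eventually λ j → N j ∈ ⟦ c ⟧) → M ≅ M∞
    limit-iso {M} {M∞} N ρ to∞ from∞ ρ→ to-from from-to N→ = record
      { bijection = mk↔ₛ′ to∞ from∞ to-from from-to
      ; fun-hom = λ f t →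
          let k , p = eventually-× (eventually-× (ρ→ (fun M f t)) (eventually-map (λ j → to (ρ j)) to∞ ρ→ t))
                                   (N→ (value f (Vec.map to∞ t) (fun M∞ f (Vec.map to∞ t))) refl)
              (to≡ , map≡) , val = p k ≤-refl
          in trans (sym to≡) (trans (fun-hom (ρ k) f t) (trans (cong (fun (N k) f) map≡) val))
      ; rel-iso = λ r t →
          let k , p = eventually-× (eventually-map (λ j → to (ρ j)) to∞ ρ→ t) (rel→ r (Vec.map to∞ t))
              map≡ , val = p k ≤-refl
          in trans (rel-iso (ρ k) r t) (trans (cong (rel (N k) r) map≡) val)
      }
      where
      rel→ : ∀ r t → Eventually λ j → rel (N j) r t ≡ rel M∞ r t
      rel→ r t with rel M∞ r t in eq
      ... | true  = N→ (holds r t) eq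
      ... | false = N→ (fails r t) eq

  module Invariance (N : ℕ) .{{_ : NonZero N}} where
    private
      module L = Action N
      module C = L.Complete L.complete
    open L using (Family; Basic; Interior; _•_)
    open Family using (Gen)

    module _ (𝒢 : Family) (p₀ : List L.Cond) where
      Good : Pred L.Point 0ℓ
      Good z = Gen 𝒢 z × z ∈ Basic p₀

      -- `stable` is a demand of its own: `Same` involves infinitely many predicates, and continuity
      -- controls only finitely many on a neighbourhood.
      record Invariant (k : ℕ) .{{_ : NonZero k}} (α : L.Point → Action.Point k) : Set where
        private module K = Action k
        field
          continuous : ∀ {z} → Good z → ∀ c → proj₁ (α z) ∈ ⟦ c ⟧ → Interior (λ w → Good w → proj₁ (α w) ∈ ⟦ c ⟧) z
          lifts      : ∀ {z w} → Good z → Good w → proj₁ z ≅ proj₁ w → proj₁ (α z) ≅ proj₁ (α w)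
          stable     : ∀ {z} h {b b′} → Good z → Good (h • z) → K.Same (α z) b (α (h • z)) b′ →
            Interior (λ w → Good w → Good (h • w) → K.Same (α w) b (α (h • w)) b′) z

        continuous-basic : ∀ {z} → Good z → ∀ is → α z ∈ K.Basic is → Interior (λ w → Good w → α w ∈ K.Basic is) z
        continuous-basic {z} good is αz∈ = L.interior-⊆ z
          (λ all w-good → ListAll.tabulate λ c∈ → all c∈ w-good)
          (L.interior-all z is λ c∈ → continuous good _ (ListAll.lookup αz∈ c∈))

        continuous-interior : ∀ {S : Pred K.Point 0ℓ} {z} → Good z → K.Interior S (α z) → Interior (λ w → Good w → α w ∈ S) z
        continuous-interior {z = z} good (is , αz∈ , is⊆S) =
          L.interior-⊆ z (λ {w} f w-good → is⊆S {α w} (f w-good)) (continuous-basic good is αz∈)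

        bit-continuous : ∀ {z} → Good z → ∀ i b → Interior (λ w → Good w →
          K.bit (proj₁ (α z)) i b ≡ K.bit (proj₁ (α w)) i b) z
        bit-continuous {z} good i b =
          continuous-interior {λ v → K.bit (proj₁ (α z)) i b ≡ K.bit (proj₁ v) i b} good (K.bit-interior (α z) i b)

        -- `α` is a bare function, not assumed to respect `≈`. On good points continuity makes up
        -- for this, since `≈`-equal points lie in the same basic sets.
        respects : ∀ {z w} → Good z → Good w → z L.≈ w → ∀ b → K.Same (α z) b (α w) b
        respects {z} {w} z-good w-good z≈w b i =
          let is , z∈ , is⊆ = bit-continuous z-good i b in is⊆ {w} (L.basic-resp is {z} {w} z≈w z∈) w-good

    module Determination
      (𝒢 : Family) (p₀ : List L.Cond) (𝒢-invariant : ∀ g {z} → Gen 𝒢 z → Gen 𝒢 (g • z))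
      {k : ℕ} .{{_ : NonZero k}} {α : L.Point → Action.Point k} (α-inv : Invariant 𝒢 p₀ k α)
      {l : ℕ} .{{_ : NonZero l}} {β : L.Point → Action.Point l} (β-inv : Invariant 𝒢 p₀ l β)
      (reflects : ∀ {z w} → Good 𝒢 p₀ z → Good 𝒢 p₀ w → proj₁ (α z) ≅ proj₁ (α w) → proj₁ z ≅ proj₁ w)
      where
      private
        module K = Action k
        module M = Action l
        module A = Invariant α-inv
        module B = Invariant β-inv
        Good′ = Good 𝒢 p₀

      -- Compares only points of one orbit of the countable group. This is all that is applied
      -- later, and it turns a failure into a word, which works on a whole neighbourhood.
      Determined : List L.Cond → List ℕ → ℕ → Set
      Determined p G c = ∀ w w′ h → Gen 𝒢 w → Gen 𝒢 w′ → w′ L.≈ (h • w) → w ∈ Basic p → w′ ∈ Basic p →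
        (∀ {b} → b ∈ˡ G → K.Same (α w) b (α w′) b) → M.Same (β w) c (β w′) c

      module Contradiction (q : List L.Cond) (q⊆p₀ : Basic q ⊆ Basic p₀) (q≠∅ : L.Nonempty q) (c : ℕ)
        (none : ∀ js → L.Nonempty (q ++ js) → ∀ G → ¬ Determined (q ++ js) G c) where

        Moves : List L.Cond → List ℕ → Word → Pred L.Point 0ℓ
        Moves js G h z = (h • z) ∈ Basic (q ++ js) × (∀ {b} → b ∈ˡ G → K.Same (α z) b (α (h • z)) b)
          × ¬ M.Same (β z) c (β (h • z)) c

        good : ∀ js {z} → Gen 𝒢 z → z ∈ Basic (q ++ js) → Good′ z
        good js {z} gen z∈ = gen , q⊆p₀ {z} (++⁻ˡ q z∈)

        Bad : List L.Cond → List ℕ → Pred L.Point 0ℓ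
        Bad js G z = ∃ λ h → Moves js G h z

        violation : ∀ js → L.Nonempty (q ++ js) → ∀ G → ∃ λ w → ∃ λ h → Gen 𝒢 w × w ∈ Basic (q ++ js) × Moves js G h w
        violation js ne G = by-contradiction λ no-violation → none js ne G
          λ w w′ h gen gen′ w′≈hw w∈ w′∈ agree → by-contradiction λ differ →
            let hw∈ = L.basic-resp (q ++ js) {w′} {h • w} w′≈hw w′∈
                w′-good = good js gen′ w′∈ ; hw-good = good js (𝒢-invariant h gen) hw∈
            in no-violation (w , h , gen , w∈ , hw∈ ,
              (λ {b} b∈ i → trans (agree b∈ i) (A.respects w′-good hw-good w′≈hw b i)) ,
              λ same → differ λ i → trans (same i) (sym (B.respects w′-good hw-good w′≈hw c i)))

        bad-interior : ∀ js G h z → Gen 𝒢 z → z ∈ Basic (q ++ js) → Moves js G h z → Interior (λ w → Good′ w → Bad js G w) z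
        bad-interior js G h z gen z∈ (hz∈ , agree , differ) =
          let z-good = good js gen z∈ ; hz-good = good js (𝒢-invariant h gen) hz∈
              i , bits≢ = ¬∀⇒∃¬ differ
          in L.interior-⊆ z
            (λ {w} (hw∈ , agree′ , bit₁ , bit₂) w-good →
              let hw-good = good js (𝒢-invariant h (proj₁ w-good)) hw∈ in
              h , hw∈ , (λ {b} b∈ → agree′ b∈ w-good hw-good) ,
              λ same → bits≢ (trans (bit₁ w-good) (trans (same i) (sym (bit₂ hw-good)))))
            (L.interior-∩ z (L.interior-pull h z (L.interior-basic (h • z) (q ++ js) hz∈))
            (L.interior-∩ z (L.interior-all z G λ b∈ → A.stable h z-good hz-good (agree b∈))
            (L.interior-∩ z (B.bit-continuous z-good i c)
              (L.interior-pull {λ w → Good′ w → M.bit (proj₁ (β (h • z))) i c ≡ M.bit (proj₁ (β w)) i c} h z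
                (B.bit-continuous hz-good i c)))))

        -- A generic point of `q ++ js` admits a move inside `q ++ js` that keeps the types of `G`
        -- and changes that of `c`, for every `js` containing it and every `G`.
        ℬ : Family
        ℬ = record
          { I         = List L.Cond × List ℕ
          ; countable = ×-countable (List-countable L.cond-countable) (List-countable ℕ-countable)
          ; D         = λ (js , G) z → ¬ z ∈ Basic (q ++ js) ⊎ Interior (λ w → Good′ w → Bad js G w) z
          ; isOpen    = λ { (js , G) {z} (inj₁ z∉) →
                              let ks , z∈ks , disjoint = C.basic-complement (q ++ js) {z} z∉
                              in ks , z∈ks , λ {w} w∈ → inj₁ (disjoint {w} w∈)
                          ; (js , G) (inj₂ (ks , z∈ks , ks⊆)) → ks , z∈ks , λ w∈ → inj₂ (ks , w∈ , ks⊆) }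
          ; isDense   = dense
          }
          where
          dense : ∀ i → L.Dense λ z → ¬ z ∈ Basic (q ++ proj₁ i) ⊎ Interior (λ w → Good′ w → Bad (proj₁ i) (proj₂ i) w) z
          dense (js , G) is (z , z∈is) with dec (z ∈ Basic (q ++ js))
          ... | no  z∉ = z , z∈is , inj₁ z∉
          ... | yes z∈ =
            -- The violation is sought in the smaller set `q ++ (js ++ is)`, so that `w` also lies
            -- in the prescribed `is`.
            let w , h , gen , w∈ , hw∈ , rest = violation (js ++ is) (z , ++⁺ (++⁻ˡ q z∈) (++⁺ (++⁻ʳ q z∈) z∈is)) G
                shrink = λ {v} (v∈ : v ∈ Basic (q ++ (js ++ is))) → ++⁺ (++⁻ˡ q v∈) (++⁻ˡ js (++⁻ʳ q v∈))
            in w , ++⁻ʳ js (++⁻ʳ q w∈) , inj₂ (bad-interior js G h w gen (shrink {w} w∈) (shrink {h • w} hw∈ , rest))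

        module Fusion (x : L.Point) (x∈q : x ∈ Basic q) (x-gen : Gen 𝒢 x) (x-sat : Gen (L.saturate ℬ) x) where
          x-good : Good′ x
          x-good = x-gen , q⊆p₀ {x} x∈q

          -- `z` moves inside the orbit of `x`, `js` accumulates the conditions secured so far, and
          -- `fixed` holds the elements of `α z` whose types may no longer change.
          record State : Set where
            field
              z     : L.Point
              gen   : Gen 𝒢 z
              sat   : Gen (L.saturate ℬ) z
              iso   : proj₁ x ≅ proj₁ z
              js    : List L.Cond
              z∈    : z ∈ Basic (q ++ js)
              fixed : List ℕ

            z-good : Good′ z
            z-good = good js gen z∈

            α-iso : proj₁ (α x) ≅ proj₁ (α z)
            α-iso = A.lifts x-good z-good iso

          module Step (m : ℕ) (S : State) where
            open State S

            record Next : Set where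
              field
                z′     : L.Point
                gen′   : Gen 𝒢 z′
                sat′   : Gen (L.saturate ℬ) z′
                iso′   : proj₁ x ≅ proj₁ z′
                z′∈    : z′ ∈ Basic (q ++ js)
                keeps  : ∀ {b} → b ∈ˡ fixed → K.Same (α z) b (α z′) b
                misses : ¬ M.Same (β z′) c (β x) m

            abstract
              -- If `c` in `β z` has the type of `m` in `β x`, genericity of `z` for `ℬ` offers a
              -- move away from this type that respects `js` and `fixed`. Otherwise `z` stays.
              next : Next
              next with dec (M.Same (β z) c (β x) m)
              ... | no differ = record
                { z′ = z ; gen′ = gen ; sat′ = sat ; iso′ = iso ; z′∈ = z∈ ; keeps = λ _ _ → refl ; misses = differ }
              ... | yes same with L.saturate-gen ℬ {z} sat (js , fixed)
              ...   | inj₁ z∉ = contradiction z∈ z∉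
              ...   | inj₂ (ks , z∈ks , ks⊆) =
                let h , hz∈ , agree , differ = ks⊆ {z} z∈ks z-good in record
                { z′ = h • z ; gen′ = 𝒢-invariant h gen ; sat′ = L.saturate-invariant ℬ h {z} sat
                ; iso′ = ≅-trans iso (act-iso h (proj₁ z)) ; z′∈ = hz∈ ; keeps = agree
                ; misses = λ same′ → differ λ i → trans (same i) (sym (same′ i)) }

            open Next next public

            z′-good : Good′ z′
            z′-good = good js gen′ z′∈

            enum : Family.I 𝒢
            enum = proj₁ (Family.countable 𝒢) m

            abstract
              constraint : Interior (λ w → (Family.D 𝒢 enum w × (Good′ w → ¬ M.Same (β w) c (β x) m)) ×
                w ∈ Basic (L.detail z′ (suc m))) z′
              constraint = let i , bits≢ = ¬∀⇒∃¬ misses in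
                L.interior-∩ z′
                  (L.interior-∩ z′ (Family.isOpen 𝒢 enum {z′} (gen′ enum))
                    (L.interior-⊆ z′ (λ bit≡ w-good same → bits≢ (trans (bit≡ w-good) (same i)))
                      (B.bit-continuous z′-good i c)))
                  (L.interior-basic z′ (L.detail z′ (suc m)) (L.∈-detail z′ (suc m)))

            extra : List L.Cond
            extra = proj₁ constraint

            extra⊆ : ∀ w → w ∈ Basic (q ++ (js ++ extra)) →
              (Family.D 𝒢 enum w × (Good′ w → ¬ M.Same (β w) c (β x) m)) × w ∈ Basic (L.detail z′ (suc m))
            extra⊆ w w∈ = proj₂ (proj₂ constraint) {w} (++⁻ʳ js (++⁻ʳ q w∈))

            z′∈extra : z′ ∈ Basic (q ++ (js ++ extra))
            z′∈extra = ++⁺ (++⁻ˡ q z′∈) (++⁺ (++⁻ʳ q z′∈) (proj₁ (proj₂ constraint)))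

            state : State
            state = record
              { z = z′ ; gen = gen′ ; sat = sat′ ; iso = iso′ ; js = js ++ extra
              ; z∈ = z′∈extra
              -- Freezing the image of `m` makes the isomorphisms converge at `m`; freezing `m`
              -- itself gives it a preimage under the limit.
              ; fixed = m ∷ _≅_.to (A.lifts x-good (good (js ++ extra) gen′ z′∈extra) iso′) m ∷ fixed
              }

          states : ℕ → State
          states zero = record
            { z = x ; gen = x-gen ; sat = x-sat
            ; iso = ≗⇒≅ (L.≈-refl {x}) ; js = L.detail x 0 ; z∈ = ++⁺ x∈q (L.∈-detail x 0) ; fixed = [] }
          states (suc m) = Step.state m (states m)

          open State using (z; js; z∈; fixed; z-good; α-iso)

          sequence : C.FusionSequence
          sequence = record
            { z       = λ m → z (states m)
            ; B       = λ m → q ++ js (states m)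
            ; z∈B     = λ m → z∈ (states m)
            ; nested  = λ m w∈ → ++⁺ (++⁻ˡ q w∈) (++⁻ˡ (js (states m)) (++⁻ʳ q w∈))
            ; details = λ { zero w∈ → ++⁻ʳ q w∈ ; (suc m) {w} w∈ → proj₂ (Step.extra⊆ m (states m) w w∈) }
            }
          open C.FusionSequence sequence using (z∞; z∞∈B; basic-eventually)

          z∞-good : Good′ z∞
          z∞-good = (λ i → let m , eq = proj₂ (Family.countable 𝒢) i in
              subst (λ i → Family.D 𝒢 i z∞) eq (proj₁ (proj₁ (Step.extra⊆ m (states m) z∞ (z∞∈B (suc m))))))
            , q⊆p₀ {z∞} (++⁻ˡ q (z∞∈B 0))

          y : ℕ → K.Point
          y m = α (z (states m))

          y→ : ∀ c → proj₁ (α z∞) ∈ ⟦ c ⟧ → Eventually λ m → proj₁ (y m) ∈ ⟦ c ⟧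
          y→ c αz∞∈ =
            let is , z∞∈ , is⊆ = A.continuous z∞-good c αz∞∈
                m , f = basic-eventually is z∞∈
            in m , λ j m≤j → is⊆ {z (states j)} (f j m≤j) (z-good (states j))

          fixed-mono : ∀ {m j} → m ≤′ j → ∀ {b} → b ∈ˡ fixed (states m) → b ∈ˡ fixed (states j)
          fixed-mono ≤′-refl       b∈ = b∈
          fixed-mono (≤′-step m≤j) b∈ = there (there (fixed-mono m≤j b∈))

          kept : ∀ {m j} → m ≤′ j → ∀ {b} → b ∈ˡ fixed (states m) → K.Same (y m) b (y j) b
          kept ≤′-refl                   b∈ i = refl
          kept {j = suc j} (≤′-step m≤j) b∈ i = trans (kept m≤j b∈ i) (Step.keeps j (states j) (fixed-mono m≤j b∈) i)

          to∞ : ℕ → ℕ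
          to∞ a = _≅_.to (α-iso (states (suc a))) a

          from∞ : ℕ → ℕ
          from∞ b = Inverse.from (_≅_.bijection (α-iso (states (suc b)))) b

          to∞-same : ∀ a {j} → suc a ≤ j → K.Same (α x) a (y j) (to∞ a)
          to∞-same a {j} a<j i = trans (K.iso-same (α x) (y (suc a)) (α-iso (states (suc a))) a i)
            (kept (≤⇒≤′ a<j) (there (here refl)) i)

          from∞-same : ∀ b {j} → suc b ≤ j → K.Same (α x) (from∞ b) (y j) b
          from∞-same b {j} b<j i = trans (K.iso-same (α x) (y (suc b)) (α-iso (states (suc b))) (from∞ b) i)
            (trans (cong (K.bit (proj₁ (y (suc b))) i) (Inverse.strictlyInverseˡ (_≅_.bijection (α-iso (states (suc b)))) b))
              (kept (≤⇒≤′ b<j) (here refl) i))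

          α-limit : proj₁ (α x) ≅ proj₁ (α z∞)
          α-limit = limit-iso (λ j → proj₁ (y j)) (λ j → α-iso (states j)) to∞ from∞
            (λ a → suc a , λ j a<j → K.same-iso (α x) (y j) (α-iso (states j)) (to∞-same a a<j))
            (λ b → let j = suc b ⊔ suc (from∞ b) in K.same-≡ (y j) λ i →
              trans (sym (to∞-same (from∞ b) (m≤n⊔m (suc b) _) i)) (from∞-same b (m≤m⊔n (suc b) (suc (from∞ b))) i))
            (λ a → let j = suc a ⊔ suc (to∞ a) in K.same-≡ (α x) λ i →
              trans (from∞-same (to∞ a) (m≤n⊔m (suc a) _) i) (sym (to∞-same a (m≤m⊔n (suc a) (suc (to∞ a))) i)))
            y→

          contradictory : ⊥
          contradictory =
            let σ = B.lifts x-good z∞-good (reflects x-good z∞-good α-limit)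
                -- This element of `β x` would have the type of `c` in `β z∞`, but step `m` excluded
                -- that by a condition kept ever after.
                m = Inverse.from (_≅_.bijection σ) c
            in proj₂ (proj₁ (Step.extra⊆ m (states m) z∞ (z∞∈B (suc m)))) z∞-good λ i →
              sym (trans (M.iso-same (β x) (β z∞) σ m i)
                (cong (M.bit (proj₁ (β z∞)) i) (Inverse.strictlyInverseˡ (_≅_.bijection σ) c)))

        impossible : ⊥
        impossible =
          let x , x∈q , x-gen = C.baire (𝒢 L.⊕ L.saturate ℬ) q q≠∅
          in Fusion.contradictory x x∈q (λ i → x-gen (inj₁ i)) (λ i → x-gen (inj₂ i))

      -- Otherwise the class of a generic point contains a sequence converging to a point z∞ for which α z∞ belongs to
      -- the same class while the element c of β z∞ realises no type realised in β x.
      determine : ∀ q → Basic q ⊆ Basic p₀ → L.Nonempty q → ∀ c →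
        ∃ λ js → L.Nonempty (q ++ js) × ∃ λ G → Determined (q ++ js) G c
      determine q q⊆p₀ q≠∅ c = by-contradiction λ none →
        Contradiction.impossible q (λ {z} → q⊆p₀ {z}) q≠∅ c λ js ne G det → none (js , ne , G , det)

  -- Amalgamation

  -- With the first entry of a tuple as the default `d`, the behaviour beyond the list is the one
  -- that B2 prescribes.
  nth : List ℕ → ℕ → ℕ → ℕ
  nth []       d i       = d
  nth (x ∷ xs) d zero    = x
  nth (x ∷ xs) d (suc i) = nth xs d i

  nth-beyond : ∀ xs {d i} → length xs < i → nth xs d i ≡ d
  nth-beyond []       _           = refl
  nth-beyond (x ∷ xs) (s≤s len<i) = nth-beyond xs len<i

  nth-∈ : ∀ xs {d} i → nth xs d i ∈ˡ xs ⊎ nth xs d i ≡ d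
  nth-∈ []       i    = inj₂ refl
  nth-∈ (x ∷ xs) zero = inj₁ (here refl)
  nth-∈ (x ∷ xs) (suc i) with nth-∈ xs i
  ... | inj₁ m  = inj₁ (there m)
  ... | inj₂ eq = inj₂ eq

  ∈-nth : ∀ {xs d x} → x ∈ˡ xs → ∃ λ i → nth xs d i ≡ x
  ∈-nth (here refl) = 0 , refl
  ∈-nth (there m)   = let i , eq = ∈-nth m in suc i , eq

  top-≤ : ∀ {n k} {t : Vec ℕ n} → All (_≤ k) t → top t ≤ k
  top-≤ []       = z≤n
  top-≤ (a≤ ∷ t≤) = ⊔-lub a≤ (top-≤ t≤)

  first-All : ∀ {n} .{{_ : NonZero n}} {Q : Pred ℕ 0ℓ} {t : Vec ℕ n} → All Q t → Q (first t)
  first-All (q ∷ _) = q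

  does-true : ∀ {i j} → does (i ≟ j) ≡ true → i ≡ j
  does-true {i} {j} eq = ≡ᵇ⇒≡ i j (subst T (sym eq) _)

  -- Tuples inside a piece keep their values, and on every other tuple t the functions enumerate span t.
  module Glue (n : ℕ) .{{_ : NonZero n}} where
    open Action n

    -- The bound `e` is for B4: by `span≤` every initial segment reaching `e` is closed. `dependent`
    -- is what is needed for B3, which inside a single piece is inherited. Only the first `K`
    -- predicates are copied from the pieces.
    record Pieces : Set₁ where
      field
        J      : Set
        point  : J → Point
        C      : J → Pred ℕ 0ℓ
        closed : ∀ ι → Closed (proj₁ (point ι)) (C ι)
        e K    : ℕ
        C≤e    : ∀ ι {a} → C ι a → a ≤ e
        compatible : ∀ ι κ → Agree (λ a → C ι a × C κ a) K (proj₁ (point ι)) (proj₁ (point κ))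
        span   : Vec ℕ n → List ℕ
        span≤  : ∀ t {a} → a ∈ˡ span t → a ≤ e ⊔ top t

      InPiece : Vec ℕ n → Set
      InPiece t = ∃ λ ι → All (C ι) t

      field
        dependent : ∀ xs → Unique xs → length xs ≡ suc n → (∃ λ ι → ∀ {x} → x ∈ˡ xs → C ι x) ⊎
          (∃ λ b → b ∈ˡ xs × ∃ λ t → All (λ x → x ∈ˡ xs × x ≢ b) t × ¬ InPiece t × b ∈ˡ span t)

    module Glued (pieces : Pieces) where
      open Pieces pieces

      opOf : ∀ t → Dec (InPiece t) → ℕ → ℕ
      opOf t (yes (ι , _)) i = op (proj₁ (point ι)) i t
      opOf t (no _)        i = nth (span t) (first t) i

      rankOf : ∀ t → Dec (InPiece t) → ℕ
      rankOf t (yes (ι , _)) = rank (point ι) t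
      -- All functions with a larger index return the first entry, as B2 requires.
      rankOf t (no _)        = length (span t)

      -- From index `K` on, the predicate with index `K + a` holds at `a` alone. This separates the
      -- elements whatever was copied below `K`.
      bitOf : ∀ a → Dec (∃ λ ι → C ι a) → ∀ i → Dec (i < K) → Bool
      bitOf a _             i (no _)  = does (K + a ≟ i)
      bitOf a (no _)        i (yes _) = false
      bitOf a (yes (ι , _)) i (yes _) = bit (proj₁ (point ι)) i a

      relations : ∀ r → Vec ℕ (Language.relArity (ℒ̂ n) r) → Bool
      relations (inj₁ (R j)) t        = does (rankOf t (dec (InPiece t)) ≟ j)
      relations (inj₂ (P i)) (a ∷ []) = bitOf a (dec (∃ λ ι → C ι a)) i (i <? K)

      G : Structure (ℒ̂ n) ℕ
      G = record { fun = λ { (s i) t → opOf t (dec (InPiece t)) i } ; rel = relations }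

      op-piece : ∀ ι {t} → All (C ι) t → ∀ i → op (proj₁ (point ι)) i t ≡ op G i t
      op-piece ι {t} t∈ i with dec (InPiece t)
      ... | yes (κ , t∈′) = ops (compatible ι κ) (VecAll.zip (t∈ , t∈′)) i
      ... | no  t∉        = contradiction (ι , t∈) t∉

      rank-piece : ∀ ι {t} → All (C ι) t → rankOf t (dec (InPiece t)) ≡ rank (point ι) t
      rank-piece ι {t} t∈ with dec (InPiece t)
      ... | yes (κ , t∈′) = rank-unique (point κ) t
        (trans (sym (ranks (compatible ι κ) (VecAll.zip (t∈ , t∈′)) (rank (point ι) t))) (rank-ranked (point ι) t))
      ... | no  t∉        = contradiction (ι , t∈) t∉

      ranked-piece : ∀ ι {t} → All (C ι) t → ∀ j → ranked (proj₁ (point ι)) j t ≡ ranked G j t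
      ranked-piece ι {t} t∈ j = trans (rank-does (rank (point ι) t ≟ j)) (cong (λ r → does (r ≟ j)) (sym (rank-piece ι t∈)))
        where
        rank-does : (rank≟j : Dec (rank (point ι) t ≡ j)) → ranked (proj₁ (point ι)) j t ≡ does rank≟j
        rank-does (yes refl)  = rank-ranked (point ι) t
        rank-does (no rank≢j) = ¬-not (λ eq → rank≢j (rank-unique (point ι) t eq))

      bit-piece : ∀ ι {a} → C ι a → ∀ i → i < K → bit (proj₁ (point ι)) i a ≡ bit G i a
      bit-piece ι {a} a∈ i i<K with i <? K
      ... | no  i≮K = contradiction i<K i≮K
      ... | yes _ with dec (∃ λ ι → C ι a)
      ...   | yes (κ , a∈′) = bits (compatible ι κ) (a∈ , a∈′) i i<K
      ...   | no  a∉        = contradiction (ι , a∈) a∉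

      agree-piece : ∀ ι → Agree (C ι) K (proj₁ (point ι)) G
      agree-piece ι = agree (op-piece ι) (ranked-piece ι) (bit-piece ι)

      op-fresh : ∀ {t} → ¬ InPiece t → ∀ i → op G i t ≡ nth (span t) (first t) i
      op-fresh {t} t∉ i with dec (InPiece t)
      ... | yes t∈ = contradiction t∈ t∉
      ... | no  _  = refl

      bit-own : ∀ a → bit G (K + a) a ≡ true
      bit-own a with K + a <? K
      ... | yes lt = contradiction (m≤m+n K a) (<⇒≱ lt)
      ... | no  _  = dec-true (K + a ≟ K + a) refl

      bit-other : ∀ {a b} → bit G (K + a) b ≡ true → a ≡ b
      bit-other {a} {b} eq with K + a <? K
      ... | yes lt = contradiction (m≤m+n K a) (<⇒≱ lt)
      ... | no  _  = sym (+-cancelˡ-≡ K b a (does-true eq))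

      above : ∀ t i → rankOf t (dec (InPiece t)) < i → op G i t ≡ first t
      above t i rank<i with dec (InPiece t)
      ... | yes (ι , _) = op-above (point ι) t rank<i
      ... | no  _       = nth-beyond (span t) rank<i

      op-bound : ∀ {k} t → e ≤ k → All (_≤ k) t → ∀ i → op G i t ≤ k
      op-bound t e≤k t≤k i with dec (InPiece t)
      ... | yes (ι , t∈) = ≤-trans (C≤e ι (closed ι t t∈ i)) e≤k
      ... | no  _ with nth-∈ (span t) {first t} i
      ...   | inj₁ m  = ≤-trans (span≤ t m) (⊔-lub e≤k (top-≤ t≤k))
      ...   | inj₂ eq = subst (_≤ _) (sym eq) (first-All t≤k)

      glued : Point
      glued = G , record
        { reduct∈𝓑 = record
          { B1 = λ t → rankOf t (dec (InPiece t)) , dec-true (rankOf t (dec (InPiece t)) ≟ _) refl , does-true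
          ; B2 = λ t j ranked i j<i → above t i (subst (_< i) (sym (does-true ranked)) j<i)
          ; B3 = λ xs unique len → case dependent xs unique len of λ
              { (inj₁ (ι , xs⊆C)) → let b , b∈ , gen = B3 (point ι) xs unique len in
                  b , b∈ , proj₂ (generated-transfer (proj₁ (point ι)) G (closed ι) (λ (x∈ , _) → xs⊆C x∈) (op-piece ι) gen)
              ; (inj₂ (b , b∈ , t , t∈ , fresh , b∈span)) → let i , eq = ∈-nth {d = first t} b∈span in
                  b , b∈ , subst (Generated (reduct G) _) (trans (op-fresh fresh i) eq) (app (s i) (VecAll.map base t∈))
              }
          ; B4 = λ xs → bounded-finite (Generated (reduct G) (_∈ˡ xs)) (e ⊔ maximum xs)
              λ gen → proj₁ (generated-transfer G G {λ a → a ≤ e ⊔ maximum xs}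
                (λ t t≤ i → op-bound t (m≤m⊔n e _) t≤ i) (λ x∈ → ≤-trans (≤-maximum x∈) (m≤n⊔m e _)) (λ _ _ → refl) gen)
          }
        ; separated = λ a b same → bit-other (trans (sym (same (K + a))) (bit-own a))
        }

    closed-act : ∀ g {M C} → Closed M C → Closed (act g M) (C ∘ bwd g)
    closed-act g {M} {C} closed t t∈ i = subst C (sym (bwd-fwd g _)) (closed (Vec.map (bwd g) t) (VecAllₚ.map⁺ t∈) i)

    -- For looking at a displaced copy from the original position, where the conditions about it
    -- were formulated.
    agree-act : ∀ g {C K M O} → Agree (C ∘ bwd g) K (act g M) O → Agree C K M (act (inv g) O)
    agree-act g {C} {K} {M} {O} gM~O = agree
      (λ {t} t∈ i → trans (trans (sym (bwd-fwd g _)) (cong (bwd g)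
        (trans (cong (fwd g ∘ op M i) (sym (map-inverse (bwd-fwd g) t)))
          (ops gM~O (moved t∈) i)))) (trans (sym (fwd-inv g _))
            (cong (fwd (inv g) ∘ op O i) (sym (map-cong (bwd-inv g) t)))))
      (λ {t} t∈ j → trans (cong (ranked M j) (sym (map-inverse (bwd-fwd g) t)))
          (trans (ranks gM~O (moved t∈) j) (cong (ranked O j) (sym (map-cong (bwd-inv g) t)))))
      (λ {a} a∈ i i<K → trans (cong (bit M i) (sym (bwd-fwd g a)))
          (trans (bits gM~O (subst C (sym (bwd-fwd g a)) a∈) i i<K) (cong (bit O i) (sym (bwd-inv g a)))))
      where
      moved : ∀ {m} {t : Vec ℕ m} → All C t → All (C ∘ bwd g) (Vec.map (fwd g) t)
      moved t∈ = VecAllₚ.map⁺ (VecAll.map (λ {a} a∈ → subst C (sym (bwd-fwd g a)) a∈) t∈)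

  unique-lookup : ∀ {xs : List ℕ} → Unique xs → ∀ {i j} → i Fin.< j → List.lookup xs i ≢ List.lookup xs j
  unique-lookup (x∉ AllPairs.∷ u) {Fin.zero}  {Fin.suc j} _         = ListAll.lookup x∉ (∈-lookup j)
  unique-lookup (x∉ AllPairs.∷ u) {Fin.suc i} {Fin.suc j} (s<s i<j) = unique-lookup u i<j

  list-pigeonhole : ∀ {m} (xs : List ℕ) → Unique xs → m < length xs → (f : ∀ {x} → x ∈ˡ xs → Fin m) →
    ∃ λ x → ∃ λ y → Σ (x ∈ˡ xs) λ x∈ → Σ (y ∈ˡ xs) λ y∈ → x ≢ y × f x∈ ≡ f y∈
  list-pigeonhole xs unique m< f =
    let i , j , i<j , eq = pigeonhole m< (λ i → f (∈-lookup {xs = xs} i))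
    in _ , _ , ∈-lookup i , ∈-lookup j , unique-lookup unique i<j , eq

  outside : ∀ (xs cs : List ℕ) → Unique xs → length cs < length xs → ∃ λ b → b ∈ˡ xs × ¬ b ∈ˡ cs
  outside xs cs unique cs<xs = by-contradiction λ none →
    let inside = λ {x} (x∈ : x ∈ˡ xs) → by-contradiction {A = x ∈ˡ cs} λ x∉ → none (x , x∈ , x∉)
        x , y , x∈ , y∈ , x≢y , eq = list-pigeonhole xs unique cs<xs (λ x∈ → Any.index (inside x∈))
    in x≢y (index-injective (≡-setoid ℕ) (inside x∈) (inside y∈) eq)

  remove : ∀ {n b} (xs : List ℕ) → b ∈ˡ xs → Unique xs → length xs ≡ suc n →
    ∃ λ (t : Vec ℕ n) → All (λ x → x ∈ˡ xs × x ≢ b) t × (∀ {Q : Pred ℕ 0ℓ} → All Q t → ∀ {x} → x ∈ˡ xs → x ≢ b → Q x)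
  remove (b ∷ ys) (here refl) (b∉ AllPairs.∷ u) refl =
    Vec.fromList ys ,
    VecAllₚ.fromList⁺ (ListAll.tabulate λ y∈ → there y∈ , λ y≡b → ListAll.lookup b∉ y∈ (sym y≡b)) ,
    λ { qs (here refl) x≢b → contradiction refl x≢b ; qs (there x∈) x≢b → ListAll.lookup (VecAllₚ.fromList⁻ qs) x∈ }
  remove {suc n} (y ∷ ys) (there m) (y∉ AllPairs.∷ u) len =
    let t , t∈ , all = remove ys m u (suc-injective len)
    in y ∷ t , (here refl , ListAll.lookup y∉ m) ∷ VecAll.map (map₁ there) t∈ ,
       λ { (q ∷ qs) (here refl) _ → q ; (q ∷ qs) (there x∈) x≢b → all qs x∈ x≢b }
  remove {zero} (y ∷ []) (there ()) _ _
  remove {zero} (y ∷ _ ∷ _) (there _) _ ()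

  greatest : (Q : Pred ℕ 0ℓ) (xs : List ℕ) → (∃ λ x → x ∈ˡ xs × Q x) →
    ∃ λ c → c ∈ˡ xs × Q c × (∀ {x} → x ∈ˡ xs → Q x → x ≤ c)
  greatest Q (y ∷ ys) some with dec (∃ λ x → x ∈ˡ ys × Q x)
  ... | no none = case some of λ
    { (_ , here refl , q) → y , here refl , q , λ { (here refl) _ → ≤-refl ; (there x∈) qx →
        contradiction (_ , x∈ , qx) none }
    ; (x , there x∈ , q)  → contradiction (x , x∈ , q) none }
  ... | yes rest with greatest Q ys rest | dec (Q y)
  ...   | c , c∈ , qc , max | no ¬qy = c , there c∈ , qc ,
    λ { (here refl) qy → contradiction qy ¬qy ; (there x∈) qx → max x∈ qx }
  ...   | c , c∈ , qc , max | yes qy with ≤-total c y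
  ...     | inj₁ c≤y = y , here refl , qy , λ { (here refl) _ → ≤-refl ; (there x∈) qx → ≤-trans (max x∈ qx) c≤y }
  ...     | inj₂ y≤c = c , there c∈ , qc , λ { (here refl) _ → y≤c ; (there x∈) qx → max x∈ qx }

  -- For `e ≤ d` the transpositions are disjoint, so none of them disturbs another.
  exchange : (Q : Pred ℕ 0ℓ) (d e : ℕ) → Word
  exchange Q d zero = []
  exchange Q d (suc e) with dec (Q e)
  ... | yes _ = (e , e + d) ∷ exchange Q d e
  ... | no  _ = exchange Q d e

  module _ (Q : Pred ℕ 0ℓ) (d : ℕ) where
    exchange-fixed : ∀ e {x} → ¬ (x < e × Q x) → (∀ {a} → a < e → Q a → x ≢ a + d) → fwd (exchange Q d e) x ≡ x
    exchange-fixed zero    _   _   = refl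
    exchange-fixed (suc e) {x} x∉ x≢ with dec (Q e) | exchange-fixed e {x} (λ (x<e , q) →
      x∉ (m<n⇒m<1+n x<e , q)) (λ a<e → x≢ (m<n⇒m<1+n a<e))
    ... | no  _ | fixed = fixed
    ... | yes q | fixed = trans (cong (swap e (e + d)) fixed) (swap-other (λ { refl → x∉ (≤-refl , q) }) (x≢ ≤-refl q))

    exchange-up : ∀ e → e ≤ d → ∀ {a} → a < e → Q a → fwd (exchange Q d e) a ≡ a + d
    exchange-up (suc e) e<d {a} (s≤s a≤e) qa with dec (Q e) | m≤n⇒m<n∨m≡n a≤e
    ... | no ¬q | inj₂ refl = contradiction qa ¬q
    ... | no _  | inj₁ a<e  = exchange-up e (<⇒≤ e<d) a<e qa
    ... | yes _ | inj₁ a<e  = trans (cong (swap e (e + d)) (exchange-up e (<⇒≤ e<d) a<e qa))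
      (swap-other (λ eq → <⇒≱ e<d (subst (d ≤_) eq (m≤n+m d a))) (λ eq → <⇒≢ a<e (+-cancelʳ-≡ d a e eq)))
    ... | yes _ | inj₂ refl = trans
      (cong (swap e (e + d)) (exchange-fixed e (λ (lt , _) → <-irrefl refl lt) λ {b} _ _ eq →
        <⇒≱ e<d (subst (d ≤_) (sym eq) (m≤n+m d b))))
      (swap-left e (e + d))

    exchange-down : ∀ e → e ≤ d → ∀ {a} → a < e → Q a → fwd (exchange Q d e) (a + d) ≡ a
    exchange-down (suc e) e<d {a} (s≤s a≤e) qa with dec (Q e) | m≤n⇒m<n∨m≡n a≤e
    ... | no ¬q | inj₂ refl = contradiction qa ¬q
    ... | no _  | inj₁ a<e  = exchange-down e (<⇒≤ e<d) a<e qa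
    ... | yes _ | inj₁ a<e  = trans (cong (swap e (e + d)) (exchange-down e (<⇒≤ e<d) a<e qa))
      (swap-other (<⇒≢ a<e) λ eq → <⇒≱ (<-trans a<e e<d) (subst (d ≤_) (sym eq) (m≤n+m d e)))
    ... | yes _ | inj₂ refl = trans
      (cong (swap e (e + d)) (exchange-fixed e (λ (lt , _) → <⇒≱ (<-trans lt e<d) (m≤n+m d e)) λ {b} b<e _ eq →
        <⇒≢ b<e (sym (+-cancelʳ-≡ d e b eq))))
      (swap-right e (e + d))

  -- Disjoint copies of a finite substructure, and two copies over a closed part

  module Blocks (n : ℕ) .{{_ : NonZero n}} where
    open Action n
    open Glue n

    -- Glued from no pieces at all: a tuple containing the largest element of a set produces
    -- everything below it, hence whichever other element was removed.
    inhabitant : Point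
    inhabitant = Glued.glued record
      { J = ⊥ ; point = λ () ; C = λ () ; closed = λ () ; e = 0 ; K = 0 ; C≤e = λ () ; compatible = λ ()
      ; span = λ t → upTo (suc (top t)) ; span≤ = λ t a∈ → ≤-pred (∈-upTo⁻ a∈)
      ; dependent = λ xs unique len →
          let x , x∈ , _ = outside xs [] unique (subst (0 <_) (sym len) z<s)
              c , c∈ , _ , max = greatest (λ _ → ⊤) xs (x , x∈ , tt)
              b , b∈ , b∉ = outside xs (c ∷ []) unique (subst (1 <_) (sym len) (s≤s (>-nonZero⁻¹ n)))
              t , t∈ , all = remove xs b∈ unique len
          in inj₂ (b , b∈ , t , t∈ , (λ ()) , ∈-upTo⁺ (s≤s (≤-trans (max b∈ tt) (all (≤-top t) c∈ λ c≡b →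
              b∉ (here (sym c≡b))))))
      }

    module Disjoint (z : Point) (F : Pred ℕ 0ℓ) (F-closed : Closed (proj₁ z) F) (e K : ℕ) (F<e : ∀ {a} → F a → a < e) where
      -- Copy `j` occupies the numbers from `j * e` up to, but excluding, `suc j * e`. Copy 0 is
      -- left in place, so its word is empty.
      shift : ℕ → Word
      shift zero    = []
      shift (suc j) = exchange (λ _ → ⊤) (suc j * e) e

      shift-fwd : ∀ j {a} → a < e → fwd (shift j) a ≡ a + j * e
      shift-fwd zero    {a} _   = sym (+-identityʳ a)
      shift-fwd (suc j)     a<e = exchange-up (λ _ → ⊤) (suc j * e) e (m≤m+n e (j * e)) a<e tt

      -- The bound `j < n` leaves all further pieces empty, which allows `ℕ` as index set.
      C : ℕ → Pred ℕ 0ℓ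
      C j a = j < n × F (bwd (shift j) a)

      position : ∀ {j a} → C j a → a ≡ bwd (shift j) a + j * e
      position {j} {a} (_ , Fa) = trans (sym (fwd-bwd (shift j) a)) (shift-fwd j (F<e Fa))

      below : ∀ {i j a} → C i a → C j a → ¬ i < j
      below {i} {j} {a} Ca Ca′ i<j = <-irrefl refl (<-≤-trans
        (subst (_< suc i * e) (sym (position Ca)) (+-monoˡ-< (i * e) (F<e (proj₂ Ca))))
        (≤-trans (*-monoˡ-≤ e i<j) (subst (j * e ≤_) (sym (position Ca′)) (m≤n+m (j * e) _))))

      disjoint : ∀ {i j a} → C i a → C j a → i ≡ j
      disjoint {i} {j} Ca Ca′ with <-cmp i j
      ... | tri< i<j _ _ = contradiction i<j (below Ca Ca′)
      ... | tri≈ _ i≡j _ = i≡j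
      ... | tri> _ _ j<i = contradiction j<i (below Ca′ Ca)

      C≤ : ∀ j {a} → C j a → a ≤ n * e
      C≤ j {a} Ca = ≤-trans (subst (_≤ suc j * e) (sym (position Ca)) (+-monoˡ-≤ (j * e) (<⇒≤ (F<e (proj₂ Ca)))))
        (*-monoˡ-≤ e (proj₁ Ca))

      Covered : Pred ℕ 0ℓ
      Covered a = ∃ λ j → C j a

      Meets : Vec ℕ n → ℕ → Set
      Meets t j = ¬ All (λ x → ¬ C j x) t

      Touched : Vec ℕ n → Pred ℕ 0ℓ
      Touched t a = ∃ λ j → C j a × Meets t j

      -- Inside the blocks a tuple reaches only the blocks it meets; this is what keeps the union of
      -- the blocks other than `i` closed. A tuple with an entry outside all blocks lies in no such
      -- union and may produce everything up to a bound.
      spanOf : ∀ t → Dec (All Covered t) → List ℕ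
      spanOf t (yes _) = List.filter (λ a → dec (Touched t a)) (upTo (suc (n * e)))
      spanOf t (no  _) = upTo (suc (n * e ⊔ top t))

      span : Vec ℕ n → List ℕ
      span t = spanOf t (dec (All Covered t))

      touched⇒∈-span : ∀ {t a} → Touched t a → a ∈ˡ span t
      touched⇒∈-span {t} {a} touched@(j , Ca , _) with dec (All Covered t)
      ... | yes _ = ∈-filter⁺ (λ a → dec (Touched t a)) (∈-upTo⁺ (s≤s (C≤ j Ca))) touched
      ... | no  _ = ∈-upTo⁺ (s≤s (≤-trans (C≤ j Ca) (m≤m⊔n _ _)))

      ∈-span⇒touched : ∀ {t a} → All Covered t → a ∈ˡ span t → Touched t a
      ∈-span⇒touched {t} covered a∈ with dec (All Covered t)
      ... | yes _ = proj₂ (∈-filter⁻ (λ a → dec (Touched t a)) {xs = upTo (suc (n * e))} a∈)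
      ... | no  ¬covered = contradiction covered ¬covered

      uncovered⇒∈-span : ∀ {t a} → ¬ All Covered t → a ≤ n * e ⊔ top t → a ∈ˡ span t
      uncovered⇒∈-span {t} ¬covered a≤ with dec (All Covered t)
      ... | yes covered = contradiction covered ¬covered
      ... | no  _ = ∈-upTo⁺ (s≤s a≤)

      span≤ : ∀ t {a} → a ∈ˡ span t → a ≤ n * e ⊔ top t
      span≤ t a∈ with dec (All Covered t)
      ... | no  _ = ≤-pred (∈-upTo⁻ a∈)
      ... | yes _ = ≤-trans (≤-pred (∈-upTo⁻ (proj₁ (∈-filter⁻ (λ a → dec (Touched t a)) {xs =
        upTo (suc (n * e))} a∈)))) (m≤m⊔n _ _)

      compatible : ∀ i j → Agree (λ a → C i a × C j a) K (proj₁ (shift i • z)) (proj₁ (shift j • z))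
      compatible i j with i ≟ j
      ... | yes refl = agree (λ _ _ → refl) (λ _ _ → refl) (λ _ _ _ → refl)
      ... | no  i≢j  = agree (λ t∈ → contradiction (common t∈) i≢j) (λ t∈ → contradiction (common t∈) i≢j)
                             (λ (Ca , Ca′) → contradiction (disjoint Ca Ca′) i≢j)
        where
        common : ∀ {t : Vec ℕ n} → All (λ a → C i a × C j a) t → i ≡ j
        common t∈ = let Ca , Ca′ = first-All t∈ in disjoint Ca Ca′

      Dependent : List ℕ → Set
      Dependent xs = (∃ λ j → ∀ {x} → x ∈ˡ xs → C j x) ⊎
        (∃ λ b → b ∈ˡ xs × ∃ λ t → All (λ x → x ∈ˡ xs × x ≢ b) t × ¬ (∃ λ j → All (C j) t) × b ∈ˡ span t)

      -- Two of n + 1 elements of the n blocks lie in the same block, and then either of them is in the span of the others.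
      dependent-covered : ∀ xs → Unique xs → length xs ≡ suc n → (∀ {x} → x ∈ˡ xs → Covered x) → Dependent xs
      dependent-covered xs unique len covered with dec (∃ λ j → ∀ {x} → x ∈ˡ xs → C j x)
      ... | yes inside = inj₁ inside
      ... | no  spread =
        let colour = λ {x} (x∈ : x ∈ˡ xs) → Fin.fromℕ< (proj₁ (proj₂ (covered x∈)))
            b , y , b∈ , y∈ , b≢y , same = list-pigeonhole xs unique (≤-reflexive (sym len)) colour
            j , Cb = covered b∈
            Cy = subst (λ i → C i y) (sym (Fin-injective (proj₁ Cb) (proj₁ (proj₂ (covered y∈))) same)) (proj₂ (covered y∈))
            t , t∈ , all = remove xs b∈ unique len
        in inj₂ (b , b∈ , t , t∈ ,
          (λ (i , t⊆C) → spread (i , λ {x} x∈ → case x ≟ b of λ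
            { (yes refl) → subst (λ i → C i b) (disjoint Cy (all t⊆C y∈ (b≢y ∘ sym))) Cb
            ; (no x≢b)   → all t⊆C x∈ x≢b })) ,
          touched⇒∈-span (j , Cb , λ avoids → all avoids y∈ (b≢y ∘ sym) Cy))
        where
        Fin-injective : ∀ {i j} (i<n : i < n) (j<n : j < n) → Fin.fromℕ< i<n ≡ Fin.fromℕ< j<n → i ≡ j
        Fin-injective i<n j<n eq = trans (sym (toℕ-fromℕ< i<n)) (trans (cong Fin.toℕ eq) (toℕ-fromℕ< j<n))

      dependent : ∀ xs → Unique xs → length xs ≡ suc n → Dependent xs
      dependent xs unique len with dec (∀ {x} → x ∈ˡ xs → Covered x)
      ... | yes covered = dependent-covered xs unique len covered
      ... | no  ¬covered =
        -- Keeping the largest uncovered element in the tuple makes the tuple fresh and its bound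
        -- large enough for any `b` removed, covered or not.
        let c , c∈ , c∉ , max = greatest (λ x → ¬ Covered x) xs (by-contradiction λ none → ¬covered λ {x} x∈ →
                                   by-contradiction λ x∉ → none (x , x∈ , x∉))
            b , b∈ , b∉ = outside xs (c ∷ []) unique (subst (1 <_) (sym len) (s≤s (>-nonZero⁻¹ n)))
            t , t∈ , all = remove xs b∈ unique len
            c≢b = λ c≡b → b∉ (here (sym c≡b))
            c≤top = all (≤-top t) c∈ c≢b
        in inj₂ (b , b∈ , t , t∈ , (λ (i , t⊆C) → c∉ (i , all t⊆C c∈ c≢b)) ,
          uncovered⇒∈-span (λ covered → c∉ (all covered c∈ c≢b)) (case dec (Covered b) of λ
            { (yes (j , Cb)) → ≤-trans (C≤ j Cb) (m≤m⊔n _ _)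
            ; (no  b-free)   → ≤-trans (max b∈ b-free) (≤-trans c≤top (m≤n⊔m (n * e) _)) }))

      pieces : Pieces
      pieces = record
        { J = ℕ ; point = λ j → shift j • z ; C = C
        ; closed = λ j t t∈ i → proj₁ (first-All t∈) , closed-act (shift j) {proj₁ z} F-closed t (VecAll.map proj₂ t∈) i
        ; e = n * e ; K = K ; C≤e = C≤ ; compatible = compatible ; span = span ; span≤ = span≤ ; dependent = dependent }

      open Glued pieces

      union : Point
      union = glued

      block-agree : ∀ {j} → j < n → Agree F K (proj₁ z) (act (inv (shift j)) (proj₁ union))
      block-agree {j} j<n = agree-act (shift j) (agree-mono (λ Fa → j<n , Fa) ≤-refl (agree-piece j))

      others-closed : ∀ i → Closed (proj₁ union) (λ a → ∃ λ j → j ≢ i × C j a)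
      others-closed i t t∈ m with dec (∃ λ j → All (C j) t)
      ... | yes (j , t⊆C) =
        let k , k≢i , Ck = first-All t∈
        in j , (λ j≡i → k≢i (trans (disjoint Ck (first-All t⊆C)) j≡i)) , Pieces.closed pieces j t t⊆C m
      ... | no fresh with nth-∈ (span t) {first t} m
      ...   | inj₂ eq = subst (λ a → ∃ λ j → j ≢ i × C j a) (sym eq) (first-All t∈)
      ...   | inj₁ a∈ =
        let j , Cj , meets = ∈-span⇒touched {t} (VecAll.map (λ (j , _ , Cj) → j , Cj) t∈) a∈
        in j , (λ j≡i → meets (VecAll.map (λ (k , k≢i , Ck) Cj′ → k≢i (trans (disjoint Ck Cj′) j≡i)) t∈)) , Cj

    module Double (1<n : 1 < n) (w : Point) (D H : Pred ℕ 0ℓ) (D-closed : Closed (proj₁ w) D) (H-closed : Closed (proj₁ w) H)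
      (H⊆D : H ⊆ D) (e K : ℕ) (D<e : ∀ {a} → D a → a < e) where
      private
        Q : Pred ℕ 0ℓ
        Q a = D a × ¬ H a

      move : Word
      move = exchange Q e e

      move-fixes : ∀ {a} → H a → fwd move a ≡ a
      move-fixes Ha = exchange-fixed Q e e (λ (_ , _ , ¬Ha) → ¬Ha Ha) λ {b} _ _ eq →
        <⇒≱ (D<e (H⊆D Ha)) (subst (e ≤_) (sym eq) (m≤n+m e b))

      move-fixes′ : ∀ {a} → H a → bwd move a ≡ a
      move-fixes′ Ha = trans (cong (bwd move) (sym (move-fixes Ha))) (bwd-fwd move _)

      move-moves : ∀ {a} → D a → ¬ H a → fwd move a ≡ a + e
      move-moves Da ¬Ha = exchange-up Q e e ≤-refl (D<e Da) (Da , ¬Ha)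

      -- Elements of `D` outside `H` are moved to `e` or beyond, where `D` has none; so the two
      -- copies overlap in `H` only.
      shared : ∀ {a} → D a → D (bwd move a) → H a
      shared {a} Da Da′ = by-contradiction λ ¬Ha →
        let back = trans (cong (bwd move) (sym (exchange-down Q e e ≤-refl (D<e Da) (Da , ¬Ha)))) (bwd-fwd move (a + e))
        in <⇒≱ (D<e (subst D back Da′)) (m≤n+m e a)

      C : Bool → Pred ℕ 0ℓ
      C true  = D
      C false = D ∘ bwd move

      point : Bool → Point
      point true  = w
      point false = move • w

      C≤ : ∀ ι {a} → C ι a → a ≤ e + e
      C≤ true  Da = ≤-trans (<⇒≤ (D<e Da)) (m≤m+n e e)
      C≤ false {a} Da with dec (H (bwd move a))
      ... | yes Ha = subst (_≤ e + e) (trans (sym (move-fixes Ha)) (fwd-bwd move a)) (C≤ true Da)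
      ... | no ¬Ha = subst (_≤ e + e) (trans (sym (move-moves Da ¬Ha)) (fwd-bwd move a)) (+-monoˡ-≤ e (<⇒≤ (D<e Da)))

      map-fixed : ∀ {m} {t : Vec ℕ m} → All H t → Vec.map (bwd move) t ≡ t
      map-fixed []         = refl
      map-fixed (Ha ∷ t∈) = cong₂ _∷_ (move-fixes′ Ha) (map-fixed t∈)

      cross : Agree (λ a → D a × D (bwd move a)) K (proj₁ w) (proj₁ (move • w))
      cross = agree
        (λ {t} t∈ i → let t∈H = VecAll.map (λ (Da , Da′) → shared Da Da′) t∈ in
          trans (sym (move-fixes (H-closed t t∈H i))) (cong (fwd move ∘ op (proj₁ w) i) (sym (map-fixed t∈H))))
        (λ t∈ j → cong (ranked (proj₁ w) j) (sym (map-fixed (VecAll.map (λ (Da , Da′) → shared Da Da′) t∈))))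
        (λ (Da , Da′) i _ → cong (bit (proj₁ w) i) (sym (move-fixes′ (shared Da Da′))))

      compatible : ∀ ι κ → Agree (λ a → C ι a × C κ a) K (proj₁ (point ι)) (proj₁ (point κ))
      compatible true  true  = agree (λ _ _ → refl) (λ _ _ → refl) (λ _ _ _ → refl)
      compatible false false = agree (λ _ _ → refl) (λ _ _ → refl) (λ _ _ _ → refl)
      compatible true  false = cross
      compatible false true  = agree-mono (λ (a , b) → b , a) ≤-refl (agree-sym cross)

      span : Vec ℕ n → List ℕ
      span t = upTo (suc (e + e ⊔ top t))

      -- A set of at least three elements outside both pieces remains outside both after a suitable element is removed.
      dependent : ∀ xs → Unique xs → length xs ≡ suc n → (∃ λ ι → ∀ {x} → x ∈ˡ xs → C ι x) ⊎
        (∃ λ b → b ∈ˡ xs × ∃ λ t → All (λ x → x ∈ˡ xs × x ≢ b) t × ¬ (∃ λ ι → All (C ι) t) × b ∈ˡ span t)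
      dependent xs unique len
        with dec (∀ {x} → x ∈ˡ xs → D x) | dec (∀ {x} → x ∈ˡ xs → D (bwd move x)) | dec (∃ λ x → x ∈ˡ xs × e + e < x)
      ... | yes inside | _          | _ = inj₁ (true , inside)
      ... | no _       | yes inside | _ = inj₁ (false , inside)
      ... | no _       | no _       | yes large =
        let c , c∈ , c> , max = greatest (e + e <_) xs large
            b , b∈ , b∉ = outside xs (c ∷ []) unique (subst (1 <_) (sym len) (m<n⇒m<1+n 1<n))
            t , t∈ , all = remove xs b∈ unique len
            c≢b = λ c≡b → b∉ (here (sym c≡b))
        in inj₂ (b , b∈ , t , t∈ , (λ (ι , t⊆C) → <⇒≱ c> (C≤ ι (all t⊆C c∈ c≢b))) ,
          ∈-upTo⁺ (s≤s (case b ≤? e + e of λ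
            { (yes b≤) → ≤-trans b≤ (m≤m⊔n _ _)
            ; (no b≰)  → ≤-trans (max b∈ (≰⇒> b≰)) (≤-trans (all (≤-top t) c∈ c≢b) (m≤n⊔m (e + e) _)) })))
      ... | no ¬D      | no ¬D′     | no small =
        let c , c∈ , c∉ = exception ¬D ; d , d∈ , d∉ = exception ¬D′
            b , b∈ , b∉ = outside xs (c ∷ d ∷ []) unique (subst (2 <_) (sym len) (s≤s 1<n))
            t , t∈ , all = remove xs b∈ unique len
        in inj₂ (b , b∈ , t , t∈ ,
          (λ { (true  , t⊆C) → c∉ (all t⊆C c∈ λ c≡b → b∉ (here (sym c≡b)))
             ; (false , t⊆C) → d∉ (all t⊆C d∈ λ d≡b → b∉ (there (here (sym d≡b)))) }) ,
          ∈-upTo⁺ (s≤s (≤-trans (≮⇒≥ λ b> → small (b , b∈ , b>)) (m≤m⊔n _ _))))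
        where
        exception : ∀ {Q : Pred ℕ 0ℓ} → ¬ (∀ {x} → x ∈ˡ xs → Q x) → ∃ λ c → c ∈ˡ xs × ¬ Q c
        exception ¬all = by-contradiction λ none → ¬all λ {x} x∈ → by-contradiction λ ¬q → none (x , x∈ , ¬q)

      pieces : Pieces
      pieces = record
        { J = Bool ; point = point ; C = C
        ; closed = λ { true → D-closed ; false → closed-act move {proj₁ w} D-closed }
        ; e = e + e ; K = K ; C≤e = C≤ ; compatible = compatible ; span = span
        ; span≤ = λ t a∈ → ≤-pred (∈-upTo⁻ a∈) ; dependent = dependent }

      open Glued pieces

      amalgam : Point
      amalgam = glued

      first-copy : Agree D K (proj₁ w) (proj₁ amalgam)
      first-copy = agree-piece true

      second-copy : Agree D K (proj₁ w) (act (inv move) (proj₁ amalgam))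
      second-copy = agree-act move (agree-piece false)

  -- The dimension argument

  module Fixing (n : ℕ) .{{_ : NonZero n}} where
    open Action n
    open _≅_

    family-dependent : ∀ (M : Point) (f : Fin (suc n) → ℕ) → (∀ {i j} → f i ≡ f j → i ≡ j) →
      ∃ λ i → Generated (reduct (proj₁ M)) (λ x → ∃ λ j → j ≢ i × x ≡ f j) (f i)
    family-dependent M f injective =
      let b , b∈ , gen = B3 M (List.tabulate f) (Unique.tabulate⁺ injective) (length-tabulate f)
          i , b≡ = ∈-tabulate⁻ {f = f} b∈
      in i , subst (Generated (reduct (proj₁ M)) _) b≡ (generated-mono {M = reduct (proj₁ M)}
        (λ {x} (x∈ , x≢b) → let j , x≡ = ∈-tabulate⁻ {f = f} x∈ in j , (λ j≡i → x≢b (trans x≡ (trans (cong f j≡i) (sym b≡)))) , x≡) gen)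

    -- Otherwise every row has an element not generated by the other rows. Such elements differ from
    -- row to row, and `suc n` of them contradict B3.
    rows-dependent : ∀ (M : Point) {N} → n < N → (κ : Fin N → ℕ → ℕ) (G : List ℕ) → ∃ λ i → ∀ {c} → c ∈ˡ G →
      Generated (reduct (proj₁ M)) (λ x → ∃ λ j → j ≢ i × ∃ λ c → c ∈ˡ G × x ≡ κ j c) (κ i c)
    rows-dependent M {N} n<N κ G = by-contradiction λ none → absurd λ i → by-contradiction λ none′ →
      none (i , λ {c} c∈ → by-contradiction λ ¬gen → none′ (c , c∈ , ¬gen))
      where
      Others : Fin N → Pred ℕ 0ℓ
      Others i x = ∃ λ j → j ≢ i × ∃ λ c → c ∈ˡ G × x ≡ κ j c
      absurd : ¬ (∀ i → ∃ λ c → c ∈ˡ G × ¬ Generated (reduct (proj₁ M)) (Others i) (κ i c))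
      absurd pick =
        let chosen = λ i → κ i (proj₁ (pick i))
            ι = λ (i : Fin (suc n)) → inject≤ i n<N
            injective = λ {i j} (eq : chosen (ι i) ≡ chosen (ι j)) → by-contradiction {A = i ≡ j} λ i≢j →
              proj₂ (proj₂ (pick (ι i))) (base (ι j , (λ eq′ → i≢j (sym (inject≤-injective n<N n<N j i eq′))) ,
                proj₁ (pick (ι j)) , proj₁ (proj₂ (pick (ι j))) , eq))
            i , gen = family-dependent M (λ i → chosen (ι i)) injective
        in proj₂ (proj₂ (pick (ι i))) (generated-mono {M = reduct (proj₁ M)}
          (λ (j , j≢i , x≡) → ι j , (λ eq → j≢i (inject≤-injective n<N n<N j i eq)) , proj₁ (pick (ι j)) ,
            proj₁ (proj₂ (pick (ι j))) , x≡) gen)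

    Fixes : Pred ℕ 0ℓ → ℕ → List Cond → Set
    Fixes S b is = ∀ {M M′ : Point} → M ∈ Basic is → M′ ∈ Basic is → (τ : proj₁ M ≅ proj₁ M′) →
      (∀ {a} → a ∈ S → to τ a ≡ a) → to τ b ≡ b

    -- The conditions record the finitely many function values met in a term for `b`; where they
    -- hold on both sides, an isomorphism fixing `S` fixes each of these values in turn.
    generated-fixed : ∀ (M : Point) {S b} → Generated (reduct (proj₁ M)) S b → ∃ λ is → M ∈ Basic is × Fixes S b is
    generated-fixed M {S} = go
      where
      go : ∀ {b} → Generated (reduct (proj₁ M)) S b → ∃ λ is → M ∈ Basic is × Fixes S b is
      gos : ∀ {m} {t : Vec ℕ m} → All (Generated (reduct (proj₁ M)) S) t →
        ∃ λ is → M ∈ Basic is × (∀ {M′ M″ : Point} → M′ ∈ Basic is → M″ ∈ Basic is → (τ : proj₁ M′ ≅ proj₁ M″) →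
          (∀ {a} → a ∈ S → to τ a ≡ a) → Vec.map (to τ) t ≡ t)
      go (base b∈S) = [] , [] , λ _ _ τ fixes → fixes b∈S
      go (app (s i) {t} gs) =
        let is , M∈ , fixed = gos gs
        in value (s i) t (op (proj₁ M) i t) ∷ is , refl ∷ M∈ , λ { {M′} {M″} (v′ ∷ M′∈) (v″ ∷ M″∈) τ fixes →
          trans (cong (to τ) (sym v′)) (trans (fun-hom τ (s i) t)
            (trans (cong (op (proj₁ M″) i) (fixed {M′} {M″} M′∈ M″∈ τ fixes)) v″)) }
      gos [] = [] , [] , λ _ _ _ _ → refl
      gos (g ∷ gs) =
        let is , M∈ , fixed = go g ; js , M∈′ , fixeds = gos gs
        in is ++ js , ++⁺ M∈ M∈′ , λ {M′} {M″} M′∈ M″∈ τ fixes →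
          cong₂ _∷_ (fixed {M′} {M″} (++⁻ˡ is M′∈) (++⁻ˡ is M″∈) τ fixes)
                    (fixeds {M′} {M″} (++⁻ʳ is M′∈) (++⁻ʳ is M″∈) τ fixes)

    -- Total in `c`, with the empty condition outside `G`, so that the conditions depend on `c` and
    -- not on a proof of membership.
    row-fixed : ∀ (M : Point) {S} (κ : ℕ → ℕ) (G : List ℕ) → (∀ {c} → c ∈ˡ G → Generated (reduct (proj₁ M)) S (κ c)) →
      ∀ c → ∃ λ is → M ∈ Basic is × (c ∈ˡ G → Fixes S (κ c) is)
    row-fixed M κ G gen c with dec (c ∈ˡ G)
    ... | no  c∉ = [] , [] , λ c∈ → contradiction c∈ c∉
    ... | yes c∈ =
      let is , M∈ , fixes = generated-fixed M (gen c∈)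
      in is , M∈ , λ _ {M′} {M″} → fixes {M′} {M″}

  -- Making equality of types locally constant

  module Stability (N : ℕ) .{{_ : NonZero N}} (n : ℕ) .{{_ : NonZero n}} where
    private
      module L = Action N
      module S = Action n
    open L using (Family; Basic; Interior; _•_)
    open Family
    open Invariance N

    id-invariant : ∀ 𝒢 p₀ → Invariant 𝒢 p₀ N id
    id-invariant 𝒢 p₀ = record
      { continuous = λ {z} _ c z∈ → L.interior-⊆ z (λ w∈ _ → w∈) (L.interior-self z c z∈)
      ; lifts      = λ _ _ → id
      -- A predicate of `h • w` at `b′` is that of `w` at `bwd h b′`. Sameness at one point thus
      -- means `b ≡ bwd h b′`, which no longer mentions the point.
      ; stable     = λ {z} h {b} {b′} _ _ same → [] , [] , λ {w} _ _ _ i → cong (L.bit (proj₁ w) i) (L.same-≡ z same)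
      }

    module _ (𝒟 : Family) (p₀ : List L.Cond) (v : L.Point → S.Point)
      (continuous : ∀ {z} → Good 𝒟 p₀ z → ∀ c → proj₁ (v z) ∈ ⟦ c ⟧ → Interior (λ w → Good 𝒟 p₀ w → proj₁ (v w) ∈ ⟦ c ⟧) z)
      where
      private
        Agreement : Word → ℕ → ℕ → Pred L.Point 0ℓ
        Agreement g b b′ w = Good 𝒟 p₀ w → Good 𝒟 p₀ (g • w) → S.Same (v w) b (v (g • w)) b′

        Disagreement : Word → ℕ → ℕ → Pred L.Point 0ℓ
        Disagreement g b b′ w = Good 𝒟 p₀ w → Good 𝒟 p₀ (g • w) → ¬ S.Same (v w) b (v (g • w)) b′

        bit-continuous : ∀ {z} → Good 𝒟 p₀ z → ∀ i b → Interior (λ w → Good 𝒟 p₀ w →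
          S.bit (proj₁ (v z)) i b ≡ S.bit (proj₁ (v w)) i b) z
        bit-continuous {z} good i b =
          let is , vz∈ , is⊆ = S.bit-interior (v z) i b
          in L.interior-⊆ z (λ {w} f w-good → is⊆ {v w} (ListAll.tabulate λ c∈ → f c∈ w-good))
               (L.interior-all z is λ c∈ → continuous good _ (ListAll.lookup vz∈ c∈))

      -- A disagreement shows in one predicate and persists nearby by continuity; a basic set
      -- without disagreement has agreement throughout. So one of the two holds near each point of a
      -- dense open set.
      decisions : Family
      decisions = record
        { I         = Word × ℕ × ℕ
        ; countable = ×-countable Word-countable (×-countable ℕ-countable ℕ-countable)
        ; D         = λ (g , b , b′) z → Interior (Agreement g b b′) z ⊎ Interior (Disagreement g b b′) z
        ; isOpen    = λ { _ (inj₁ (is , z∈is , is⊆)) → is , z∈is , λ w∈is → inj₁ (is , w∈is , is⊆)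
                        ; _ (inj₂ (is , z∈is , is⊆)) → is , z∈is , λ w∈is → inj₂ (is , w∈is , is⊆) }
        ; isDense   = dense
        }
        where
        dense : ∀ j → L.Dense λ z → Interior (Agreement (proj₁ j) (proj₁ (proj₂ j)) (proj₂ (proj₂ j))) z
                                  ⊎ Interior (Disagreement (proj₁ j) (proj₁ (proj₂ j)) (proj₂ (proj₂ j))) z
        dense (g , b , b′) is (z , z∈is)
          with dec (∃ λ w → w ∈ Basic is × Good 𝒟 p₀ w × Good 𝒟 p₀ (g • w) × ¬ S.Same (v w) b (v (g • w)) b′)
        ... | no  none = z , z∈is , inj₁ (is , z∈is , λ {w} w∈ good good′ → by-contradiction λ differ →
          none (w , w∈ , good , good′ , differ))
        ... | yes (w , w∈ , good , good′ , differ) =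
          let i , bits≢ = ¬∀⇒∃¬ differ
          in w , w∈ , inj₂ (L.interior-⊆ w
            (λ (bit₁ , bit₂) u-good gu-good same → bits≢ (trans (bit₁ u-good) (trans (same i) (sym (bit₂ gu-good)))))
            (L.interior-∩ w (bit-continuous good i b)
              (L.interior-pull {λ u → Good 𝒟 p₀ u → S.bit (proj₁ (v (g • w))) i b′ ≡ S.bit (proj₁ (v u)) i b′} g w
                (bit-continuous good′ i b′))))

      stabilised : Family
      stabilised = L.saturate (𝒟 L.⊕ decisions)

      stabilised-good : ∀ {z} → Good stabilised p₀ z → Good 𝒟 p₀ z
      stabilised-good {z} (gen , z∈) = (λ i → L.saturate-gen (𝒟 L.⊕ decisions) {z} gen (inj₁ i)) , z∈

      stable : ∀ {z} h {b b′} → Good stabilised p₀ z → Good stabilised p₀ (h • z) → S.Same (v z) b (v (h • z)) b′ →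
        Interior (λ w → Good stabilised p₀ w → Good stabilised p₀ (h • w) → S.Same (v w) b (v (h • w)) b′) z
      stable {z} h {b} {b′} good good′ same with L.saturate-gen (𝒟 L.⊕ decisions) {z} (proj₁ good) (inj₂ (h , b , b′))
      ... | inj₁ interior = L.interior-⊆ z (λ {w} f w-good hw-good →
        f (stabilised-good {w} w-good) (stabilised-good {h • w} hw-good)) interior
      ... | inj₂ (is , z∈is , is⊆) = contradiction same (is⊆ {z} z∈is (stabilised-good {z} good)
        (stabilised-good {h • z} good′))

      v-invariant : (∀ {z w} → Good 𝒟 p₀ z → Good 𝒟 p₀ w → proj₁ z ≅ proj₁ w → proj₁ (v z) ≅ proj₁ (v w)) →
        Invariant stabilised p₀ n v
      v-invariant lifts = record
        { continuous = λ {z} good c vz∈ → L.interior-⊆ z (λ {w} f w-good → f (stabilised-good {w} w-good))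
            (continuous (stabilised-good {z} good) c vz∈)
        ; lifts      = λ {z} {w} good good′ → lifts (stabilised-good {z} good) (stabilised-good {w} good′)
        ; stable     = λ {z} → stable {z}
        }

  -- The contradiction in the larger dimension

  module Core (N : ℕ) .{{_ : NonZero N}} (n : ℕ) .{{_ : NonZero n}} (n<N : n < N) where
    private
      module L = Action N
      module S = Action n
      module C = L.Complete L.complete
    open L using (Family; Basic; Interior; _•_; Agree)
    open Family
    open Invariance N
    open _≅_

    1<N : 1 < N
    1<N = ≤-trans (s≤s (>-nonZero⁻¹ n)) n<N

    module Impossible (𝒢 : Family) (p₀ : List L.Cond) (p₀≠∅ : L.Nonempty p₀) (𝒢-invariant : ∀ g {z} → Gen 𝒢 z →
      Gen 𝒢 (g • z))
      (v : L.Point → S.Point) (id-inv : Invariant 𝒢 p₀ N id) (v-inv : Invariant 𝒢 p₀ n v)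
      (reflects : ∀ {z w} → Good 𝒢 p₀ z → Good 𝒢 p₀ w → proj₁ (v z) ≅ proj₁ (v w) → proj₁ z ≅ proj₁ w) where
      private
        module V = Invariant v-inv
        module ByV = Determination 𝒢 p₀ 𝒢-invariant v-inv id-inv reflects
        module ById = Determination 𝒢 p₀ 𝒢-invariant id-inv v-inv (λ {z} {w} _ _ τ → τ)

      -- Being determined passes to stronger conditions and larger finite sets, so the elements of
      -- `G` can be treated one at a time.
      determine-all : ∀ G q → Basic q ⊆ Basic p₀ → L.Nonempty q →
        ∃ λ p → Basic p ⊆ Basic q × L.Nonempty p × ∃ λ F → ∀ {c} → c ∈ˡ G → ById.Determined p F c
      determine-all [] q q⊆ q≠∅ = q , id , q≠∅ , [] , λ ()
      determine-all (c ∷ G) q q⊆ q≠∅ =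
        let js , p≠∅ , F , det = ById.determine q (λ {z} → q⊆ {z}) q≠∅ c
            p′ , p′⊆ , p′≠∅ , F′ , dets = determine-all G (q ++ js) (λ {z} z∈ → q⊆ {z} (++⁻ˡ q z∈)) p≠∅
        in p′ , (λ {z} z∈ → ++⁻ˡ q (p′⊆ {z} z∈)) , p′≠∅ , F ++ F′ , λ
          { (here refl) w w′ h gen gen′ w′≈hw w∈ w′∈ agree →
              det w w′ h gen gen′ w′≈hw (p′⊆ {w} w∈) (p′⊆ {w′} w′∈) (λ b∈ → agree (∈-++⁺ˡ b∈))
          ; (there c∈)  w w′ h gen gen′ w′≈hw w∈ w′∈ agree →
              dets c∈ w w′ h gen gen′ w′≈hw w∈ w′∈ (λ b∈ → agree (∈-++⁺ʳ F b∈)) }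

      module Conclude (pᴬ : List L.Cond) (pᴬ⊆ : Basic pᴬ ⊆ Basic p₀) (G : List ℕ) (detᴬ : ByV.Determined pᴬ G 0)
        (p : List L.Cond) (p⊆ : Basic p ⊆ Basic pᴬ) (F : List ℕ) (det : ∀ {c} → c ∈ˡ G → ById.Determined p F c)
        (z : L.Point) (z∈p : z ∈ Basic p) where

        k : ℕ
        -- The hull then contains `F` and all arguments in `p`, so that a copy of it, moved back
        -- into place, forces `p`.
        k = L.sizes p ⊔ maximum F

        E : Pred ℕ 0ℓ
        E a = a ∈ˡ L.hull z k

        e : ℕ
        e = suc (maximum (L.hull z k))

        open Blocks.Disjoint N z E (L.hull-closed z k) e k (λ a∈ → s≤s (≤-maximum a∈))
          using (shift; C; C≤; disjoint; union; block-agree; others-closed)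

        block-in-p : ∀ {u : L.Point} → Agree E k (proj₁ z) (proj₁ u) → u ∈ Basic p
        block-in-p {u} z~u = L.agree-basic {z = z} {w = u} p z~u
          (λ a≤ → L.≤⇒∈-hull z k (≤-trans a≤ (m≤m⊔n _ _))) (m≤m⊔n _ _) z∈p

        Others : ℕ → Pred ℕ 0ℓ
        Others i a = ∃ λ j → j ≢ i × C j a

        -- `p` speaks about particular numbers; moving block `j` back to the place of `E` makes it
        -- speak about that block.
        γ : Fin N → Word
        γ j = inv (shift (toℕ j))

        Frame : Pred L.Point 0ℓ
        Frame w = Agree (_∈ˡ L.hull union (N * e)) (N * e) (proj₁ union) (proj₁ w)
          × (∀ {j} → j ∈ˡ allFin N → (γ j • w) ∈ Basic p)

        abstract
          frame : Interior Frame union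
          frame = L.interior-∩ union (L.agree-interior (L.hull union (N * e)) (N * e) union)
            (L.interior-all union (allFin N) λ {j} _ → L.interior-pull (γ j) union
              (L.interior-basic (γ j • union) p (block-in-p {γ j • union} (block-agree (toℕ<n j)))))

        module _ {w : L.Point} (w∈frame : Frame w) where
          block-∈p : ∀ j → (γ j • w) ∈ Basic p
          block-∈p j = proj₂ w∈frame (∈-allFin j)

          others-closed′ : ∀ i → L.Closed (proj₁ w) (Others i)
          others-closed′ i t t∈ m = subst (Others i)
            (L.ops (proj₁ w∈frame) (VecAll.map (λ (j , _ , Cj) → L.≤⇒∈-hull union (N * e) (C≤ j Cj)) t∈) m)
            (others-closed i t t∈ m)

          -- Block 0 stands in its original place, so the view from it is `w` itself.
          ∈p₀ : w ∈ Basic p₀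
          ∈p₀ = pᴬ⊆ {w} (p⊆ {w} (L.basic-resp p {γ zeroth • w} {w} γ₀w≈w (block-∈p zeroth)))
            where
            zeroth : Fin N
            zeroth = Fin.fromℕ< (<-trans z<s 1<N)
            γ₀w≈w : (γ zeroth • w) L.≈ w
            γ₀w≈w = act-trivial (γ zeroth) (λ a → trans (fwd-inv (shift (toℕ zeroth)) a)
                (cong (λ j → bwd (shift j) a) (toℕ-fromℕ< (<-trans z<s 1<N)))) (proj₁ w)

          frame-good : Gen 𝒢 w → Good 𝒢 p₀ w
          frame-good gen = gen , ∈p₀

          block-good : Gen 𝒢 w → ∀ j → Good 𝒢 p₀ (γ j • w)
          block-good gen j = 𝒢-invariant (γ j) gen , pᴬ⊆ {γ j • w} (p⊆ {γ j • w} (block-∈p j))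

        module _ (w : L.Point) (w-gen : Gen 𝒢 w) (w∈frame : Frame w) where
          private
            w-good = frame-good {w} w∈frame w-gen

          σ : ∀ j → proj₁ (v w) ≅ proj₁ (v (γ j • w))
          σ j = V.lifts w-good (block-good {w} w∈frame w-gen j) (act-iso (γ j) (proj₁ w))

          -- The element of `v w` that appears as `c` in the view from block `j`. For `c` in `G`
          -- these form the finite set attached to the block.
          κ : Fin N → ℕ → ℕ
          κ j c = Inverse.from (bijection (σ j)) c

          κ-same : ∀ j c → S.Same (v w) (κ j c) (v (γ j • w)) c
          κ-same j c i = trans (S.iso-same (v w) (v (γ j • w)) (σ j) (κ j c) i)
            (cong (S.bit (proj₁ (v (γ j • w))) i) (Inverse.strictlyInverseˡ (bijection (σ j)) c))

          FromOthers : Fin N → Pred ℕ 0ℓ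
          FromOthers i x = ∃ λ j → j ≢ i × ∃ λ c → c ∈ˡ G × x ≡ κ j c

          abstract
            dependence : ∃ λ i → ∀ {c} → c ∈ˡ G → Generated (reduct (proj₁ (v w))) (FromOthers i) (κ i c)
            dependence = Fixing.rows-dependent n (v w) n<N κ G

        module Final (w : L.Point) (w-gen : Gen 𝒢 w) (w∈ : w ∈ Basic (proj₁ frame)) where
          w∈frame : Frame w
          w∈frame = proj₂ (proj₂ frame) {w} w∈

          w-good : Good 𝒢 p₀ w
          w-good = frame-good {w} w∈frame w-gen

          i : Fin N
          i = proj₁ (dependence w w-gen w∈frame)

          κ′ : Fin N → ℕ → ℕ
          κ′ = κ w w-gen w∈frame

          S′ : Pred ℕ 0ℓ
          S′ = FromOthers w w-gen w∈frame i

          abstract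
            fixing : ∀ c → ∃ λ is → v w ∈ S.Basic is × (c ∈ˡ G → Fixing.Fixes n S′ (κ′ i c) is)
            fixing = Fixing.row-fixed n (v w) (κ′ i) G (proj₂ (dependence w w-gen w∈frame))

          -- Everything that both twins must inherit from `w`: the frame, the identity of the
          -- elements `κ′ j c`, and the terms generating row `i` from the other rows.
          Stable : Pred L.Point 0ℓ
          Stable u = u ∈ Basic (proj₁ frame)
            × (∀ {j} → j ∈ˡ allFin N → ∀ {c} → c ∈ˡ G → Good 𝒢 p₀ u → Good 𝒢 p₀ (γ j • u) →
              S.Same (v u) (κ′ j c) (v (γ j • u)) c)
            × (∀ {c} → c ∈ˡ G → Good 𝒢 p₀ u → v u ∈ S.Basic (proj₁ (fixing c)))

          abstract
            stable : Interior Stable w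
            stable = L.interior-∩ w (L.interior-basic w (proj₁ frame) w∈)
              (L.interior-∩ w
                (L.interior-all w (allFin N) λ {j} _ → L.interior-all w G λ {c} _ →
                  V.stable (γ j) w-good (block-good {w} w∈frame w-gen j) (κ-same w w-gen w∈frame j c))
                (L.interior-all w G λ {c} _ → V.continuous-basic w-good (proj₁ (fixing c)) (proj₁ (proj₂ (fixing c)))))

          r : List L.Cond
          r = proj₁ stable

          l : ℕ
          -- `D′` has to contain the arguments in `r`, so that each copy of it forces `r`, and all
          -- the blocks.
          l = L.sizes r ⊔ N * e

          D′ : Pred ℕ 0ℓ
          D′ a = a ∈ˡ L.hull w l

          others⊆D′ : Others (toℕ i) ⊆ D′
          others⊆D′ (j , _ , Cj) = L.≤⇒∈-hull w l (≤-trans (C≤ j Cj) (m≤n⊔m (L.sizes r) _))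

          open Blocks.Double N 1<N w D′ (Others (toℕ i)) (L.hull-closed w l) (others-closed′ {w} w∈frame (toℕ i)) others⊆D′
            (suc (maximum (L.hull w l))) l (λ a∈ → s≤s (≤-maximum a∈))
            using (move; move-fixes; move-moves; amalgam; first-copy; second-copy)

          -- Carries the second copy to the place of the first, so that `amalgam` and `h • amalgam`
          -- both look like `w` on `D′`.
          h : Word
          h = inv move

          in-r : ∀ {u : L.Point} → Agree D′ l (proj₁ w) (proj₁ u) → u ∈ Basic r
          in-r {u} w~u = L.agree-basic {z = w} {w = u} r w~u (λ a≤ → L.≤⇒∈-hull w l (≤-trans a≤ (m≤m⊔n _ _))) (m≤m⊔n _ _)
            (proj₁ (proj₂ stable))

          abstract
            twin : Interior (λ u → u ∈ Basic r × (h • u) ∈ Basic r) amalgam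
            twin = L.interior-∩ amalgam (L.interior-basic amalgam r (in-r {amalgam} first-copy))
              (L.interior-pull h amalgam (L.interior-basic (h • amalgam) r (in-r {h • amalgam} second-copy)))

          module Twins (u : L.Point) (u-gen : Gen 𝒢 u) (u∈ : u ∈ Basic (proj₁ twin)) where
            u-stable : Stable u
            u-stable = proj₂ (proj₂ stable) {u} (proj₁ (proj₂ (proj₂ twin) {u} u∈))

            u′ : L.Point
            u′ = h • u

            u′-stable : Stable u′
            u′-stable = proj₂ (proj₂ stable) {u′} (proj₂ (proj₂ (proj₂ twin) {u} u∈))

            u′-gen : Gen 𝒢 u′
            u′-gen = 𝒢-invariant h u-gen

            u-frame : Frame u
            u-frame = proj₂ (proj₂ frame) {u} (proj₁ u-stable)

            u′-frame : Frame u′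
            u′-frame = proj₂ (proj₂ frame) {u′} (proj₁ u′-stable)

            u-good = frame-good {u} u-frame u-gen
            u′-good = frame-good {u′} u′-frame u′-gen

            block-same : ∀ j {c} → c ∈ˡ G → S.Same (v u) (κ′ j c) (v (γ j • u)) c
            block-same j c∈ = proj₁ (proj₂ u-stable) (∈-allFin j) c∈ u-good (block-good {u} u-frame u-gen j)

            block-same′ : ∀ j {c} → c ∈ˡ G → S.Same (v u′) (κ′ j c) (v (γ j • u′)) c
            block-same′ j c∈ = proj₁ (proj₂ u′-stable) (∈-allFin j) c∈ u′-good (block-good {u′} u′-frame u′-gen j)

            linked : ∀ j → (γ j • u′) L.≈ ((γ j ++ (h ++ inv (γ j))) • γ j • u)
            linked j = L.conjugate (γ j) h u

            -- In block `j` the elements of `F` belong to the common part of the amalgam, which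
            -- `move` leaves in place.
            others-fixed : ∀ {j} → j ≢ i → ∀ {b} → b ∈ˡ F → L.Same (γ j • u) b (γ j • u′) b
            others-fixed {j} j≢i {b} b∈ m = cong (L.bit (proj₁ u) m) (sym (trans (bwd-inv move _) (move-fixes
              (toℕ j , (λ eq → j≢i (toℕ-injective eq)) , toℕ<n j ,
               subst E (sym (trans (cong (bwd (shift (toℕ j))) (bwd-inv (shift (toℕ j)) b)) (bwd-fwd (shift (toℕ j)) b)))
                 (L.≤⇒∈-hull z k (≤-trans (≤-maximum b∈) (m≤n⊔m (L.sizes p) _)))))))

            others-same : ∀ {j} → j ≢ i → ∀ {c} → c ∈ˡ G → S.Same (v u) (κ′ j c) (v u′) (κ′ j c)
            others-same {j} j≢i c∈ m = trans (block-same j c∈ m) (trans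
              (det c∈ (γ j • u) (γ j • u′) (γ j ++ (h ++ inv (γ j))) (𝒢-invariant (γ j) u-gen)
                (𝒢-invariant (γ j) u′-gen) (linked j)
                (block-∈p {u} u-frame j) (block-∈p {u′} u′-frame j) (others-fixed j≢i) m)
              (sym (block-same′ j c∈ m)))

            τ : proj₁ (v u) ≅ proj₁ (v u′)
            τ = V.lifts u-good u′-good (act-iso h (proj₁ u))

            fixes : ∀ {a} → a ∈ S′ → to τ a ≡ a
            fixes (j , j≢i , c , c∈ , refl) = S.same-iso (v u) (v u′) τ (others-same j≢i c∈)

            -- `τ` fixes the other rows, and these generate row `i` by terms evaluated alike in
            -- `v u` and `v u′`.
            own-fixed : ∀ {c} → c ∈ˡ G → to τ (κ′ i c) ≡ κ′ i c
            own-fixed {c} c∈ = proj₂ (proj₂ (fixing c)) c∈ {v u} {v u′}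
              (proj₂ (proj₂ u-stable) c∈ u-good) (proj₂ (proj₂ u′-stable) c∈ u′-good) τ fixes

            own-same : ∀ {c} → c ∈ˡ G → S.Same (v (γ i • u)) c (v (γ i • u′)) c
            own-same {c} c∈ m = trans (sym (block-same i c∈ m)) (trans
              (trans (S.iso-same (v u) (v u′) τ (κ′ i c) m) (cong (S.bit (proj₁ (v u′)) m) (own-fixed c∈)))
              (block-same′ i c∈ m))

            -- The element that appears as 0 in the view from block `i`. Every hull contains 0, so
            -- `a` lies in block `i` and hence outside the common part.
            a : ℕ
            a = bwd (γ i) 0

            Ca : C (toℕ i) a
            Ca = toℕ<n i , subst E (sym (trans (cong (bwd (shift (toℕ i))) (bwd-inv (shift (toℕ i)) 0))
              (bwd-fwd (shift (toℕ i)) 0)))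
              (L.≤⇒∈-hull z k z≤n)

            a-fixed : a ≡ bwd h a
            a-fixed = L.same-≡ u (detᴬ (γ i • u) (γ i • u′) (γ i ++ (h ++ inv (γ i)))
              (𝒢-invariant (γ i) u-gen) (𝒢-invariant (γ i) u′-gen) (linked i)
              (p⊆ {γ i • u} (block-∈p {u} u-frame i)) (p⊆ {γ i • u′} (block-∈p {u′} u′-frame i)) own-same)

            a-moved : bwd h a ≡ a + suc (maximum (L.hull w l))
            a-moved = trans (bwd-inv move a) (move-moves (L.≤⇒∈-hull w l (≤-trans (C≤ (toℕ i) Ca) (m≤n⊔m (L.sizes r) _)))
              λ (j , j≢i , Cj) → j≢i (disjoint Cj Ca))

            contradictory : ⊥
            contradictory = m≢1+m+n a (trans (trans a-fixed a-moved) (+-suc a _))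

          twins-contradictory : ⊥
          twins-contradictory =
            let u , u∈ , u-gen = C.baire 𝒢 (proj₁ twin) (amalgam , proj₁ (proj₂ twin))
            in Twins.contradictory u u-gen u∈

        contradictory : ⊥
        contradictory =
          let w , w∈ , w-gen = C.baire 𝒢 (proj₁ frame) (union , proj₁ (proj₂ frame))
          in Final.twins-contradictory w w-gen w∈

      impossible : ⊥
      impossible =
        let jsᴬ , pᴬ≠∅ , G , detᴬ = ByV.determine p₀ id p₀≠∅ 0
            p , p⊆ , (z , z∈p) , F , det = determine-all G (p₀ ++ jsᴬ) (++⁻ˡ p₀) pᴬ≠∅
        in Conclude.contradictory (p₀ ++ jsᴬ) (++⁻ˡ p₀) G detᴬ p (λ {z} → p⊆ {z}) F det z z∈p

    open Stability N n

    -- Relative to a basic set `p₀`, because the right inverse serving the case `m < n` has its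
    -- properties only inside one.
    no-continuous-reduction : (𝒟 : Family) (p₀ : List L.Cond) → L.Nonempty p₀ → (v : L.Point → S.Point) →
      (∀ {z} → Good 𝒟 p₀ z → ∀ c → proj₁ (v z) ∈ ⟦ c ⟧ → Interior (λ w → Good 𝒟 p₀ w → proj₁ (v w) ∈ ⟦ c ⟧) z) →
      (∀ {z w} → Good 𝒟 p₀ z → Good 𝒟 p₀ w → proj₁ z ≅ proj₁ w → proj₁ (v z) ≅ proj₁ (v w)) →
      (∀ {z w} → Good 𝒟 p₀ z → Good 𝒟 p₀ w → proj₁ (v z) ≅ proj₁ (v w) → proj₁ z ≅ proj₁ w) → ⊥
    no-continuous-reduction 𝒟 p₀ p₀≠∅ v continuous lifts reflects =
      let 𝒢 = stabilised 𝒟 p₀ v continuous in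
      Impossible.impossible 𝒢 p₀ p₀≠∅ (L.saturate-invariant (𝒟 L.⊕ decisions 𝒟 p₀ v continuous)) v (id-invariant 𝒢 p₀)
        (v-invariant 𝒟 p₀ v continuous λ {z} {w} → lifts {z} {w})
        λ {z} {w} good good′ → reflects (stabilised-good 𝒟 p₀ v continuous {z} good)
          (stabilised-good 𝒟 p₀ v continuous {w} good′)

  -- Continuous right inverses

  least-unique : {Q : Pred ℕ 0ℓ} → ∀ {i j} → Least Q i → Least Q j → i ≡ j
  least-unique {i = i} {j} (qi , min-i) (qj , min-j) with <-cmp i j
  ... | tri< i<j _ _ = contradiction qi (min-j i i<j)
  ... | tri≈ _ i≡j _ = i≡j
  ... | tri> _ _ j<i = contradiction qj (min-i j j<i)

  module Maps (X Y : Space) where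
    private
      module X = Category X
      module Y = Category Y
    open X.Family

    ContinuousOn : Pred X.Point 0ℓ → (X.Point → Y.Point) → Set
    ContinuousOn G f = ∀ {x} → G x → ∀ c → f x ∈ Y.Sub c → X.Interior (λ w → G w → f w ∈ Y.Sub c) x

    module _ (Y-countable : Countable Y.Index) (f : X.Point → Y.Point) (measurable : BaireMeasurable X Y f) where
      private
        bp : ∀ c → X.BaireProperty (Y.Sub c ∘ f)
        bp c = measurable (Y.Sub c) λ {y} → Y.interior-self y c

        difference : Y.Index → Pred X.Point 0ℓ
        difference c = (Y.Sub c ∘ f) X.△ proj₁ (bp c)

      -- The preimage of each subbasic set differs from an open set by a meager set. Avoiding these
      -- countably many differences makes `f` continuous.
      continuity : X.Family
      continuity = X.meager-family Y-countable difference λ c → proj₂ (proj₂ (bp c))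

      continuity-continuous : ContinuousOn (Gen continuity) f
      continuity-continuous {x} gen c fx∈ =
        let x∈U = by-contradiction {A = x ∈ proj₁ (bp c)} λ x∉U → avoids gen c (inj₁ (fx∈ , x∉U))
        in X.interior-⊆ x (λ w∈U w-gen → by-contradiction λ fw∉ → avoids w-gen c (inj₂ (w∈U , fw∉)))
             (proj₁ (proj₂ (bp c)) x∈U)
        where
        avoids : ∀ {w} → Gen continuity w → ∀ c → ¬ difference c w
        avoids = X.meager-family-avoids Y-countable difference λ c → proj₂ (proj₂ (bp c))

  -- The approximations to a preimage of y are selected with the least possible code; since basic sets are clopen,
  -- the selection is locally constant.
  module Uniformization (X Y : Space) (X-complete : Category.Complete X) (Y-complete : Category.Complete Y) where
    private
      module X = Category X
      module Y = Category Y
      module CX = X.Complete X-complete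
      module CY = Y.Complete Y-complete
    open X.Family
    open Maps X Y

    module RightInverse (x₀ : X.Point) (f : X.Point → Y.Point) (preserving : CategoryPreserving X Y f)
      (𝒟 : X.Family) (continuous : ContinuousOn (Gen 𝒟) f) where

      Image : List X.Index → Pred Y.Point 0ℓ
      Image is y = ∃ λ x → Gen 𝒟 x × x ∈ X.Basic is × f x ≡ y

      -- The invariant of the construction: the image of the current basic set remains nonmeager in
      -- every nonempty part of `q`, which leaves room for the next step near any point.
      Large : List X.Index → List Y.Index → Set
      Large is q = Small (Y.EverywhereNonmeagerIn (Image is) q)

      large-inhabited : ∀ {is q} → Large is q → Y.Nonempty q → ∃ λ x → Gen 𝒟 x × x ∈ X.Basic is × f x ∈ Y.Basic q
      large-inhabited {is} {q} is-large (y , y∈) =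
        let _ , (x , gen , x∈ , fx≡y) , y∈′ = Y.nonmeager-inhabited (large is-large [] (y , ++⁺ y∈ []))
        in x , gen , x∈ , subst (λ y → y ∈ Y.Basic q) (sym fx≡y) (++⁻ˡ q y∈′)

      -- Category preservation enters here: a meager image would have a meager preimage, and this
      -- preimage contains every generic point.
      image-nonmeager : ¬ Y.Meager (Image [])
      image-nonmeager meager =
        let 𝒩 = X.meager-family ℕ-countable (λ _ → Image [] ∘ f) (λ _ → preserving (Image []) meager)
            x , _ , gen = CX.baire (𝒟 X.⊕ 𝒩) [] (x₀ , [])
        in X.meager-family-avoids ℕ-countable (λ _ → Image [] ∘ f) (λ _ → preserving (Image []) meager)
             (λ i → gen (inj₂ i)) 0 (x , (λ i → gen (inj₁ i)) , [] , refl)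

      abstract
        initial : ∃ λ q → Y.Nonempty q × Y.EverywhereNonmeagerIn (Image []) q
        initial = Y.localize CY.index-countable {is = []} λ meager → image-nonmeager (Y.meager-⊆ (λ y∈ → y∈ , []) meager)

      q₀ : List Y.Index
      q₀ = proj₁ initial

      State : Set
      State = List X.Index × List Y.Index

      states : Countable State
      states = ×-countable (List-countable CX.index-countable) (List-countable CY.index-countable)

      cX : ℕ → X.Index
      cX = proj₁ CX.index-countable

      cY : ℕ → Y.Index
      cY = proj₁ CY.index-countable

      -- `detailed` makes the construction converge and `generic` keeps the limit generic; `decides`
      -- yields continuity of the inverse, and `decides-f` that `f` takes the limit back to `y`.
      record Approximation (k : ℕ) (is js : List X.Index) : Set where
        field
          refines   : X.Basic js ⊆ X.Basic is
          centre    : X.Point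
          centre∈   : centre ∈ X.Basic js
          detailed  : X.Basic js ⊆ X.Basic (CX.detail centre k)
          generic   : X.Basic js ⊆ D 𝒟 (proj₁ (countable 𝒟) k)
          decides   : (∀ {x} → x ∈ X.Basic js → x ∈ X.Sub (cX k)) ⊎ (∀ {x} → x ∈ X.Basic js → ¬ x ∈ X.Sub (cX k))
          decides-f : (∀ {x} → x ∈ X.Basic js → Gen 𝒟 x → f x ∈ Y.Sub (cY k)) ⊎
            (∀ {x} → x ∈ X.Basic js → Gen 𝒟 x → ¬ f x ∈ Y.Sub (cY k))

      abstract
        approximate : ∀ k is {x} → Gen 𝒟 x → x ∈ X.Basic is → ∃ λ js → x ∈ X.Basic js × Approximation k is js
        approximate k is {x} gen x∈ =
          let ks , x∈ks , ks⊆ = common in ks , x∈ks , record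
            { refines   = λ w∈ → proj₁ (ks⊆ w∈)
            ; centre    = x
            ; centre∈   = x∈ks
            ; detailed  = λ w∈ → proj₁ (proj₂ (ks⊆ w∈))
            ; generic   = λ w∈ → proj₁ (proj₂ (proj₂ (ks⊆ w∈)))
            ; decides   = case-decided (x ∈ X.Sub (cX k)) λ w∈ → proj₁ (proj₂ (proj₂ (proj₂ (ks⊆ w∈))))
            ; decides-f = case-decided (f x ∈ Y.Sub (cY k)) λ w∈ → proj₂ (proj₂ (proj₂ (proj₂ (ks⊆ w∈))))
            }
          where
          case-decided : ∀ (A : Set) {Q Q′ : Pred X.Point 0ℓ} {js} →
            (∀ {w} → w ∈ X.Basic js → (A → w ∈ Q) × (¬ A → w ∈ Q′)) →
            (∀ {w} → w ∈ X.Basic js → w ∈ Q) ⊎ (∀ {w} → w ∈ X.Basic js → w ∈ Q′)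
          case-decided A h with dec A
          ... | yes a = inj₁ λ w∈ → proj₁ (h w∈) a
          ... | no ¬a = inj₂ λ w∈ → proj₂ (h w∈) ¬a
          Follows Follows-f : Pred X.Point 0ℓ
          Follows w = (x ∈ X.Sub (cX k) → w ∈ X.Sub (cX k)) × (¬ x ∈ X.Sub (cX k) → ¬ w ∈ X.Sub (cX k))
          Follows-f w = (f x ∈ Y.Sub (cY k) → Gen 𝒟 w → f w ∈ Y.Sub (cY k)) ×
            (¬ f x ∈ Y.Sub (cY k) → Gen 𝒟 w → ¬ f w ∈ Y.Sub (cY k))
          decided : X.Interior Follows x
          decided with dec (x ∈ X.Sub (cX k))
          ... | yes x∈c = X.interior-⊆ x (λ w∈c → (λ _ → w∈c) , λ x∉c → contradiction x∈c x∉c) (X.interior-self x (cX k) x∈c)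
          ... | no  x∉c = let js , x∈js , disjoint = CX.complement (cX k) x∉c in
            js , x∈js , λ w∈js → (λ x∈c → contradiction x∈c x∉c) , λ _ → disjoint w∈js
          decided-f : X.Interior Follows-f x
          decided-f with dec (f x ∈ Y.Sub (cY k))
          ... | yes fx∈c = X.interior-⊆ x (λ fw∈c → (λ _ → fw∈c) , λ fx∉c →
            contradiction fx∈c fx∉c) (continuous gen (cY k) fx∈c)
          ... | no  fx∉c = let js , fx∈js , disjoint = CY.complement (cY k) fx∉c in
            X.interior-⊆ x (λ all → (λ fx∈c → contradiction fx∈c fx∉c) , λ _ w-gen →
              disjoint (ListAll.tabulate λ c∈ → all c∈ w-gen))
              (X.interior-all x js λ c∈ → continuous gen _ (ListAll.lookup fx∈js c∈))
          common : X.Interior (X.Basic is ∩ (X.Basic (CX.detail x k) ∩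
            (D 𝒟 (proj₁ (countable 𝒟) k) ∩ (Follows ∩ Follows-f)))) x
          common = X.interior-∩ x (X.interior-basic x is x∈)
            (X.interior-∩ x (X.interior-basic x (CX.detail x k) (CX.∈-detail x k))
            (X.interior-∩ x (isOpen 𝒟 (proj₁ (countable 𝒟) k) (gen _)) (X.interior-∩ x decided decided-f)))

      Decides : List Y.Index → ℕ → Set
      Decides q k = (∀ {y} → y ∈ Y.Basic q → y ∈ Y.Sub (cY k)) ⊎ (∀ {y} → y ∈ Y.Basic q → ¬ y ∈ Y.Sub (cY k))

      decides-⊆ : ∀ {p q k} → Y.Basic q ⊆ Y.Basic p → Decides p k → Decides q k
      decides-⊆ q⊆p (inj₁ inside)   = inj₁ λ y∈ → inside (q⊆p y∈)
      decides-⊆ q⊆p (inj₂ disjoint) = inj₂ λ y∈ → disjoint (q⊆p y∈)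

      record Successor (k : ℕ) (σ τ : State) : Set where
        field
          approximation : Approximation k (proj₁ σ) (proj₁ τ)
          shrinks       : Y.Basic (proj₂ τ) ⊆ Y.Basic (proj₂ σ)
          decides-y     : Decides (proj₂ τ) k
          still-large   : Large (proj₁ τ) (proj₂ τ)

      abstract
        -- The generic part of `is` is covered by countably many approximations, so one of them has
        -- a nonmeager image, which can be localized. The list `ls` directs the successor into any
        -- given part of `q`, as density requires.
        extend : ∀ k is q ls → Large is q → Y.Nonempty (q ++ ls) →
          ∃ λ τ → Successor k (is , q) τ × Y.Nonempty (proj₂ τ) × Y.Basic (proj₂ τ) ⊆ Y.Basic (q ++ ls)
        extend k is q ls is-large q∩ls≠∅ =
          let ks , ne , dec-y = split
              q₁ = q ++ (ls ++ ks)
              js , approximation , nonmeager = refine q₁ (large is-large (ls ++ ks) ne)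
              ms , ne′ , everywhere = Y.localize CY.index-countable nonmeager
              shrink = λ {y} (y∈ : y ∈ Y.Basic (q₁ ++ ms)) → ++⁻ˡ q₁ y∈
          in (js , q₁ ++ ms) , record
               { approximation = approximation
               ; shrinks       = λ y∈ → ++⁻ˡ q (shrink y∈)
               ; decides-y     = decides-⊆ {q₁} {q₁ ++ ms} {k} shrink dec-y
               ; still-large   = small everywhere
               } , ne′ , λ y∈ → ++⁺ (++⁻ˡ q (shrink y∈)) (++⁻ˡ ls (++⁻ʳ q (shrink y∈)))
          where
          split : ∃ λ ks → Y.Nonempty (q ++ (ls ++ ks)) × Decides (q ++ (ls ++ ks)) k
          split with dec (∃ λ y → y ∈ Y.Basic (q ++ ls) × y ∈ Y.Sub (cY k))
          ... | yes (y , y∈ , y∈c) = cY k ∷ [] , (y , ++⁺ (++⁻ˡ q y∈) (++⁺ (++⁻ʳ q y∈) (y∈c ∷ []))) ,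
                  inj₁ λ w∈ → ListAll.head (++⁻ʳ ls (++⁻ʳ q w∈))
          ... | no  none = let y , y∈ = q∩ls≠∅ in
                  [] , (y , ++⁺ (++⁻ˡ q y∈) (++⁺ (++⁻ʳ q y∈) [])) ,
                  inj₂ λ w∈ w∈c → none (_ , ++⁺ (++⁻ˡ q w∈) (++⁻ˡ ls (++⁻ʳ q w∈)) , w∈c)
          Piece : List Y.Index → List X.Index → Pred Y.Point 0ℓ
          Piece q₁ js y = Approximation k is js × y ∈ Image js × y ∈ Y.Basic q₁
          cover : ∀ q₁ → (Image is ∩ Y.Basic q₁) ⊆ λ y → ∃ λ js → y ∈ Piece q₁ js
          cover q₁ ((x , gen , x∈ , fx≡y) , y∈) =
            let js , x∈js , approximation = approximate k is gen x∈ in js , approximation , (x , gen , x∈js , fx≡y) , y∈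
          refine : ∀ q₁ → Y.NonmeagerIn (Image is) q₁ → ∃ λ js → Approximation k is js × Y.NonmeagerIn (Image js) q₁
          refine q₁ nonmeager =
            let js , nonmeager-js = Y.nonmeager-piece {S = Piece q₁} (List-countable CX.index-countable) (cover q₁) nonmeager
                y , approximation , _ = Y.nonmeager-inhabited {S = Piece q₁ js} nonmeager-js
            in js , approximation , λ meager → nonmeager-js (Y.meager-⊆ {S = Piece q₁ js} {T =
                Image js ∩ Y.Basic q₁} proj₂ meager)

      code : ℕ → State
      code = proj₁ states

      Admits : ℕ → State → Y.Point → Pred ℕ 0ℓ
      Admits k σ y i = Successor k σ (code i) × y ∈ Y.Basic (proj₂ (code i))

      step : ℕ → State → Y.Point → State
      step k σ y with dec (∃ (Admits k σ y))
      ... | yes some = code (proj₁ (least (Admits k σ y) some))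
      -- A dummy value: points without a successor are not live, and `ℰ` excludes them inside `q₀`.
      ... | no  _    = σ

      step-least : ∀ k σ y {i} → Least (Admits k σ y) i → step k σ y ≡ code i
      step-least k σ y {i} i-least with dec (∃ (Admits k σ y))
      ... | yes some = cong code (least-unique {Admits k σ y} (proj₂ (least (Admits k σ y) some)) i-least)
      ... | no  none = contradiction (i , proj₁ i-least) none

      state : ℕ → Y.Point → State
      state zero    y = [] , q₀
      state (suc k) y = step k (state k y) y

      Live : ℕ → Pred Y.Point 0ℓ
      Live k y = ∃ (Admits k (state k y) y)

      live-step : ∀ k y → Live k y → Successor k (state k y) (state (suc k) y) × y ∈ Y.Basic (proj₂ (state (suc k) y))
      live-step k y live = let i , i-least = least (Admits k (state k y) y) live in
        subst (λ τ → Successor k (state k y) τ × y ∈ Y.Basic (proj₂ τ)) (sym (step-least k (state k y) y i-least))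
          (proj₁ i-least)

      Constant : ℕ → Y.Point → Pred Y.Point 0ℓ
      Constant k y y′ = state k y′ ≡ state k y

      admits-interior : ∀ k σ y i → Admits k σ y i → Y.Interior (λ y′ → Admits k σ y′ i) y
      admits-interior k σ y i (successor , y∈) = Y.interior-⊆ y (λ y′∈ → successor ,
        y′∈) (Y.interior-basic y (proj₂ (code i)) y∈)

      rejects-interior : ∀ k σ y i → ¬ Admits k σ y i → Y.Interior (λ y′ → ¬ Admits k σ y′ i) y
      rejects-interior k σ y i ¬admits with dec (Successor k σ (code i))
      ... | no  ¬successor = [] , [] , λ _ admits → ¬successor (proj₁ admits)
      ... | yes successor  =
        let js , y∈ , disjoint = CY.basic-complement (proj₂ (code i)) λ y∈ → ¬admits (successor , y∈)
        in js , y∈ , λ w∈ admits → disjoint w∈ (proj₂ admits)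

      abstract
        constant-interior : ∀ k y → (∀ {j} → j < k → Live j y) → Y.Interior (Constant k y) y
        constant-interior zero    y _    = [] , [] , λ _ → refl
        constant-interior (suc k) y live =
          let σ = state k y
              i , i-least = least (Admits k σ y) (live ≤-refl)
          in Y.interior-⊆ y (λ {y′} (same , admits , below) → trans (cong (λ σ → step k σ y′) same)
               (trans (step-least k σ y′ (admits , λ j j<i → below (∈-upTo⁺ j<i))) (sym (step-least k σ y i-least))))
             (Y.interior-∩ y (constant-interior k y (λ j<k → live (m<n⇒m<1+n j<k)))
               (Y.interior-∩ y (admits-interior k σ y i (proj₁ i-least))
                 (Y.interior-all y (upTo i) λ {j} j∈ → rejects-interior k σ y j (proj₂ i-least j (∈-upTo⁻ j∈)))))

        live-interior : ∀ k y → (∀ {j} → j < suc k → Live j y) → Y.Interior (Live k) y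
        live-interior k y live =
          let i , admits = live ≤-refl
          in Y.interior-⊆ y (λ {y′} (same , admits′) → i , subst (λ σ → Admits k σ y′ i) (sym same) admits′)
               (Y.interior-∩ y (constant-interior k y (λ j<k → live (m<n⇒m<1+n j<k)))
                 (admits-interior k (state k y) y i admits))

      LiveBelow : ℕ → Pred Y.Point 0ℓ
      LiveBelow k y = ∀ {j} → j ∈ˡ upTo k → Live j y

      liveBelow-suc : ∀ {k y} → LiveBelow k y → Live k y → LiveBelow (suc k) y
      liveBelow-suc live live-k j∈ with m<1+n⇒m<n∨m≡n (∈-upTo⁻ j∈)
      ... | inj₁ j<k  = live (∈-upTo⁺ j<k)
      ... | inj₂ refl = live-k

      abstract
        liveBelow-interior : ∀ k y → LiveBelow k y → Y.Interior (LiveBelow k) y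
        liveBelow-interior k y live = Y.interior-all y (upTo k) λ {j} j∈ →
          live-interior j y λ i<1+j → live (∈-upTo⁺ (≤-trans i<1+j (∈-upTo⁻ j∈)))

        valid : ∀ k y → y ∈ Y.Basic q₀ → LiveBelow k y → Large (proj₁ (state k y)) (proj₂ (state k y)) ×
          y ∈ Y.Basic (proj₂ (state k y))
        valid zero    y y∈ _    = small (proj₂ (proj₂ initial)) , y∈
        valid (suc k) y y∈ live =
          let successor , y∈′ = live-step k y (live (∈-upTo⁺ ≤-refl)) in Successor.still-large successor , y∈′

      -- The state is constant near `y`, so a successor that `extend` finds within this
      -- neighbourhood is admissible at the new point too.
      live-extend : ∀ k js y → y ∈ Y.Basic (q₀ ++ js) → LiveBelow k y → ∃ λ y′ → y′ ∈ Y.Basic (q₀ ++ js) ×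
        LiveBelow (suc k) y′
      live-extend k js y y∈ live
        with valid k y (++⁻ˡ q₀ y∈) live
           | Y.interior-∩ y (constant-interior k y λ j<k → live (∈-upTo⁺ j<k)) (liveBelow-interior k y live)
      ... | is-large , y∈q | ks , y∈ks , ks⊆
        with extend k (proj₁ (state k y)) (proj₂ (state k y)) ((q₀ ++ js) ++ ks) is-large (y , ++⁺ y∈q (++⁺ y∈ y∈ks))
      ... | τ , successor , (y′ , y′∈) , τ⊆ with ++⁻ʳ (proj₂ (state k y)) (τ⊆ y′∈) | proj₂ states τ
      ... | y′∈rest | i , refl with ks⊆ (++⁻ʳ (q₀ ++ js) y′∈rest)
      ... | same , live′ = y′ , ++⁻ˡ (q₀ ++ js) y′∈rest ,
        liveBelow-suc live′ (i , subst (λ σ → Admits k σ y′ i) (sym same) (successor , y′∈))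

      live-dense : ∀ k js → Y.Nonempty (q₀ ++ js) → ∃ λ y → y ∈ Y.Basic (q₀ ++ js) × LiveBelow k y
      live-dense zero    js (y , y∈) = y , y∈ , λ ()
      live-dense (suc k) js ne = let y , y∈ , live = live-dense k js ne in live-extend k js y y∈ live

      ℰ : Y.Family
      ℰ = record
        { I         = ℕ
        ; countable = ℕ-countable
        ; D         = λ k y → y ∈ Y.Basic q₀ → LiveBelow k y
        ; isOpen    = λ k → open-live k
        ; isDense   = dense-live
        }
        where
        open-live : ∀ k {y} → (y ∈ Y.Basic q₀ → LiveBelow k y) → Y.Interior (λ y → y ∈ Y.Basic q₀ → LiveBelow k y) y
        open-live k {y} live with dec (y ∈ Y.Basic q₀)
        ... | yes y∈ = Y.interior-⊆ y (λ live′ _ → live′) (liveBelow-interior k y (live y∈))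
        ... | no  y∉ = let js , y∈js , disjoint = CY.basic-complement q₀ y∉ in
          js , y∈js , λ w∈ w∈q₀ → contradiction w∈q₀ (disjoint w∈)
        dense-live : ∀ k → Y.Dense λ y → y ∈ Y.Basic q₀ → LiveBelow k y
        dense-live k js (y , y∈js) with dec (y ∈ Y.Basic q₀)
        ... | yes y∈ = let y′ , y′∈ , live = live-dense k js (y , ++⁺ y∈ y∈js) in y′ , ++⁻ʳ q₀ y′∈ , λ _ → live
        ... | no  y∉ = y , y∈js , λ y∈ → contradiction y∈ y∉

      Good : Pred Y.Point 0ℓ
      Good y = Y.Family.Gen ℰ y × y ∈ Y.Basic q₀

      module Preimage (y : Y.Point) (y-good : Good y) where
        live : ∀ k → LiveBelow k y
        live k = proj₁ y-good k (proj₂ y-good)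

        successor : ∀ k → Successor k (state k y) (state (suc k) y)
        successor k = proj₁ (live-step k y (live (suc k) (∈-upTo⁺ ≤-refl)))

        module A k = Approximation (Successor.approximation (successor k))

        sequence : CX.FusionSequence
        sequence = record
          { z       = λ k → A.centre k
          ; B       = λ k → proj₁ (state (suc k) y)
          ; z∈B     = λ k → A.centre∈ k
          ; nested  = λ k → A.refines (suc k)
          ; details = λ k → A.detailed k
          }
        open CX.FusionSequence sequence public using (z∞; z∞∈B)

        z∞-gen : Gen 𝒟 z∞
        z∞-gen i = let k , eq = proj₂ (countable 𝒟) i in subst (λ i → z∞ ∈ D 𝒟 i) eq (A.generic k (z∞∈B k))

        -- Were `f` to avoid the set on the whole approximation, largeness would still give a
        -- generic point there with image in the current neighbourhood of `y`, and this
        -- neighbourhood is contained in the set.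
        image-of-z∞ : ∀ c → y ∈ Y.Sub c → f z∞ ∈ Y.Sub c
        image-of-z∞ c y∈c with proj₂ CY.index-countable c
        ... | k , refl with A.decides-f k
        ...   | inj₁ inside = inside (z∞∈B k) z∞-gen
        ...   | inj₂ disjoint with valid (suc k) y (proj₂ y-good) (live (suc k)) | Successor.decides-y (successor k)
        ...     | _ , y∈q           | inj₂ y-disjoint = contradiction y∈c (y-disjoint y∈q)
        ...     | is-large , y∈q    | inj₁ y-inside   =
          let x , gen , x∈ , fx∈ = large-inhabited is-large (y , y∈q) in contradiction (y-inside fx∈) (disjoint x∈ gen)

      choose : ∀ y → Dec (Good y) → X.Point
      choose y (yes good) = Preimage.z∞ y good
      choose y (no  _)    = x₀

      inverse : Y.Point → X.Point
      inverse y = choose y (dec (Good y))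

      inverse-preimage : ∀ {y} → Good y → ∃ λ good → inverse y ≡ Preimage.z∞ y good
      inverse-preimage {y} good with dec (Good y)
      ... | yes good′ = good′ , refl
      ... | no  ¬good = contradiction good ¬good

      inverse-image : ∀ {y} → Good y → ∀ c → y ∈ Y.Sub c → f (inverse y) ∈ Y.Sub c
      inverse-image good c y∈c = let good′ , eq = inverse-preimage good in
        subst (λ x → f x ∈ Y.Sub c) (sym eq) (Preimage.image-of-z∞ _ good′ c y∈c)

      inverse-basic : ∀ {y} → Good y → ∀ k → inverse y ∈ X.Basic (proj₁ (state (suc k) y))
      inverse-basic {y} good k = let good′ , eq = inverse-preimage good in
        subst (λ x → x ∈ X.Basic (proj₁ (state (suc k) y))) (sym eq) (Preimage.z∞∈B _ good′ k)

      inverse-continuous : ∀ {y} → Good y → ∀ c → inverse y ∈ X.Sub c → Y.Interior (λ w → Good w → inverse w ∈ X.Sub c) y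
      inverse-continuous {y} good c ∈c with proj₂ CX.index-countable c
      ... | k , refl with Preimage.A.decides y good k
      ...   | inj₂ disjoint = contradiction ∈c (disjoint (inverse-basic good k))
      ...   | inj₁ inside   = Y.interior-⊆ y
        (λ {w} same w-good → inside (subst (λ σ → inverse w ∈ X.Basic (proj₁ σ)) same (inverse-basic w-good k)))
        (constant-interior (suc k) y λ j< → Preimage.live y good (suc k) (∈-upTo⁺ j<))

  -- The cases of decreasing and increasing dimension

  module Reductions where
    -- One inclusion suffices, since conditions fix function values and both truth values of
    -- relations.
    refines-≗ : ∀ {L : Language} {M N : Structure L ℕ} → (∀ c → M ∈ ⟦ c ⟧ → N ∈ ⟦ c ⟧) → M ≗ N
    refines-≗ {L} {M} {N} M⊆N = record { fun-≗ = λ f t → sym (M⊆N (value f t (fun M f t)) refl) ; rel-≗ = same-rel }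
      where
      same-rel : ∀ r t → rel M r t ≡ rel N r t
      same-rel r t with rel M r t in eq
      ... | true  = sym (M⊆N (holds r t) eq)
      ... | false = sym (M⊆N (fails r t) eq)

    module _ (m n : ℕ) .{{_ : NonZero m}} .{{_ : NonZero n}}
      (reduction : *-Reduction (Modω (𝓑̂ m)) (Modω (𝓑̂ n)) (Iso (𝓑̂ m)) (Iso (𝓑̂ n))) where
      open *-Reduction reduction
      private
        module X = Models m
        module Y = Models n
      open Maps (Modω (𝓑̂ m)) (Modω (𝓑̂ n))

      𝒟 : X.Family
      𝒟 = continuity Y.cond-countable f baireMeasurable

      f-continuous : ContinuousOn (X.Family.Gen 𝒟) f
      f-continuous {x} = continuity-continuous Y.cond-countable f baireMeasurable {x}

      lowering-impossible : n < m → ⊥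
      lowering-impossible n<m = Core.no-continuous-reduction m n n<m 𝒟 [] (Blocks.inhabitant m , []) f
        (λ {z} good c fz∈ → X.interior-⊆ z (λ fw∈ w-good → fw∈ (proj₁ w-good)) (f-continuous {z} (proj₁ good) c fz∈))
        (λ {z} {w} _ _ → Equivalence.to (reduces z w))
        (λ {z} {w} _ _ → Equivalence.from (reduces z w))

      -- For good `y` the structure `f (inverse y)` is isomorphic to `y`. Read backwards, the
      -- equivalence for `f` thus makes `inverse` a reduction from the larger dimension to the
      -- smaller one.
      raising-impossible : m < n → ⊥
      raising-impossible m<n = Core.no-continuous-reduction n m m<n ℰ q₀ (proj₁ (proj₂ initial)) inverse
        (λ {y} → inverse-continuous {y})
        (λ {y} {y′} good good′ τ → Equivalence.from (reduces (inverse y) (inverse y′))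
          (≅-trans (≅-sym (preimage {y} good)) (≅-trans τ (preimage {y′} good′))))
        (λ {y} {y′} good good′ τ → ≅-trans (preimage {y} good)
          (≅-trans (Equivalence.to (reduces (inverse y) (inverse y′)) τ) (≅-sym (preimage {y′} good′))))
        where
        open Uniformization (Modω (𝓑̂ m)) (Modω (𝓑̂ n)) X.complete Y.complete
        open RightInverse (Blocks.inhabitant m) f categoryPreserving 𝒟 (λ {x} → f-continuous {x})
        preimage : ∀ {y} → Good y → proj₁ y ≅ proj₁ (f (inverse y))
        preimage {y} good = ≗⇒≅ (refines-≗ (inverse-image {y} good))

corollary11 : (∀ ℓ → ExcludedMiddle ℓ) → (m n : ℕ) .{{_ : NonZero m}} .{{_ : NonZero n}} → m ≢ n → ¬ *-Reduction (Modω (𝓑̂ m)) (Modω (𝓑̂ n)) (Iso (𝓑̂ m)) (Iso (𝓑̂ n))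
corollary11 em m n m≢n reduction with <-cmp m n
... | tri< m<n _ _ = Reductions.raising-impossible em m n reduction m<n
... | tri≈ _ m≡n _ = m≢n m≡n
... | tri> _ _ n<m = Reductions.lowering-impossible em m n reduction n<m
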